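{- Let $S_1$ and $S_2$ be strings over a constant-size alphabet, and let $d$ be the edit distance between $S_1$ and $S_2$ (the minimum number of single-character insertions, deletions and substitutions needed to change $S_1$ into $S_2$). Given a data structure supporting select queries on $S_1$, one can store $O(d)$ additional words and support any select query on $S_2$ using $O(\log \log (|S_1| + |S_2|))$ time in addition to the time of one select query on $S_1$.
   Context: Model: word-RAM with words of $\Omega(\log(|S_1|+|S_2|))$ bits; the alphabet size is constant. For a string $S$, a character $a$ and a positive integer $j$, the query $S.\mathrm{select}_a(j)$ returns the position of the $j$th leftmost occurrence of $a$ in $S$. Similarly $S.\mathrm{rank}_a(i)$ returns the number of occurrences of $a$ in the prefix of $S$ of length $i$. -}

module Defs where

open import Data.Bool.Base using (Bool; true; false; _∧_; _∨_; _xor_; if_then_else_)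
open import Data.Fin.Base using (Fin; toℕ)
open import Data.List.Base using (List; []; _∷_; length; sum; map; allFin)
open import Data.Nat.Base using (ℕ; zero; suc; _+_; _*_; _∸_; _^_; _≤_; _≡ᵇ_; _<ᵇ_; ⌊_/2⌋)
open import Data.Nat.DivMod using (_/_; _%_; _mod_)
open import Data.Nat.Properties using (m^n≢0)
open import Data.Product.Base using (_×_; ∃-syntax)
open import Relation.Binary.PropositionalEquality.Core using (_≡_; _≢_)

Str : ℕ → Set
Str σ = List (Fin σ)

infix 4 _⇝_ _⇝[_]_

data _⇝_ {σ : ℕ} : Str σ → Str σ → Set where
  insert     : ∀ {c xs} → xs ⇝ c ∷ xs
  delete     : ∀ {c xs} → c ∷ xs ⇝ xs
  substitute : ∀ {b c xs} → b ∷ xs ⇝ c ∷ xs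
  later      : ∀ {c xs ys} → xs ⇝ ys → c ∷ xs ⇝ c ∷ ys

data _⇝[_]_ {σ : ℕ} : Str σ → ℕ → Str σ → Set where
  done : ∀ {xs} → xs ⇝[ 0 ] xs
  step : ∀ {xs ys zs m} → xs ⇝ ys → ys ⇝[ m ] zs → xs ⇝[ suc m ] zs

IsEditDistance : {σ : ℕ} → Str σ → Str σ → ℕ → Set
IsEditDistance S₁ S₂ d = S₁ ⇝[ d ] S₂ × (∀ m → S₁ ⇝[ m ] S₂ → d ≤ m)

-- Select S a j p: the jth leftmost occurrence of a in S exists and is at
-- position p.  Both j and p count from 1.
data Select {σ : ℕ} : Str σ → Fin σ → ℕ → ℕ → Set where
  first : ∀ {a S} → Select (a ∷ S) a 1 1
  hit   : ∀ {a S j p} → Select S a j p → Select (a ∷ S) a (suc j) (suc p)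
  miss  : ∀ {a c S j p} → c ≢ a → Select S a j p → Select (c ∷ S) a j (suc p)

record Word (w : ℕ) : Set where
  constructor mkWord
  field
    index : Fin (2 ^ w)

  value : ℕ
  value = toℕ index

open Word public using (value)

word : (w : ℕ) → ℕ → Word w
word w n = mkWord (_mod_ n (2 ^ w) {{m^n≢0 2 w}})

data Op : Set where
  add sub mul div rem and or xor shl shr : Op

quotient : ℕ → ℕ → ℕ
quotient x zero    = 0
quotient x (suc y) = x / suc y

remainder : ℕ → ℕ → ℕ
remainder x zero    = x
remainder x (suc y) = x % suc y

bitwise : (Bool → Bool → Bool) → ℕ → ℕ → ℕ → ℕ
bitwise f zero    x y = 0
bitwise f (suc w) x y =
  (if f (x % 2 ≡ᵇ 1) (y % 2 ≡ᵇ 1) then 1 else 0) + 2 * bitwise f w ⌊ x /2⌋ ⌊ y /2⌋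

-- The value before reduction modulo 2 ^ w.
evalℕ : ℕ → Op → ℕ → ℕ → ℕ
evalℕ w add x y = x + y
evalℕ w sub x y = x + (2 ^ w ∸ y)
evalℕ w mul x y = x * y
evalℕ w div x y = quotient x y
evalℕ w rem x y = remainder x y
evalℕ w and x y = bitwise _∧_ w x y
evalℕ w or  x y = bitwise _∨_ w x y
evalℕ w xor x y = bitwise _xor_ w x y
evalℕ w shl x y = x * 2 ^ y
evalℕ w shr x y = quotient x (2 ^ y)

eval : {w : ℕ} → Op → Word w → Word w → Word w
eval {w} o x y = word w (evalℕ w o (value x) (value y))

Reg : Set
Reg = ℕ

data Test : Set where
  _≺_ _≈_ : Reg → Reg → Test

-- Programs with access to k stored arrays and to a black box for select
-- queries on a string over Fin σ.  A program mentions only finitely many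
-- registers, and these are its only working space: the stored arrays are
-- read-only, so a query leaves the data structure as it was.
data Program (σ k : ℕ) : Set where
  skip    : Program σ k
  literal : Reg → ℕ → Program σ k
  binop   : Reg → Op → Reg → Reg → Program σ k
  load    : Reg → Fin k → Reg → Program σ k
  select  : Reg → Fin σ → Reg → Program σ k
  seq     : Program σ k → Program σ k → Program σ k
  branch  : Test → Program σ k → Program σ k → Program σ k
  while   : Test → Program σ k → Program σ k

Store : ℕ → ℕ → Set
Store k w = Fin k → List (Word w)

words : {k w : ℕ} → Store k w → ℕ
words {k} D = sum (map (λ b → length (D b)) (allFin k))

-- Cells beyond the end of a stored array read as 0.
cell : {w : ℕ} → List (Word w) → ℕ → Word w
cell {w} []       i       = word w 0
cell     (x ∷ xs) zero    = x
cell     (x ∷ xs) (suc i) = cell xs i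

Regs : ℕ → Set
Regs w = Reg → Word w

_[_≔_] : {w : ℕ} → Regs w → Reg → Word w → Regs w
(ρ [ r ≔ x ]) s = if s ≡ᵇ r then x else ρ s

input : {w : ℕ} → Word w → Regs w
input {w} x = (λ _ → word w 0) [ 0 ≔ x ]

test : {w : ℕ} → Test → Regs w → Bool
test (r ≺ s) ρ = value (ρ r) <ᵇ value (ρ s)
test (r ≈ s) ρ = value (ρ r) ≡ᵇ value (ρ s)

-- Run S D P ρ ρ′ t q: with stored arrays D and a black box for select
-- queries on S, the program P takes registers ρ to ρ′ in t steps and q
-- queries to the black box, where queries are not counted as steps.  The
-- black box is only specified on occurrences that exist, so any other
-- query has no run.
data Run {σ k w : ℕ} (S : Str σ) (D : Store k w) :
         Program σ k → Regs w → Regs w → ℕ → ℕ → Set where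
  skip    : ∀ {ρ} → Run S D skip ρ ρ 0 0
  literal : ∀ {ρ r n} → Run S D (literal r n) ρ (ρ [ r ≔ word w n ]) 1 0
  binop   : ∀ {ρ r o s s′} →
            Run S D (binop r o s s′) ρ (ρ [ r ≔ eval o (ρ s) (ρ s′) ]) 1 0
  load    : ∀ {ρ r b s} →
            Run S D (load r b s) ρ (ρ [ r ≔ cell (D b) (value (ρ s)) ]) 1 0
  select  : ∀ {ρ r a s} (x : Word w) → Select S a (value (ρ s)) (value x) →
            Run S D (select r a s) ρ (ρ [ r ≔ x ]) 0 1
  seq     : ∀ {P Q ρ ρ′ ρ″ t t′ q q′} →
            Run S D P ρ ρ′ t q → Run S D Q ρ′ ρ″ t′ q′ →
            Run S D (seq P Q) ρ ρ″ (t + t′) (q + q′)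
  then-   : ∀ {c P Q ρ ρ′ t q} → test c ρ ≡ true → Run S D P ρ ρ′ t q →
            Run S D (branch c P Q) ρ ρ′ (suc t) q
  else-   : ∀ {c P Q ρ ρ′ t q} → test c ρ ≡ false → Run S D Q ρ ρ′ t q →
            Run S D (branch c P Q) ρ ρ′ (suc t) q
  exit    : ∀ {c P ρ} → test c ρ ≡ false → Run S D (while c P) ρ ρ 1 0
  loop    : ∀ {c P ρ ρ′ ρ″ t t′ q q′} → test c ρ ≡ true →
            Run S D P ρ ρ′ t q → Run S D (while c P) ρ′ ρ″ t′ q′ →
            Run S D (while c P) ρ ρ″ (suc (t + t′)) (q + q′)

-- Program P, given j in register 0, leaves in register 0 the answer to
-- select_a(j) on S₂, in at most t steps besides at most q select queries
-- on S₁.  The alphabet has constant size, so the character may be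
-- dispatched on in advance: each a has its own program.
AnswersSelect : {σ k w : ℕ} (S₁ S₂ : Str σ) → Store k w →
                Program σ k → Fin σ → (t q : ℕ) → Set
AnswersSelect {w = w} S₁ S₂ D P a t q =
  ∀ (j : Word w) p → Select S₂ a (value j) p →
  ∃[ ρ ] ∃[ t′ ] ∃[ q′ ]
    (Run S₁ D P (input j) ρ t′ q′ × value (ρ 0) ≡ p × t′ ≤ t × q′ ≤ q)

-- An alignment with O(d) insertions and deletions cuts S₂, for each
-- character, into O(d) pieces on which select agrees with select on S₁ up to
-- shifts of rank and position.  A query is thus a predecessor search among
-- the ranks at which the pieces begin, done with a y-fast trie.  Let L be the
-- bit length of n.  Every 8L-th rank is put into a binary trie of height L;
-- the at most L nodes above each of them are kept in a two-level perfect hash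
-- table of linear size, and a binary search over the depth finds the deepest
-- node above the queried rank, hence its position among these ranks.  A binary
-- search among 8L consecutive pieces completes the query, so both searches
-- take O(log L) steps.  The hash functions are x ↦ (a x mod 2 ^ w) / 2 ^ t with
-- odd a, which need no products longer than a word; good multipliers a exist
-- by averaging the number of collisions over all of them.

module Submission where

open import Defs
open import Data.Bool.Base using (Bool; T; false; if_then_else_; true)
open import Data.Empty using (⊥-elim)
open import Data.Fin using (#_)
open import Data.Fin.Base using (Fin; combine; fromℕ<; remQuot; suc; zero)
open import Data.Fin.Properties as Fin
  using (fromℕ<-injective; injective⇒≤; remQuot-combine; toℕ-fromℕ<; toℕ<n)
open import Data.List.Base
  using (List; []; _++_; _∷_; allFin; applyUpTo; cartesianProductWith; deduplicate;
    filter; length; lookup; map; tabulate; upTo)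
open import Data.List.Membership.Propositional using (_∈_)
open import Data.List.Membership.Propositional.Properties
  using (∈-cartesianProductWith⁺; ∈-cartesianProductWith⁻; ∈-deduplicate⁺;
    ∈-deduplicate⁻; ∈-filter⁺; ∈-filter⁻; ∈-lookup; ∈-upTo⁺; ∈-upTo⁻)
open import Data.List.Properties
  using (length-++; length-applyUpTo; length-deduplicate; length-map; length-tabulate;
    length-upTo; upTo-∷ʳ)
open import Data.List.Relation.Unary.All as All using (All; []; _∷_)
import Data.List.Relation.Unary.All.Properties as All
open import Data.List.Relation.Unary.AllPairs using ([]; _∷_)
open import Data.List.Relation.Unary.Any using (here; there)
open import Data.List.Relation.Unary.Unique.Propositional using (Unique)
open import Data.Nat.Base
open import Data.Nat.DivMod
open import Data.Nat.Divisibility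
  using (*-cancelˡ-∣; *-monoʳ-∣; 1∣_; >⇒∤; _∣_; divides; m∣m*n; n∣m*n; ∣-trans;
    ∣m+n∣m⇒∣n; ∣⇒≤)
open import Data.Nat.Induction using (<-rec)
open import Data.Nat.ListAction using (sum)
open import Data.Nat.Logarithm
open import Data.Nat.Properties
import Data.List.Relation.Unary.Unique.DecPropositional.Properties _≟_ as Uniqueness
open import Data.Nat.Tactic.RingSolver using (solve-∀)
open import Data.Product.Base using (_,_; _×_; proj₁; proj₂; Σ-syntax; ∃-syntax)
open import Data.Sum.Base using (_⊎_; inj₁; inj₂)
open import Data.Unit.Base using (tt; ⊤)
open import Data.Vec.Base as Vec using (Vec; []; _∷_)
open import Function.Base using (_$_; _∘_; case_of_)
open import Relation.Binary.PropositionalEquality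
open import Relation.Nullary using (Dec; contradiction; does; no; yes; ¬_)
open import Relation.Unary using (Decidable)

-- Two tight resources shape the construction. If the strings are equal, not a single word may be
-- stored, although the program is the same. Absent cells read as 0, so the piece with all fields 0
-- is made the identity and the number of trie representatives is read as 0: empty arrays already
-- describe `select` on S₁. The piece of rank 0 is therefore implicit, and is written out only once
-- some edit pays for it.
--
-- Words are only assumed to hold n, without a constant factor to spare. Hence every stored number,
-- every table offset and every intermediate sum must be shown to fit, the multipliers of the hash
-- functions are analysed modulo the word size itself, the alphabet's arrays are kept separate
-- instead of being concatenated, and the trie omits its leaves, whose codes could need one bit too
-- many. The time bound depends on n alone, so the height of the trie comes from n, not from the
-- word length, which may be much larger.

-- Residues modulo powers of two

infixl 7 _mod2^_ _div2^_

-- Sealed together with the `NonZero` evidence, so that both operations stay atomic in later goals.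
opaque
  _mod2^_ : ℕ → ℕ → ℕ
  x mod2^ w = _%_ x (2 ^ w) {{m^n≢0 2 w}}

  _div2^_ : ℕ → ℕ → ℕ
  x div2^ w = _/_ x (2 ^ w) {{m^n≢0 2 w}}

  mod+div : ∀ x w → x ≡ x mod2^ w + x div2^ w * 2 ^ w
  mod+div x w = m≡m%n+[m/n]*n x (2 ^ w) {{m^n≢0 2 w}}

  mod<2^ : ∀ x w → x mod2^ w < 2 ^ w
  mod<2^ x w = m%n<n x (2 ^ w) {{m^n≢0 2 w}}

  mod-small : ∀ {x} w → x < 2 ^ w → x mod2^ w ≡ x
  mod-small w = m<n⇒m%n≡m {{m^n≢0 2 w}}

  div<2^ : ∀ {x} s t → x < 2 ^ (s + t) → x div2^ t < 2 ^ s
  div<2^ {x} s t p = m<n*o⇒m/o<n {n = 2 ^ s} {{m^n≢0 2 t}} (subst (x <_) (^-distribˡ-+-* 2 s t) p)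

  mod-+* : ∀ x k w → (x + k * 2 ^ w) mod2^ w ≡ x mod2^ w
  mod-+* x k w = [m+kn]%n≡m%n x k (2 ^ w) {{m^n≢0 2 w}}

0<2^ : ∀ n → 0 < 2 ^ n
0<2^ n = m^n>0 2 n

infix 4 _≡_[mod2^_]

-- Multiples on both sides keep the congruence symmetric without subtraction.
_≡_[mod2^_] : ℕ → ℕ → ℕ → Set
x ≡ y [mod2^ w ] = ∃[ p ] ∃[ q ] x + p * 2 ^ w ≡ y + q * 2 ^ w

mod-cong : ∀ {x y w} → x ≡ y [mod2^ w ] → x mod2^ w ≡ y mod2^ w
mod-cong {x} {y} {w} (p , q , e) = begin
  x mod2^ w               ≡⟨ mod-+* x p w ⟨
  (x + p * 2 ^ w) mod2^ w ≡⟨ cong (_mod2^ w) e ⟩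
  (y + q * 2 ^ w) mod2^ w ≡⟨ mod-+* y q w ⟩
  y mod2^ w               ∎
  where open ≡-Reasoning

evenOrOdd : ∀ n → ∃[ m ] (n ≡ 2 * m ⊎ n ≡ 1 + 2 * m)
evenOrOdd zero = 0 , inj₁ refl
evenOrOdd (suc n) with evenOrOdd n
... | m , inj₁ e = m , inj₂ (cong suc e)
... | m , inj₂ e = suc m , inj₁ (trans (cong suc e) (sym (*-suc 2 m)))

∣m+n∣n⇒∣m : ∀ {d m n} → d ∣ m + n → d ∣ n → d ∣ m
∣m+n∣n⇒∣m {d} {m} {n} d∣m+n = ∣m+n∣m⇒∣n (subst (d ∣_) (+-comm m n) d∣m+n)

2∤1+2* : ∀ m → ¬ 2 ∣ 1 + 2 * m
2∤1+2* m d = contradiction (∣⇒≤ (∣m+n∣m⇒∣n (subst (2 ∣_) (+-comm 1 (2 * m)) d) (m∣m*n m))) λ { (s≤s ()) }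

-- Odd numbers are units modulo powers of two. By induction on `w`: an even product with an odd
-- factor makes `x` even, and one factor 2 cancels on both sides.
2^∣odd* : ∀ w i {x} → 2 ^ w ∣ (1 + 2 * i) * x → 2 ^ w ∣ x
2^∣odd* zero i d = 1∣ _
2^∣odd* (suc w) i {x} d with evenOrOdd x
... | y , inj₁ refl = *-monoʳ-∣ 2 (2^∣odd* w i {y} (*-cancelˡ-∣ 2 (subst (2 * 2 ^ w ∣_) (lemma i y) d)))
  where
  lemma : ∀ i y → (1 + 2 * i) * (2 * y) ≡ 2 * ((1 + 2 * i) * y)
  lemma = solve-∀
... | y , inj₂ refl = contradiction (subst (2 ∣_) (lemma i y) (∣-trans (m∣m*n (2 ^ w)) d)) (2∤1+2* (i + y + 2 * (i * y)))
  where
  lemma : ∀ i y → (1 + 2 * i) * (1 + 2 * y) ≡ 1 + 2 * (i + y + 2 * (i * y))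
  lemma = solve-∀

odd-cancel-≤ : ∀ w y {a b} p q → a ≤ b → a * (1 + 2 * y) + p * 2 ^ w ≡ b * (1 + 2 * y) + q * 2 ^ w →
               ∃[ k ] a + k * 2 ^ w ≡ b
odd-cancel-≤ w y {a} p q a≤b e with m≤n⇒∃[o]m+o≡n a≤b
... | δ , refl = let divides k δ≡ = 2^∣odd* w y w∣ in k , cong (a +_) (sym δ≡)
  where
  lemma : ∀ a δ z Q → (a + δ) * z + Q ≡ a * z + (z * δ + Q)
  lemma = solve-∀
  w∣ : 2 ^ w ∣ (1 + 2 * y) * δ
  w∣ = ∣m+n∣n⇒∣m
    (divides p (sym (+-cancelˡ-≡ (a * (1 + 2 * y)) _ _ (trans e (lemma a δ (1 + 2 * y) (q * 2 ^ w))))))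
    (n∣m*n q)

odd-cancel : ∀ w y a b → a * (1 + 2 * y) ≡ b * (1 + 2 * y) [mod2^ w ] → a ≡ b [mod2^ w ]
odd-cancel w y a b (p , q , e) with ≤-total a b
... | inj₁ a≤b = let k , e′ = odd-cancel-≤ w y p q a≤b e in k , 0 , trans e′ (sym (+-identityʳ b))
... | inj₂ b≤a = let k , e′ = odd-cancel-≤ w y q p b≤a (sym e) in 0 , k , trans (+-identityʳ a) (sym e′)

-- Multiply-shift hashing

-- For the odd multiplier 1 + 2i the product with z lies, modulo 2 ^ w,
-- strictly between -2 ^ t and 2 ^ t; u is that residue plus 2 ^ t.
Near : (t w z i : ℕ) → Set
Near t w z i = ∃[ u ] (0 < u × u < 2 ^ suc t × (1 + 2 * i) * z + 2 ^ t ≡ u [mod2^ w ])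

-- A counting bound in the form of an injection: up to congruence modulo 2 ^ w, at most 2 ^ t odd
-- multipliers bring `z` near 0. Colliding multipliers will be counted through these codes.
record NearCode (t w z : ℕ) : Set where
  field
    code    : ∀ i → Near t w z i → ℕ
    code<   : ∀ i n → code i n < 2 ^ t
    code-injective : ∀ i j n m → code i n ≡ code j m → 1 + 2 * i ≡ 1 + 2 * j [mod2^ w ]

open NearCode

2*-+-injective : ∀ {a b c d} → c < 2 → d < 2 → c + 2 * a ≡ d + 2 * b → c ≡ d × a ≡ b
2*-+-injective {a} {b} {0} {0} _ _ e = refl , *-cancelˡ-≡ a b 2 e
2*-+-injective {a} {b} {1} {1} _ _ e = refl , *-cancelˡ-≡ a b 2 (suc-injective e)
2*-+-injective {a} {b} {0} {1} _ _ e = contradiction (divides a (trans (sym e) (*-comm 2 a))) (2∤1+2* b)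
2*-+-injective {a} {b} {1} {0} _ _ e = contradiction (divides b (trans e (*-comm 2 b))) (2∤1+2* a)
2*-+-injective {c = suc (suc _)} (s≤s (s≤s ())) _ _
2*-+-injective {d = suc (suc _)} _ (s≤s (s≤s ())) _

-- Factors 2 are stripped from `z`. If `z` is odd, `u` is odd and determines the multiplier modulo 2
-- ^ w, so half of `u` is a code. If `z` is even, so is `u`; halving everything recovers the
-- multiplier only modulo half the modulus, and its lost top bit is added to the recursive code,
-- which doubles the bound as `t` grows by one.
nearCode : ∀ t w z → 0 < z → z < 2 ^ w → NearCode t w z
nearCode t zero z 0<z z<1 = contradiction (<-≤-trans z<1 0<z) (<-irrefl refl)
-- Only `u = 1` is left, so the product, and with it `z`, would be divisible by the modulus.
nearCode zero (suc w) z 0<z z<W = record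
  { code = λ i n → ⊥-elim (impossible i n) ; code< = λ i n → ⊥-elim (impossible i n)
  ; code-injective = λ i j n m → ⊥-elim (impossible i n) }
  where
  impossible : ∀ i → ¬ Near 0 (suc w) z i
  impossible i (suc (suc u) , _ , s≤s (s≤s ()) , _)
  impossible i (1 , _ , _ , p , q , e) = contradiction (2^∣odd* (suc w) i w∣) (>⇒∤ {{>-nonZero 0<z}} z<W)
    where
    w∣ : 2 ^ suc w ∣ (1 + 2 * i) * z
    w∣ = ∣m+n∣n⇒∣m (divides q (suc-injective (trans (trans (lemma ((1 + 2 * i) * z) (p * 2 ^ suc w)) e) refl))) (n∣m*n p)
      where
      lemma : ∀ x y → suc (x + y) ≡ x + 1 + y
      lemma = solve-∀
nearCode (suc t) (suc w) z 0<z z<W with evenOrOdd z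
... | z′ , inj₁ refl = record
  { code = λ i n → bit i + 2 * code rec i (half i n)
  ; code< = λ i n → begin-strict
      bit i + 2 * code rec i (half i n) <⟨ +-monoˡ-< _ (bit< i) ⟩
      2 + 2 * code rec i (half i n)     ≡⟨ *-suc 2 _ ⟨
      2 * suc (code rec i (half i n))   ≤⟨ *-monoʳ-≤ 2 (code< rec i (half i n)) ⟩
      2 * 2 ^ t                         ∎
  ; code-injective = λ i j n m e → let b , c = 2*-+-injective (bit< i) (bit< j) e in
      extend (1 + 2 * i) (1 + 2 * j) b (code-injective rec i j (half i n) (half j m) c)
  }
  where
  open ≤-Reasoning
  rec : NearCode t w z′
  rec = nearCode t w z′ (*-cancelˡ-< 2 0 z′ 0<z) (*-cancelˡ-< 2 z′ (2 ^ w) z<W)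
  bit : ℕ → ℕ
  bit i = ((1 + 2 * i) div2^ w) % 2
  bit< : ∀ i → bit i < 2
  bit< i = m%n<n ((1 + 2 * i) div2^ w) 2
  half : ∀ i → Near (suc t) (suc w) (2 * z′) i → Near t w z′ i
  half i (u , 0<u , u<2T , p , q , e) with evenOrOdd u
  ... | u′ , inj₁ refl = u′ , *-cancelˡ-< 2 0 u′ 0<u , *-cancelˡ-< 2 u′ _ u<2T , p , q ,
          *-cancelˡ-≡ _ _ 2 (trans (lemma i z′ (2 ^ t) p (2 ^ w)) (trans e (lemma′ u′ q (2 ^ w))))
    where
    lemma : ∀ i z H p W → 2 * ((1 + 2 * i) * z + H + p * W) ≡ (1 + 2 * i) * (2 * z) + 2 * H + p * (2 * W)
    lemma = solve-∀
    lemma′ : ∀ u q W → 2 * u + q * (2 * W) ≡ 2 * (u + q * W)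
    lemma′ = solve-∀
  ... | u′ , inj₂ refl = contradiction
          (divides ((1 + 2 * i) * z′ + 2 ^ t + p * 2 ^ w)
            (trans (lemma′ u′ q (2 ^ w)) (trans (sym e) (lemma i z′ (2 ^ t) p (2 ^ w)))))
          (2∤1+2* (u′ + q * 2 ^ w))
    where
    lemma : ∀ i z H p W → (1 + 2 * i) * (2 * z) + 2 * H + p * (2 * W) ≡ ((1 + 2 * i) * z + H + p * W) * 2
    lemma = solve-∀
    lemma′ : ∀ u q W → 1 + 2 * (u + q * W) ≡ 1 + 2 * u + q * (2 * W)
    lemma′ = solve-∀
  extend : ∀ a b → (a div2^ w) % 2 ≡ (b div2^ w) % 2 → a ≡ b [mod2^ w ] → a ≡ b [mod2^ suc w ]
  -- Each side is padded with the bits of the other above position `w`.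
  extend a b bits low = hi b , hi a , (begin-equality
      a + hi b * (2 * 2 ^ w)
        ≡⟨ cong (_+ hi b * (2 * 2 ^ w)) (split a) ⟩
      a mod2^ w + (a div2^ w) % 2 * 2 ^ w + hi a * (2 * 2 ^ w) + hi b * (2 * 2 ^ w)
        ≡⟨ cong₂ (λ r s → r + s * 2 ^ w + hi a * (2 * 2 ^ w) + hi b * (2 * 2 ^ w)) (mod-cong {a} {b} {w} low) bits ⟩
      b mod2^ w + (b div2^ w) % 2 * 2 ^ w + hi a * (2 * 2 ^ w) + hi b * (2 * 2 ^ w)
        ≡⟨ +-swap (b mod2^ w + (b div2^ w) % 2 * 2 ^ w) _ _ ⟩
      b mod2^ w + (b div2^ w) % 2 * 2 ^ w + hi b * (2 * 2 ^ w) + hi a * (2 * 2 ^ w)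
        ≡⟨ cong (_+ hi a * (2 * 2 ^ w)) (split b) ⟨
      b + hi a * (2 * 2 ^ w) ∎)
    where
    hi : ℕ → ℕ
    hi x = (x div2^ w) / 2
    +-swap : ∀ x y z → x + y + z ≡ x + z + y
    +-swap = solve-∀
    lemma : ∀ r s h W → r + (s + h * 2) * W ≡ r + s * W + h * (2 * W)
    lemma = solve-∀
    split : ∀ x → x ≡ x mod2^ w + (x div2^ w) % 2 * 2 ^ w + hi x * (2 * 2 ^ w)
    split x = begin-equality
      x ≡⟨ mod+div x w ⟩
      x mod2^ w + x div2^ w * 2 ^ w ≡⟨ cong (λ d → x mod2^ w + d * 2 ^ w) (m≡m%n+[m/n]*n (x div2^ w) 2) ⟩
      x mod2^ w + ((x div2^ w) % 2 + hi x * 2) * 2 ^ w ≡⟨ lemma (x mod2^ w) ((x div2^ w) % 2) (hi x) (2 ^ w) ⟩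
      _ ∎
... | y , inj₂ refl = record
  { code = λ i n → proj₁ (half i n)
  ; code< = λ i n → proj₁ (proj₂ (half i n))
  ; code-injective = λ i j n m e → odd-cancel (suc w) y (1 + 2 * i) (1 + 2 * j)
      (same i j n m (trans (proj₂ (proj₂ (half i n))) (trans (cong (λ c → 1 + 2 * c) e) (sym (proj₂ (proj₂ (half j m)))))))
  }
  where
  half : ∀ i (n : Near (suc t) (suc w) (1 + 2 * y) i) → ∃[ c ] (c < 2 * 2 ^ t × proj₁ n ≡ 1 + 2 * c)
  half i (u , 0<u , u<2T , p , q , e) with evenOrOdd u
  ... | c , inj₂ refl = c , *-cancelˡ-< 2 c _ (<-trans (n<1+n _) u<2T) , refl
  ... | c , inj₁ refl = contradiction
          (divides (c + q * 2 ^ w) (trans (lemma i y (2 ^ t) p (2 ^ w)) (trans e (lemma′ c q (2 ^ w)))))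
          (2∤1+2* (i + y + 2 * (i * y) + 2 ^ t + p * 2 ^ w))
    where
    lemma : ∀ i y H p W → 1 + 2 * (i + y + 2 * (i * y) + H + p * W) ≡ (1 + 2 * i) * (1 + 2 * y) + 2 * H + p * (2 * W)
    lemma = solve-∀
    lemma′ : ∀ u q W → 2 * u + q * (2 * W) ≡ (u + q * W) * 2
    lemma′ = solve-∀
  same : ∀ i j (n : Near (suc t) (suc w) (1 + 2 * y) i) (m : Near (suc t) (suc w) (1 + 2 * y) j) → proj₁ n ≡ proj₁ m →
         (1 + 2 * i) * (1 + 2 * y) ≡ (1 + 2 * j) * (1 + 2 * y) [mod2^ suc w ]
  same i j (u , _ , _ , p , q , e) (.u , _ , _ , p′ , q′ , e′) refl =
    p + q′ , p′ + q , +-cancelʳ-≡ (2 ^ suc t) _ _ (begin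
      a + (p + q′) * W + H     ≡⟨ lemma a p q′ W H ⟩
      a + H + p * W + q′ * W   ≡⟨ cong (_+ q′ * W) e ⟩
      u + q * W + q′ * W       ≡⟨ +-swap u (q * W) (q′ * W) ⟩
      u + q′ * W + q * W       ≡⟨ cong (_+ q * W) e′ ⟨
      b + H + p′ * W + q * W   ≡⟨ lemma b p′ q W H ⟨
      b + (p′ + q) * W + H     ∎)
    where
    open ≡-Reasoning
    W = 2 ^ suc w
    H = 2 ^ suc t
    a = (1 + 2 * i) * (1 + 2 * y)
    b = (1 + 2 * j) * (1 + 2 * y)
    +-swap : ∀ x y z → x + y + z ≡ x + z + y
    +-swap = solve-∀
    lemma : ∀ a p q W H → a + (p + q) * W + H ≡ a + H + p * W + q * W
    lemma = solve-∀

-- Finite sums, averaging and pigeonhole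

private variable
  X Y : Set
  σ : ℕ

∑ : List X → (X → ℕ) → ℕ
∑ []       f = 0
∑ (x ∷ xs) f = f x + ∑ xs f

⟦_⟧ : {P : Set} → Dec P → ℕ
⟦ yes _ ⟧ = 1
⟦ no _ ⟧  = 0

⟦_⟧≤1 : {P : Set} (d : Dec P) → ⟦ d ⟧ ≤ 1
⟦ yes _ ⟧≤1 = ≤-refl
⟦ no _ ⟧≤1  = z≤n

⟦⟧-yes : {P : Set} (d : Dec P) → P → ⟦ d ⟧ ≡ 1
⟦⟧-yes (yes _) p = refl
⟦⟧-yes (no ¬p) p = contradiction p ¬p

⟦⟧-no : {P : Set} (d : Dec P) → ¬ P → ⟦ d ⟧ ≡ 0
⟦⟧-no (yes p) ¬p = contradiction p ¬p
⟦⟧-no (no _)  _  = refl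

⟦⟧-cong : {P Q : Set} (d : Dec P) (e : Dec Q) → (P → Q) → (Q → P) → ⟦ d ⟧ ≡ ⟦ e ⟧
⟦⟧-cong (yes p) e f g = sym (⟦⟧-yes e (f p))
⟦⟧-cong (no ¬p) e f g = sym (⟦⟧-no e (¬p ∘ g))

∑-mono : ∀ xs {f g : X → ℕ} → (∀ {x} → x ∈ xs → f x ≤ g x) → ∑ xs f ≤ ∑ xs g
∑-mono []       h = z≤n
∑-mono (x ∷ xs) h = +-mono-≤ (h (here refl)) (∑-mono xs (h ∘ there))

∑-cong : ∀ xs {f g : X → ℕ} → (∀ {x} → x ∈ xs → f x ≡ g x) → ∑ xs f ≡ ∑ xs g
∑-cong []       h = refl
∑-cong (x ∷ xs) h = cong₂ _+_ (h (here refl)) (∑-cong xs (h ∘ there))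

∑-const : ∀ (xs : List X) c → ∑ xs (λ _ → c) ≡ length xs * c
∑-const []       c = refl
∑-const (x ∷ xs) c = cong (c +_) (∑-const xs c)

∑-+ : ∀ xs (f g : X → ℕ) → ∑ xs (λ x → f x + g x) ≡ ∑ xs f + ∑ xs g
∑-+ []       f g = refl
∑-+ (x ∷ xs) f g = trans (cong (f x + g x +_) (∑-+ xs f g)) (lemma (f x) (g x) (∑ xs f) (∑ xs g))
  where
  lemma : ∀ a b c d → a + b + (c + d) ≡ a + c + (b + d)
  lemma = solve-∀

∑-*ˡ : ∀ xs c (f : X → ℕ) → ∑ xs (λ x → c * f x) ≡ c * ∑ xs f
∑-*ˡ []       c f = sym (*-zeroʳ c)
∑-*ˡ (x ∷ xs) c f = trans (cong (c * f x +_) (∑-*ˡ xs c f)) (sym (*-distribˡ-+ c (f x) (∑ xs f)))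

∑-swap : ∀ xs (ys : List Y) (f : X → Y → ℕ) →
         ∑ xs (λ x → ∑ ys (f x)) ≡ ∑ ys (λ y → ∑ xs (λ x → f x y))
∑-swap []       ys f = sym (trans (∑-const ys 0) (*-zeroʳ (length ys)))
∑-swap (x ∷ xs) ys f =
  trans (cong (∑ ys (f x) +_) (∑-swap xs ys f)) (sym (∑-+ ys (f x) (λ y → ∑ xs (λ x → f x y))))

∑-member : ∀ {xs x} (f : X → ℕ) → x ∈ xs → f x ≤ ∑ xs f
∑-member f (here refl) = m≤m+n _ _
∑-member {xs = y ∷ xs} f (there x∈) = ≤-trans (∑-member f x∈) (m≤n+m _ (f y))

∑-indicator : ∀ {P : X → Set} (P? : Decidable P) xs → ∑ xs (λ x → ⟦ P? x ⟧) ≡ length (filter P? xs)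
∑-indicator P? []       = refl
∑-indicator P? (x ∷ xs) with P? x
... | yes _ = cong suc (∑-indicator P? xs)
... | no  _ = ∑-indicator P? xs

-- The `y` produced minimises `f`.
∑-average : ∀ x xs (f : X → ℕ) → ∃[ y ] (y ∈ x ∷ xs × length (x ∷ xs) * f y ≤ ∑ (x ∷ xs) f)
∑-average x []       f = x , here refl , ≤-refl
∑-average x (z ∷ xs) f with ∑-average z xs f
... | y , y∈ , p with ≤-total (f x) (f y)
...   | inj₁ fx≤fy = x , here refl , +-monoʳ-≤ (f x) (≤-trans (*-monoʳ-≤ (length (z ∷ xs)) fx≤fy) p)
...   | inj₂ fy≤fx = y , there y∈ , +-mono-≤ fy≤fx p

lookup-injective : ∀ {xs : List X} → Unique xs → ∀ i j → lookup xs i ≡ lookup xs j → i ≡ j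
lookup-injective (_   ∷ _)  zero    zero    e = refl
lookup-injective (x∉ ∷ _)   zero    (suc j) e = contradiction e (All.lookup x∉ (∈-lookup j))
lookup-injective (x∉ ∷ _)   (suc i) zero    e = contradiction (sym e) (All.lookup x∉ (∈-lookup i))
lookup-injective (_   ∷ xs) (suc i) (suc j) e = cong suc (lookup-injective xs i j e)

-- A code may depend on the proof of membership, since multipliers are coded only when they collide.
pigeonhole : ∀ {xs : List X} {n} → Unique xs → (code : ∀ {x} → x ∈ xs → ℕ) → (∀ {x} (p : x ∈ xs) → code p < n) →
             (∀ {x y} (p : x ∈ xs) (q : y ∈ xs) → code p ≡ code q → x ≡ y) → length xs ≤ n
pigeonhole {xs = xs} unique code code< code-injective = injective⇒≤ {f = λ i → fromℕ< (code< (∈-lookup i))}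
  (λ {i} {j} e → lookup-injective unique i j
    (code-injective (∈-lookup i) (∈-lookup j) (fromℕ<-injective _ _ (code< (∈-lookup i)) (code< (∈-lookup j)) e)))

∑-unique≤1 : ∀ (_≟_ : (x y : X) → Dec (x ≡ y)) {xs : List X} → Unique xs → ∀ x → ∑ xs (λ y → ⟦ x ≟ y ⟧) ≤ 1
∑-unique≤1 _≟_ [] x = z≤n
∑-unique≤1 _≟_ {xs = y ∷ xs} (y∉ ∷ u) x with x ≟ y
... | no  _    = ∑-unique≤1 _≟_ u x
... | yes refl = s≤s (≤-trans (∑-mono xs (λ {z} z∈ → ≤-reflexive (⟦⟧-no (x ≟ z) (All.lookup y∉ z∈))))
                       (≤-reflexive (trans (∑-const xs 0) (*-zeroʳ (length xs)))))

-- Collision counts for multiply-shift hashing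

hash : (w t i x : ℕ) → ℕ
hash w t i x = ((1 + 2 * i) * x mod2^ w) div2^ t

hash< : ∀ s t i x → hash (s + t) t i x < 2 ^ s
hash< s t i x = div<2^ s t (mod<2^ ((1 + 2 * i) * x) (s + t))

-- Equal high parts leave only the low parts `s₁` and `s₂`, both below 2 ^ t, to differ, so the
-- product with `z` is congruent to `s₂` minus `s₁`.
collision⇒Near : ∀ w t i x z → hash w t i x ≡ hash w t i (x + z) → Near t w z i
-- `suc (H ∸ suc s₁)` is H minus `s₁`, written so as to be visibly positive.
collision⇒Near w t i x z e = s₂ + suc (H ∸ suc s₁) , ≤-trans (s≤s z≤n) (m≤n+m _ s₂) ,
  (begin-strict
    s₂ + suc (H ∸ suc s₁) ≤⟨ +-monoʳ-≤ s₂ (subst (suc (H ∸ suc s₁) ≤_) gap (m≤n+m _ s₁)) ⟩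
    s₂ + H                <⟨ +-monoˡ-< H (mod<2^ r₂ t) ⟩
    H + H                 ≡⟨ cong (H +_) (+-identityʳ H) ⟨
    2 ^ suc t             ∎) ,
  k₁ , k₂ ,
  +-cancelˡ-≡ (c * H + s₁) _ _ (begin-equality
    c * H + s₁ + (a * z + H + k₁ * W)              ≡⟨ lemma (c * H) s₁ (a * z) H (k₁ * W) ⟩
    s₁ + c * H + k₁ * W + a * z + H                 ≡⟨ cong (λ v → v + a * z + H) ax ⟨
    a * x + a * z + H                               ≡⟨ cong (_+ H) (*-distribˡ-+ a x z) ⟨
    a * (x + z) + H                                 ≡⟨ cong₂ _+_ ay (sym gap) ⟩
    s₂ + c * H + k₂ * W + (s₁ + suc (H ∸ suc s₁))   ≡⟨ lemma′ (c * H) s₁ s₂ (suc (H ∸ suc s₁)) (k₂ * W) ⟩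
    c * H + s₁ + (s₂ + suc (H ∸ suc s₁) + k₂ * W)  ∎)
  where
  open ≤-Reasoning
  a = 1 + 2 * i
  W = 2 ^ w
  H = 2 ^ t
  r₁ = a * x mod2^ w
  r₂ = a * (x + z) mod2^ w
  k₁ = a * x div2^ w
  k₂ = a * (x + z) div2^ w
  s₁ = r₁ mod2^ t
  s₂ = r₂ mod2^ t
  c = r₁ div2^ t
  gap : s₁ + suc (H ∸ suc s₁) ≡ H
  gap = trans (+-suc s₁ _) (m+[n∸m]≡n (mod<2^ r₁ t))
  ax : a * x ≡ s₁ + c * H + k₁ * W
  ax = trans (mod+div (a * x) w) (cong (_+ k₁ * W) (mod+div r₁ t))
  ay : a * (x + z) ≡ s₂ + c * H + k₂ * W
  ay = trans (mod+div (a * (x + z)) w)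
         (cong (_+ k₂ * W) (trans (mod+div r₂ t) (cong (λ c → s₂ + c * H) (sym e))))
  lemma : ∀ cH s az H kW → cH + s + (az + H + kW) ≡ s + cH + kW + az + H
  lemma = solve-∀
  lemma′ : ∀ cH s s₂ g kW → s₂ + cH + kW + (s + g) ≡ cH + s + (s₂ + g + kW)
  lemma′ = solve-∀

1+2*<2^suc : ∀ {i} w → i < 2 ^ w → 1 + 2 * i < 2 ^ suc w
1+2*<2^suc {i} w i< = begin-strict
  1 + 2 * i   <⟨ n<1+n _ ⟩
  2 + 2 * i   ≡⟨ *-suc 2 i ⟨
  2 * suc i   ≤⟨ *-monoʳ-≤ 2 i< ⟩
  2 ^ suc w   ∎
  where open ≤-Reasoning

-- Words have `suc w` bits here, so that the odd multipliers 1 + 2i below 2 ^ suc w are indexed by i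
-- below 2 ^ w.
module _ (w t : ℕ) where

  private
    h : ℕ → ℕ → ℕ
    h = hash (suc w) t

  -- Colliding multipliers are near for the difference of the keys, and congruent multipliers are
  -- equal because all of them are below the modulus.
  collisions< : ∀ {x y} → x < y → y < 2 ^ suc w → ∑ (upTo (2 ^ w)) (λ i → ⟦ h i x ≟ h i y ⟧) ≤ 2 ^ t
  collisions< {x} {y} x<y y<W = ≤-trans (≤-reflexive (∑-indicator P? (upTo (2 ^ w))))
    (pigeonhole (Uniqueness.filter⁺ P? (Uniqueness.upTo⁺ (2 ^ w)))
      (λ {i} i∈ → code coding i (near i∈)) (λ {i} i∈ → code< coding i (near i∈))
      λ {i} {j} i∈ j∈ e → *-cancelˡ-≡ i j 2 (suc-injective (begin
        1 + 2 * i               ≡⟨ mod-small (suc w) (1+2*<2^suc w (bound i∈)) ⟨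
        (1 + 2 * i) mod2^ suc w ≡⟨ mod-cong {w = suc w} (code-injective coding i j (near i∈) (near j∈) e) ⟩
        (1 + 2 * j) mod2^ suc w ≡⟨ mod-small (suc w) (1+2*<2^suc w (bound j∈)) ⟩
        1 + 2 * j               ∎)))
    where
    open ≡-Reasoning
    P? : Decidable (λ i → h i x ≡ h i y)
    P? i = h i x ≟ h i y
    coding : NearCode t (suc w) (y ∸ x)
    coding = nearCode t (suc w) (y ∸ x) (m<n⇒0<n∸m x<y) (≤-<-trans (m∸n≤m y x) y<W)
    bound : ∀ {i} → i ∈ filter P? (upTo (2 ^ w)) → i < 2 ^ w
    bound i∈ = ∈-upTo⁻ (proj₁ (∈-filter⁻ P? {xs = upTo (2 ^ w)} i∈))
    near : ∀ {i} → i ∈ filter P? (upTo (2 ^ w)) → Near t (suc w) (y ∸ x) i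
    near {i} i∈ = collision⇒Near (suc w) t i x (y ∸ x)
      (trans (proj₂ (∈-filter⁻ P? {xs = upTo (2 ^ w)} i∈)) (cong (h i) (sym (m+[n∸m]≡n (<⇒≤ x<y)))))

  collisions≢ : ∀ {x y} → x ≢ y → x < 2 ^ suc w → y < 2 ^ suc w → ∑ (upTo (2 ^ w)) (λ i → ⟦ h i x ≟ h i y ⟧) ≤ 2 ^ t
  collisions≢ {x} {y} x≢y x< y< with ≤-total x y
  ... | inj₁ x≤y = collisions< (≤∧≢⇒< x≤y x≢y) y<
  ... | inj₂ y≤x = ≤-trans (≤-reflexive (∑-cong (upTo (2 ^ w)) (λ {i} _ → ⟦⟧-cong (h i x ≟ h i y) (h i y ≟ h i x) sym sym)))
                     (collisions< (≤∧≢⇒< y≤x (x≢y ∘ sym)) x<)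

  -- Equal keys count 0, so that `collisions` can vanish; it counts ordered pairs.
  collides : ℕ → ℕ → ℕ → ℕ
  collides i x y = if-distinct (x ≟ y)
    where
    if-distinct : Dec (x ≡ y) → ℕ
    if-distinct (yes _) = 0
    if-distinct (no _)  = ⟦ h i x ≟ h i y ⟧

  collisions : ℕ → List ℕ → ℕ
  collisions i K = ∑ K (λ x → ∑ K (collides i x))

  goodMultiplier : ∀ K → All (_< 2 ^ suc w) K →
                   ∃[ i ] (i < 2 ^ w × 2 ^ w * collisions i K ≤ length K * length K * 2 ^ t)
  goodMultiplier K K< = let i , i∈ , p = average in i , ∈-upTo⁻ i∈ , ≤-trans p total
    where
    average : ∃[ i ] (i ∈ upTo (2 ^ w) × 2 ^ w * collisions i K ≤ ∑ (upTo (2 ^ w)) (λ i → collisions i K))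
    average with upTo (2 ^ w) | length-upTo (2 ^ w)
    ... | []     | e = contradiction e (<⇒≢ (0<2^ w))
    ... | i ∷ is | e = subst (λ m → ∃[ j ] (j ∈ i ∷ is × m * collisions j K ≤ ∑ (i ∷ is) (λ i → collisions i K))) e
                         (∑-average i is (λ i → collisions i K))
    pair : ∀ {x y} → x ∈ K → y ∈ K → ∑ (upTo (2 ^ w)) (λ i → collides i x y) ≤ 2 ^ t
    pair {x} {y} x∈ y∈ with x ≟ y
    ... | yes _  = ≤-trans (≤-reflexive (trans (∑-const (upTo (2 ^ w)) 0) (*-zeroʳ (length (upTo (2 ^ w)))))) z≤n
    ... | no x≢y = collisions≢ x≢y (All.lookup K< x∈) (All.lookup K< y∈)
    total : ∑ (upTo (2 ^ w)) (λ i → collisions i K) ≤ length K * length K * 2 ^ t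
    total = begin
      ∑ I (λ i → ∑ K (λ x → ∑ K (collides i x)))            ≡⟨ ∑-swap I K _ ⟩
      ∑ K (λ x → ∑ I (λ i → ∑ K (collides i x)))            ≡⟨ ∑-cong K (λ {x} _ → ∑-swap I K (λ i y → collides i x y)) ⟩
      ∑ K (λ x → ∑ K (λ y → ∑ I (λ i → collides i x y)))    ≤⟨ ∑-mono K (λ x∈ → ∑-mono K (λ y∈ → pair x∈ y∈)) ⟩
      ∑ K (λ x → ∑ K (λ y → 2 ^ t))                         ≡⟨ ∑-cong K (λ _ → ∑-const K (2 ^ t)) ⟩
      ∑ K (λ x → length K * 2 ^ t)                          ≡⟨ ∑-const K _ ⟩
      length K * (length K * 2 ^ t)                         ≡⟨ *-assoc (length K) (length K) (2 ^ t) ⟨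
      length K * length K * 2 ^ t                           ∎
      where
      open ≤-Reasoning
      I = upTo (2 ^ w)

-- Two-level dictionaries

n<2^n : ∀ n → n < 2 ^ n
n<2^n zero    = s≤s z≤n
n<2^n (suc n) = ≤-trans (+-mono-≤ (0<2^ n) (n<2^n n)) (≤-reflexive (cong (2 ^ n +_) (sym (+-identityʳ _))))

2^-cancel-≤ : ∀ {m n} → 2 ^ m ≤ 2 ^ n → m ≤ n
2^-cancel-≤ {m} {n} p with ≤-<-connex m n
... | inj₁ m≤n = m≤n
... | inj₂ n<m = contradiction (<-≤-trans (^-monoʳ-< 2 (s≤s (s≤s z≤n)) n<m) p) (<-irrefl refl)

-- Strictness on the left lets an integer `c` with `2 ^ k * c ≤ m` be 0 only; at most doubling on
-- the right keeps the tables proportional to `m`.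
nextPower : ∀ m → 0 < m → ∃[ k ] (m < 2 ^ k × 2 ^ k ≤ 2 * m)
nextPower (suc zero)    _ = 1 , ≤-refl , ≤-refl
nextPower (suc (suc m)) _ with nextPower (suc m) (s≤s z≤n)
... | k , m< , ≤2m with m≤n⇒m<n∨m≡n m<
...   | inj₁ lt = k , lt , ≤-trans ≤2m (*-monoʳ-≤ 2 {suc m} {suc (suc m)} (n≤1+n (suc m)))
...   | inj₂ eq = suc k , subst (λ v → suc (suc m) < 2 * v) eq (m<m+n (suc (suc m)) (s≤s z≤n)) , ≤-reflexive (cong (2 *_) (sym eq))

-- Mirrors `cell`, including the 0 beyond the end.
at : List ℕ → ℕ → ℕ
at []       i       = 0
at (x ∷ xs) zero    = x
at (x ∷ xs) (suc i) = at xs i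

at-applyUpTo : ∀ (f : ℕ → ℕ) m {i} → i < m → at (applyUpTo f m) i ≡ f i
at-applyUpTo f (suc m) {zero}  _       = refl
at-applyUpTo f (suc m) {suc i} (s≤s p) = at-applyUpTo (f ∘ suc) m p

at-++ˡ : ∀ xs {ys i} → i < length xs → at (xs ++ ys) i ≡ at xs i
at-++ˡ (x ∷ xs) {i = zero}  _       = refl
at-++ˡ (x ∷ xs) {i = suc i} (s≤s p) = at-++ˡ xs p

at-++ʳ : ∀ xs {ys i} → at (xs ++ ys) (length xs + i) ≡ at ys i
at-++ʳ []       = refl
at-++ʳ (x ∷ xs) = at-++ʳ xs

at-All : ∀ {P : ℕ → Set} {xs} → All P xs → P 0 → ∀ i → P (at xs i)
at-All []       p0 i       = p0
at-All (p ∷ ps) p0 zero    = p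
at-All (p ∷ ps) p0 (suc i) = at-All ps p0 i

-- Blocks are appended on the right, so that `length (concatUpTo f b)` is literally the offset at
-- which block `b` starts.
concatUpTo : (ℕ → List X) → ℕ → List X
concatUpTo f zero    = []
concatUpTo f (suc m) = concatUpTo f m ++ f m

concatUpTo-All : ∀ {P : X → Set} (f : ℕ → List X) → (∀ b → All P (f b)) → ∀ m → All P (concatUpTo f m)
concatUpTo-All f p zero    = []
concatUpTo-All f p (suc m) = All.++⁺ (concatUpTo-All f p m) (p m)

∑-++ : ∀ xs {ys} (f : X → ℕ) → ∑ (xs ++ ys) f ≡ ∑ xs f + ∑ ys f
∑-++ []       f = refl
∑-++ (x ∷ xs) f = trans (cong (f x +_) (∑-++ xs f)) (sym (+-assoc (f x) _ _))

length-concatUpTo : ∀ (f : ℕ → List X) m → length (concatUpTo f m) ≡ ∑ (upTo m) (length ∘ f)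
length-concatUpTo f zero    = refl
length-concatUpTo f (suc m) = begin
  length (concatUpTo f m ++ f m)                 ≡⟨ length-++ (concatUpTo f m) ⟩
  length (concatUpTo f m) + length (f m)         ≡⟨ cong₂ _+_ (length-concatUpTo f m) (sym (+-identityʳ _)) ⟩
  ∑ (upTo m) (length ∘ f) + (length (f m) + 0)   ≡⟨ ∑-++ (upTo m) (length ∘ f) ⟨
  ∑ (upTo m ++ m ∷ []) (length ∘ f)              ≡⟨ cong (λ l → ∑ l (length ∘ f)) (upTo-∷ʳ m) ⟩
  ∑ (upTo (suc m)) (length ∘ f)                  ∎
  where open ≡-Reasoning

concatUpTo-offset< : ∀ (f : ℕ → List X) m {b i} → b < m → i < length (f b) →
                     length (concatUpTo f b) + i < length (concatUpTo f m)
concatUpTo-offset< f (suc m) {b} {i} (s≤s b≤m) i< with m≤n⇒m<n∨m≡n b≤m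
... | inj₂ refl = subst (length (concatUpTo f b) + i <_) (sym (length-++ (concatUpTo f b))) (+-monoʳ-< _ i<)
... | inj₁ b<m  = <-≤-trans (concatUpTo-offset< f m b<m i<)
                    (≤-trans (m≤m+n _ _) (≤-reflexive (sym (length-++ (concatUpTo f m)))))

concatUpTo-offset≤ : ∀ (f : ℕ → List X) {b m} → b < m → length (concatUpTo f b) ≤ length (concatUpTo f m)
concatUpTo-offset≤ f {b} {suc m} (s≤s b≤m) with m≤n⇒m<n∨m≡n b≤m
... | inj₂ refl = ≤-trans (m≤m+n _ _) (≤-reflexive (sym (length-++ (concatUpTo f b))))
... | inj₁ b<m  = ≤-trans (concatUpTo-offset≤ f b<m) (≤-trans (m≤m+n _ _) (≤-reflexive (sym (length-++ (concatUpTo f m)))))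

at-concatUpTo : ∀ (f : ℕ → List ℕ) m {b i} → b < m → i < length (f b) →
                at (concatUpTo f m) (length (concatUpTo f b) + i) ≡ at (f b) i
at-concatUpTo f (suc m) {b} {i} (s≤s b≤m) i< with m≤n⇒m<n∨m≡n b≤m
... | inj₂ refl = at-++ʳ (concatUpTo f b)
... | inj₁ b<m  = trans (at-++ˡ (concatUpTo f m) (concatUpTo-offset< f m b<m i<)) (at-concatUpTo f m b<m i<)

firstOr0 : List ℕ → ℕ
firstOr0 []      = 0
firstOr0 (x ∷ _) = x

firstOr0-∈ : ∀ xs → firstOr0 xs ∈ xs ⊎ firstOr0 xs ≡ 0
firstOr0-∈ []       = inj₂ refl
firstOr0-∈ (x ∷ xs) = inj₁ (here refl)

firstOr0-nonempty : ∀ {xs x} → x ∈ xs → firstOr0 xs ∈ xs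
firstOr0-nonempty {x ∷ xs} _ = here refl

multiplyShift : (w a t x : ℕ) → ℕ
multiplyShift w a t x = (a * x mod2^ w) div2^ t

-- The outer reduction is the wrap-around of word addition. For a word that is not a key the sum may
-- overflow, and the formula still describes what the program computes.
twoLevel : (w a t : ℕ) (as ts os : ℕ → ℕ) → ℕ → ℕ
twoLevel w a t as ts os x =
  (os (multiplyShift w a t x) + multiplyShift w (as (multiplyShift w a t x)) (ts (multiplyShift w a t x)) x) mod2^ w

twoLevel-≡ : ∀ w a t {as ts os : ℕ → ℕ} x {a′ t′ o} → as (multiplyShift w a t x) ≡ a′ → ts (multiplyShift w a t x) ≡ t′ →
             os (multiplyShift w a t x) ≡ o → twoLevel w a t as ts os x ≡ (o + multiplyShift w a′ t′ x) mod2^ w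
twoLevel-≡ w a t x refl refl refl = refl

module _ (w : ℕ) where

  record Bucket (K : List ℕ) : Set where
    field
      multiplier shift : ℕ
      table            : List ℕ
      multiplier<      : multiplier < 2 ^ suc w
      shift<           : shift < 2 ^ suc w
      table-length     : length table ≤ 4 * (length K * length K)
    slot : ℕ → ℕ
    slot = multiplyShift (suc w) multiplier shift
    field
      slot<   : ∀ {x} → x ∈ K → slot x < length table
      found : ∀ {x} → x ∈ K → at table (slot x) ≡ x
      stored  : All (λ y → y ∈ K ⊎ y ≡ 0) table

  ≤w⇒<2^ : ∀ {t} → t ≤ w → t < 2 ^ suc w
  ≤w⇒<2^ t≤w = ≤-<-trans t≤w (<-trans (n<1+n w) (n<2^n (suc w)))

  -- Shift `w ∸ k` leaves hashes of k + 1 bits while the bound divides by 2 ^ k only: multiply-shift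
  -- is universal up to a factor of two, which tables of 2 ^ suc k cells absorb.
  hasMultiplier : ∀ K → All (_< 2 ^ suc w) K → ∀ k → k ≤ w →
                  ∃[ i ] (i < 2 ^ w × 2 ^ k * collisions w (w ∸ k) i K ≤ length K * length K)
  hasMultiplier K K< k k≤w with goodMultiplier w (w ∸ k) K K<
  ... | i , i< , p = i , i< , *-cancelʳ-≤ _ _ (2 ^ (w ∸ k)) {{m^n≢0 2 (w ∸ k)}} (begin
      2 ^ k * c * 2 ^ (w ∸ k)   ≡⟨ lemma (2 ^ k) c (2 ^ (w ∸ k)) ⟩
      2 ^ k * 2 ^ (w ∸ k) * c   ≡⟨ cong (_* c) (^-distribˡ-+-* 2 k (w ∸ k)) ⟨
      2 ^ (k + (w ∸ k)) * c     ≡⟨ cong (λ v → 2 ^ v * c) (m+[n∸m]≡n k≤w) ⟩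
      2 ^ w * c                 ≤⟨ p ⟩
      length K * length K * 2 ^ (w ∸ k) ∎)
    where
    open ≤-Reasoning
    c = collisions w (w ∸ k) i K
    lemma : ∀ a b c → a * b * c ≡ a * c * b
    lemma = solve-∀

  hash<2^suc : ∀ {k} → k ≤ w → ∀ i x → hash (suc w) (w ∸ k) i x < 2 ^ suc k
  hash<2^suc {k} k≤w i x = subst (λ v → hash (suc v) (w ∸ k) i x < 2 ^ suc k) (m+[n∸m]≡n k≤w) (hash< (suc k) (w ∸ k) i x)

  exponent≤ : ∀ {k m} → 2 ^ k ≤ 2 * m → 4 * m ≤ 2 ^ suc w → k ≤ w
  exponent≤ {k} {m} p q = ≤-pred (2^-cancel-≤ {suc k} {suc w} (begin
    2 * 2 ^ k    ≤⟨ *-monoʳ-≤ 2 p ⟩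
    2 * (2 * m)  ≡⟨ *-assoc 2 2 m ⟨
    4 * m        ≤⟨ q ⟩
    2 ^ suc w    ∎))
    where open ≤-Reasoning

  -- With 2 ^ k above the square of the number of keys, the good multiplier has fewer than one
  -- collision, hence none. A cell then has at most one key to hold.
  nonemptyBucket : ∀ K → 0 < length K * length K → All (_< 2 ^ suc w) K → 4 * (length K * length K) ≤ 2 ^ suc w → Bucket K
  nonemptyBucket K 0<n² K< 4n²≤ with nextPower (length K * length K) 0<n²
  ... | k , n²< , ≤2n² with exponent≤ {k} {length K * length K} ≤2n² 4n²≤
  ...   | k≤w with hasMultiplier K K< k k≤w
  ...     | i , i< , p = record
    { multiplier = 1 + 2 * i
    ; shift = w ∸ k
    ; table = applyUpTo entry (2 ^ suc k)
    ; multiplier< = 1+2*<2^suc w i<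
    ; shift< = ≤w⇒<2^ (m∸n≤m w k)
    ; table-length = begin
        length (applyUpTo entry (2 ^ suc k)) ≡⟨ length-applyUpTo entry (2 ^ suc k) ⟩
        2 * 2 ^ k                            ≤⟨ *-monoʳ-≤ 2 ≤2n² ⟩
        2 * (2 * (length K * length K))      ≡⟨ *-assoc 2 2 (length K * length K) ⟨
        4 * (length K * length K)            ∎
    ; slot< = λ {x} _ → subst (h x <_) (sym (length-applyUpTo entry (2 ^ suc k))) (hash<2^suc k≤w i x)
    ; found = λ {x} x∈ → trans (at-applyUpTo entry (2 ^ suc k) (hash<2^suc k≤w i x)) (entry-hit x∈)
    ; stored = All.applyUpTo⁺₂ entry (2 ^ suc k) entry-stored
    }
    where
    open ≤-Reasoning
    h : ℕ → ℕ
    h = hash (suc w) (w ∸ k) i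
    entry : ℕ → ℕ
    entry s = firstOr0 (filter (λ x → h x ≟ s) K)
    entry-stored : ∀ s → entry s ∈ K ⊎ entry s ≡ 0
    entry-stored s with firstOr0-∈ (filter (λ x → h x ≟ s) K)
    ... | inj₁ e∈ = inj₁ (proj₁ (∈-filter⁻ (λ x → h x ≟ s) {xs = K} e∈))
    ... | inj₂ e0 = inj₂ e0
    no-collisions : collisions w (w ∸ k) i K ≡ 0
    no-collisions = zero-factor _ p
      where
      zero-factor : ∀ c → 2 ^ k * c ≤ length K * length K → c ≡ 0
      zero-factor zero    _ = refl
      zero-factor (suc c) q = contradiction (<-≤-trans n²< (≤-trans (m≤m*n (2 ^ k) (suc c)) q)) (<-irrefl refl)
    injective : ∀ {x y} → x ∈ K → y ∈ K → h x ≡ h y → x ≡ y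
    injective {x} {y} x∈ y∈ e with x ≟ y | ≤-trans (∑-member (collides w (w ∸ k) i x) y∈)
                                     (∑-member (λ x → ∑ K (collides w (w ∸ k) i x)) x∈)
    ... | yes x≡y | _ = x≡y
    ... | no  x≢y | q = contradiction (≤-trans (≤-reflexive (sym (⟦⟧-yes (h x ≟ h y) e))) (≤-trans q (≤-reflexive no-collisions))) λ ()
    entry-hit : ∀ {x} → x ∈ K → entry (h x) ≡ x
    entry-hit {x} x∈ with ∈-filter⁻ (λ y → h y ≟ h x) {xs = K} (firstOr0-nonempty (∈-filter⁺ (λ y → h y ≟ h x) x∈ refl))
    ... | e∈ , he = injective e∈ x∈ he

  opaque
    bucket : ∀ K → All (_< 2 ^ suc w) K → 4 * (length K * length K) ≤ 2 ^ suc w → Bucket K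
    bucket [] _ _ = record
      { multiplier = 0 ; shift = 0 ; table = [] ; multiplier< = 0<2^ (suc w) ; shift< = 0<2^ (suc w)
      ; table-length = z≤n ; slot< = λ () ; found = λ () ; stored = [] }
    bucket K@(_ ∷ _) K< 4n²≤ = nonemptyBucket K (s≤s z≤n) K< 4n²≤

record Dictionary (w : ℕ) (K : List ℕ) : Set where
  field
    multiplier shift                     : ℕ
    multipliers shifts offsets keys      : List ℕ
    multiplier<                          : multiplier < 2 ^ w
    shift<                               : shift < 2 ^ w
    multipliers<                         : All (_< 2 ^ w) multipliers
    shifts<                              : All (_< 2 ^ w) shifts
    offsets<                             : All (_< 2 ^ w) offsets
    keys<                                : All (_< 2 ^ w) keys
    length-multipliers                   : length multipliers ≤ 8 * length K
    length-shifts                        : length shifts ≤ 8 * length K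
    length-offsets                       : length offsets ≤ 8 * length K
    length-keys                          : length keys ≤ 8 * length K

  slot : ℕ → ℕ
  slot = twoLevel w multiplier shift (at multipliers) (at shifts) (at offsets)

  field
    found : ∀ {x} → x ∈ K → at keys (slot x) ≡ x
    stored : ∀ i → at keys i ∈ K ⊎ at keys i ≡ 0

-- With 2 ^ k above the number of keys, the first level has at most `length K` colliding pairs.
-- Together with the pairs of a key with itself, the squared bucket sizes sum to at most
-- `2 * length K`, and a bucket takes at most 4 cells per unit of its square: this is the 8.
dictionary : ∀ w K → Unique K → All (_< 2 ^ w) K → 0 < length K → 8 * length K < 2 ^ w → Dictionary w K
dictionary zero K _ _ 0<ℓ 8ℓ< = contradiction (<-≤-trans 8ℓ< (≤-trans 0<ℓ (m≤m+n _ _))) (<-irrefl refl)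
dictionary (suc w) K unique K< 0<ℓ 8ℓ< with nextPower (length K) 0<ℓ
... | k , ℓ< , ≤2ℓ with exponent≤ w {k} {length K} ≤2ℓ (≤-trans (*-monoˡ-≤ (length K) {4} {8} (s≤s (s≤s (s≤s (s≤s z≤n))))) (<⇒≤ 8ℓ<))
...   | k≤w with hasMultiplier w K K< k k≤w
...     | i , i< , p = record
  { multiplier = 1 + 2 * i
  ; shift = t
  ; multipliers = applyUpTo (λ b → multiplier (at′ b)) m
  ; shifts = applyUpTo (λ b → shift (at′ b)) m
  ; offsets = applyUpTo offset m
  ; keys = concatUpTo tab m
  ; multiplier< = 1+2*<2^suc w i<
  ; shift< = ≤w⇒<2^ w (m∸n≤m w k)
  ; multipliers< = All.applyUpTo⁺₂ _ m (λ b → multiplier< (at′ b))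
  ; shifts< = All.applyUpTo⁺₂ _ m (λ b → shift< (at′ b))
  ; offsets< = All.applyUpTo⁺₁ offset m (λ b<m → ≤-<-trans (concatUpTo-offset≤ tab b<m) total<)
  ; keys< = concatUpTo-All tab (λ b → All.map (λ { (inj₁ y∈) → All.lookup K< (proj₁ (∈-filter⁻ (λ x → h x ≟ b) {xs = K} y∈))
                                                  ; (inj₂ refl) → 0<2^ (suc w) }) (stored (at′ b))) m
  ; length-multipliers = length≤ _
  ; length-shifts = length≤ _
  ; length-offsets = length≤ _
  ; length-keys = total≤
  ; found = found′
  ; stored = at-All (concatUpTo-All tab (λ b → All.map (λ { (inj₁ y∈) → inj₁ (proj₁ (∈-filter⁻ (λ x → h x ≟ b) {xs = K} y∈))
                                                           ; (inj₂ e) → inj₂ e }) (stored (at′ b))) m) (inj₂ refl)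
  }
  where
  open ≤-Reasoning
  open Bucket
  t m : ℕ
  t = w ∸ k
  m = 2 ^ suc k
  h : ℕ → ℕ
  h = hash (suc w) t i
  h<m : ∀ x → h x < m
  h<m x = hash<2^suc w k≤w i x
  K[_] : ℕ → List ℕ
  K[ b ] = filter (λ x → h x ≟ b) K

  few-collisions : collisions w t i K ≤ length K
  few-collisions = *-cancelˡ-≤ (2 ^ k) {{m^n≢0 2 k}} (begin
    2 ^ k * collisions w t i K ≤⟨ p ⟩
    length K * length K        ≤⟨ *-monoˡ-≤ (length K) (<⇒≤ ℓ<) ⟩
    2 ^ k * length K           ∎)

  -- Two keys with the same hash are equal or collide, and `unique` bounds the equal pairs.
  same-hash : ∑ K (λ x → ∑ K (λ y → ⟦ h x ≟ h y ⟧)) ≤ 2 * length K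
  same-hash = begin
    ∑ K (λ x → ∑ K (λ y → ⟦ h x ≟ h y ⟧))
      ≤⟨ ∑-mono K (λ {x} _ → ∑-mono K (λ {y} _ → split x y)) ⟩
    ∑ K (λ x → ∑ K (λ y → ⟦ x ≟ y ⟧ + collides w t i x y))
      ≡⟨ ∑-cong K (λ {x} _ → ∑-+ K (λ y → ⟦ x ≟ y ⟧) (collides w t i x)) ⟩
    ∑ K (λ x → ∑ K (λ y → ⟦ x ≟ y ⟧) + ∑ K (collides w t i x))
      ≡⟨ ∑-+ K (λ x → ∑ K (λ y → ⟦ x ≟ y ⟧)) (λ x → ∑ K (collides w t i x)) ⟩
    ∑ K (λ x → ∑ K (λ y → ⟦ x ≟ y ⟧)) + collisions w t i K
      ≤⟨ +-mono-≤ (∑-mono K (λ {x} _ → ∑-unique≤1 _≟_ unique x)) few-collisions ⟩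
    ∑ K (λ _ → 1) + length K
      ≡⟨ cong (_+ length K) (trans (∑-const K 1) (*-identityʳ _)) ⟩
    length K + length K
      ≡⟨ cong (length K +_) (+-identityʳ _) ⟨
    2 * length K ∎
    where
    split : ∀ x y → ⟦ h x ≟ h y ⟧ ≤ ⟦ x ≟ y ⟧ + collides w t i x y
    split x y with x ≟ y
    ... | yes _ = ⟦ h x ≟ h y ⟧≤1
    ... | no  _ = ≤-refl

  square : ∀ b → length K[ b ] * length K[ b ] ≡ ∑ K (λ x → ∑ K (λ y → ⟦ h x ≟ b ⟧ * ⟦ h y ≟ b ⟧))
  square b = begin-equality
    length K[ b ] * length K[ b ]
      ≡⟨ cong (λ n → n * n) (∑-indicator (λ x → h x ≟ b) K) ⟨
    ∑ K (λ x → ⟦ h x ≟ b ⟧) * ∑ K (λ y → ⟦ h y ≟ b ⟧)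
      ≡⟨ *-comm (∑ K (λ x → ⟦ h x ≟ b ⟧)) _ ⟩
    ∑ K (λ y → ⟦ h y ≟ b ⟧) * ∑ K (λ x → ⟦ h x ≟ b ⟧)
      ≡⟨ ∑-*ˡ K (∑ K (λ y → ⟦ h y ≟ b ⟧)) (λ x → ⟦ h x ≟ b ⟧) ⟨
    ∑ K (λ x → ∑ K (λ y → ⟦ h y ≟ b ⟧) * ⟦ h x ≟ b ⟧)
      ≡⟨ ∑-cong K (λ {x} _ → trans (*-comm (∑ K (λ y → ⟦ h y ≟ b ⟧)) _) (sym (∑-*ˡ K ⟦ h x ≟ b ⟧ (λ y → ⟦ h y ≟ b ⟧)))) ⟩
    ∑ K (λ x → ∑ K (λ y → ⟦ h x ≟ b ⟧ * ⟦ h y ≟ b ⟧)) ∎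

  -- The square of a bucket's size counts the pairs of keys hashed to it.
  squares : ∑ (upTo m) (λ b → length K[ b ] * length K[ b ]) ≤ 2 * length K
  squares = begin
    ∑ (upTo m) (λ b → length K[ b ] * length K[ b ])
      ≡⟨ ∑-cong (upTo m) (λ {b} _ → square b) ⟩
    ∑ (upTo m) (λ b → ∑ K (λ x → ∑ K (λ y → ⟦ h x ≟ b ⟧ * ⟦ h y ≟ b ⟧)))
      ≡⟨ ∑-swap (upTo m) K _ ⟩
    ∑ K (λ x → ∑ (upTo m) (λ b → ∑ K (λ y → ⟦ h x ≟ b ⟧ * ⟦ h y ≟ b ⟧)))
      ≡⟨ ∑-cong K (λ _ → ∑-swap (upTo m) K _) ⟩
    ∑ K (λ x → ∑ K (λ y → ∑ (upTo m) (λ b → ⟦ h x ≟ b ⟧ * ⟦ h y ≟ b ⟧)))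
      ≤⟨ ∑-mono K (λ {x} _ → ∑-mono K (λ {y} _ → pair x y)) ⟩
    ∑ K (λ x → ∑ K (λ y → ⟦ h x ≟ h y ⟧))
      ≤⟨ same-hash ⟩
    2 * length K ∎
    where
    pair : ∀ x y → ∑ (upTo m) (λ b → ⟦ h x ≟ b ⟧ * ⟦ h y ≟ b ⟧) ≤ ⟦ h x ≟ h y ⟧
    pair x y with h x ≟ h y
    ... | yes _ = ≤-trans (∑-mono (upTo m) (λ {b} _ → ≤-trans (*-monoʳ-≤ ⟦ h x ≟ b ⟧ ⟦ h y ≟ b ⟧≤1) (≤-reflexive (*-identityʳ _))))
                    (∑-unique≤1 _≟_ (Uniqueness.upTo⁺ m) (h x))
    ... | no hx≢hy = ≤-reflexive (trans (∑-cong (upTo m) (λ {b} _ → zero-product b)) (trans (∑-const (upTo m) 0) (*-zeroʳ (length (upTo m)))))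
      where
      zero-product : ∀ b → ⟦ h x ≟ b ⟧ * ⟦ h y ≟ b ⟧ ≡ 0
      zero-product b with h x ≟ b
      ... | no _     = refl
      ... | yes refl = trans (+-identityʳ _) (⟦⟧-no (h y ≟ h x) (hx≢hy ∘ sym))

  -- A single bucket must meet the size condition of `bucket`. Its pairs are among all the pairs
  -- with equal hashes.
  square≤ : ∀ b → length K[ b ] * length K[ b ] ≤ 2 * length K
  square≤ b = begin
    length K[ b ] * length K[ b ]                             ≡⟨ square b ⟩
    ∑ K (λ x → ∑ K (λ y → ⟦ h x ≟ b ⟧ * ⟦ h y ≟ b ⟧))   ≤⟨ ∑-mono K (λ {x} _ → ∑-mono K (λ {y} _ → both x y)) ⟩
    ∑ K (λ x → ∑ K (λ y → ⟦ h x ≟ h y ⟧))                  ≤⟨ same-hash ⟩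
    2 * length K                                               ∎
    where
    both : ∀ x y → ⟦ h x ≟ b ⟧ * ⟦ h y ≟ b ⟧ ≤ ⟦ h x ≟ h y ⟧
    both x y with h x ≟ b
    ... | no _     = z≤n
    ... | yes refl = ≤-reflexive (trans (+-identityʳ _) (⟦⟧-cong (h y ≟ h x) (h x ≟ h y) sym sym))

  K[]< : ∀ b → All (_< 2 ^ suc w) K[ b ]
  K[]< b = All.filter⁺ (λ x → h x ≟ b) K<

  at′ : ∀ b → Bucket w K[ b ]
  at′ b = bucket w K[ b ] (K[]< b) (begin
    4 * (length K[ b ] * length K[ b ]) ≤⟨ *-monoʳ-≤ 4 (square≤ b) ⟩
    4 * (2 * length K)                  ≡⟨ *-assoc 4 2 (length K) ⟨
    8 * length K                        ≤⟨ <⇒≤ 8ℓ< ⟩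
    2 ^ suc w                           ∎)

  tab : ℕ → List ℕ
  tab b = table (at′ b)
  offset : ℕ → ℕ
  offset b = length (concatUpTo tab b)

  total≤ : length (concatUpTo tab m) ≤ 8 * length K
  total≤ = begin
    length (concatUpTo tab m)                              ≡⟨ length-concatUpTo tab m ⟩
    ∑ (upTo m) (λ b → length (tab b))                      ≤⟨ ∑-mono (upTo m) (λ {b} _ → table-length (at′ b)) ⟩
    ∑ (upTo m) (λ b → 4 * (length K[ b ] * length K[ b ])) ≡⟨ ∑-*ˡ (upTo m) 4 _ ⟩
    4 * ∑ (upTo m) (λ b → length K[ b ] * length K[ b ])   ≤⟨ *-monoʳ-≤ 4 squares ⟩
    4 * (2 * length K)                                     ≡⟨ *-assoc 4 2 (length K) ⟨
    8 * length K                                           ∎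

  total< : length (concatUpTo tab m) < 2 ^ suc w
  total< = ≤-<-trans total≤ 8ℓ<

  length≤ : ∀ (f : ℕ → ℕ) → length (applyUpTo f m) ≤ 8 * length K
  length≤ f = begin
    length (applyUpTo f m) ≡⟨ length-applyUpTo f m ⟩
    2 * 2 ^ k              ≤⟨ *-monoʳ-≤ 2 ≤2ℓ ⟩
    2 * (2 * length K)     ≡⟨ *-assoc 2 2 (length K) ⟨
    4 * length K           ≤⟨ *-monoˡ-≤ (length K) {4} {8} (s≤s (s≤s (s≤s (s≤s z≤n)))) ⟩
    8 * length K           ∎

  own : ∀ {x} → x ∈ K → x ∈ K[ h x ]
  own {x} x∈ = ∈-filter⁺ (λ y → h y ≟ h x) x∈ refl

  as ts os : ℕ → ℕ
  as = at (applyUpTo (λ b → multiplier (at′ b)) m)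
  ts = at (applyUpTo (λ b → shift (at′ b)) m)
  os = at (applyUpTo offset m)

  found′ : ∀ {x} → x ∈ K →
         at (concatUpTo tab m) (twoLevel (suc w) (1 + 2 * i) t as
                                         ts os x) ≡ x
  found′ {x} x∈ = begin-equality
    at (concatUpTo tab m) (twoLevel (suc w) (1 + 2 * i) t as ts os x)
      ≡⟨ cong (at (concatUpTo tab m)) (twoLevel-≡ (suc w) (1 + 2 * i) t {as} {ts} {os} x
          (at-applyUpTo (λ b → multiplier (at′ b)) m (h<m x)) (at-applyUpTo (λ b → shift (at′ b)) m (h<m x)) (at-applyUpTo offset m (h<m x))) ⟩
    at (concatUpTo tab m) ((offset (h x) + slot (at′ (h x)) x) mod2^ suc w)
      ≡⟨ cong (at (concatUpTo tab m)) (mod-small (suc w) (<-trans (concatUpTo-offset< tab m (h<m x) (slot< (at′ (h x)) (own x∈))) total<)) ⟩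
    at (concatUpTo tab m) (offset (h x) + slot (at′ (h x)) x)
      ≡⟨ at-concatUpTo tab m (h<m x) (slot< (at′ (h x)) (own x∈)) ⟩
    at (tab (h x)) (slot (at′ (h x)) x)
      ≡⟨ found (at′ (h x)) (own x∈) ⟩
    x ∎

-- Binary tries

2^⌊log⌋≤ : ∀ n → 0 < n → 2 ^ ⌊log₂ n ⌋ ≤ n
2^⌊log⌋≤ = <-rec _ go
  where
  open ≤-Reasoning
  go : ∀ n → (∀ {m} → m < n → 0 < m → 2 ^ ⌊log₂ m ⌋ ≤ m) → 0 < n → 2 ^ ⌊log₂ n ⌋ ≤ n
  go zero _ ()
  go (suc zero) _ _ = ≤-refl
  go n@(suc (suc k)) rec _ = begin
    2 ^ ⌊log₂ n ⌋                 ≡⟨ cong (2 ^_) (m+[n∸m]≡n (⌊log₂⌋-mono-≤ {2} {n} (s≤s (s≤s z≤n)))) ⟨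
    2 * 2 ^ (⌊log₂ n ⌋ ∸ 1)       ≡⟨ cong (λ v → 2 * 2 ^ v) (⌊log₂⌊n/2⌋⌋≡⌊log₂n⌋∸1 n) ⟨
    2 * 2 ^ ⌊log₂ ⌊ n /2⌋ ⌋       ≤⟨ *-monoʳ-≤ 2 (rec (⌊n/2⌋<n (suc k)) (s≤s z≤n)) ⟩
    ⌊ n /2⌋ + (⌊ n /2⌋ + 0)       ≡⟨ cong (⌊ n /2⌋ +_) (+-identityʳ _) ⟩
    ⌊ n /2⌋ + ⌊ n /2⌋             ≤⟨ +-monoʳ-≤ ⌊ n /2⌋ (⌊n/2⌋≤⌈n/2⌉ n) ⟩
    ⌊ n /2⌋ + ⌈ n /2⌉             ≡⟨ ⌊n/2⌋+⌈n/2⌉≡n n ⟩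
    n                             ∎

<2^suc⌊log⌋ : ∀ n → n < 2 ^ suc ⌊log₂ n ⌋
<2^suc⌊log⌋ n with <-≤-connex n (2 ^ suc ⌊log₂ n ⌋)
... | inj₁ lt = lt
... | inj₂ ge = contradiction (≤-trans (≤-reflexive (sym (⌊log₂[2^n]⌋≡n (suc ⌊log₂ n ⌋)))) (⌊log₂⌋-mono-≤ ge)) (<-irrefl refl)

2^-cancel-< : ∀ {m n} → 2 ^ m < 2 ^ n → m < n
2^-cancel-< {m} {n} p with <-≤-connex m n
... | inj₁ m<n = m<n
... | inj₂ n≤m = contradiction (<-≤-trans p (^-monoʳ-≤ 2 n≤m)) (<-irrefl refl)

⌊log₂[2^u+v]⌋≡u : ∀ u {v} → v < 2 ^ u → ⌊log₂ (2 ^ u + v) ⌋ ≡ u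
⌊log₂[2^u+v]⌋≡u u {v} v< = ≤-antisym
  (≤-pred (2^-cancel-< {n = suc u} (begin-strict
    2 ^ ⌊log₂ (2 ^ u + v) ⌋ ≤⟨ 2^⌊log⌋≤ (2 ^ u + v) (≤-trans (0<2^ u) (m≤m+n _ v)) ⟩
    2 ^ u + v               <⟨ +-monoʳ-< (2 ^ u) v< ⟩
    2 ^ u + 2 ^ u           ≡⟨ cong (2 ^ u +_) (+-identityʳ _) ⟨
    2 ^ suc u               ∎)))
  (≤-trans (≤-reflexive (sym (⌊log₂[2^n]⌋≡n u))) (⌊log₂⌋-mono-≤ (m≤m+n (2 ^ u) v)))
  where open ≤-Reasoning

opaque
  unfolding _div2^_

  div2^-mono : ∀ {x y} t → x ≤ y → x div2^ t ≤ y div2^ t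
  div2^-mono t = /-monoˡ-≤ (2 ^ t) {{m^n≢0 2 t}}

  div2^0 : ∀ x → x div2^ 0 ≡ x
  div2^0 = n/1≡n

  div2^-div2 : ∀ x t → x div2^ t div2^ 1 ≡ x div2^ suc t
  div2^-div2 x t = trans (m/n/o≡m/[n*o] x (2 ^ t) 2 {{m^n≢0 2 t}} {{_}} {{m*n≢0 (2 ^ t) 2 {{m^n≢0 2 t}}}})
    (/-congʳ {m = x} {{m*n≢0 (2 ^ t) 2 {{m^n≢0 2 t}}}} {{m^n≢0 2 (suc t)}} (*-comm (2 ^ t) 2))

count : {P : ℕ → Set} → Decidable P → ℕ → ℕ
count P? zero    = 0
count P? (suc m) = count P? m + ⟦ P? m ⟧

count-cong : ∀ {P Q : ℕ → Set} (P? : Decidable P) (Q? : Decidable Q) m →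
             (∀ {i} → i < m → (P i → Q i) × (Q i → P i)) → count P? m ≡ count Q? m
count-cong P? Q? zero    h = refl
count-cong P? Q? (suc m) h = cong₂ _+_ (count-cong P? Q? m (h ∘ m<n⇒m<1+n))
  (⟦⟧-cong (P? m) (Q? m) (proj₁ (h ≤-refl)) (proj₂ (h ≤-refl)))

count≤ : ∀ {P : ℕ → Set} (P? : Decidable P) m → count P? m ≤ m
count≤ P? zero    = z≤n
count≤ P? (suc m) = ≤-trans (+-mono-≤ (count≤ P? m) ⟦ P? m ⟧≤1) (≤-reflexive (+-comm m 1))

count-all : ∀ {P : ℕ → Set} (P? : Decidable P) m → (∀ {i} → i < m → P i) → count P? m ≡ m
count-all P? zero    h = refl
count-all P? (suc m) h = trans (cong₂ _+_ (count-all P? m (h ∘ m<n⇒m<1+n)) (⟦⟧-yes (P? m) (h ≤-refl))) (+-comm m 1)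

count-threshold : ∀ {P : ℕ → Set} (P? : Decidable P) m → (∀ {i j} → i ≤ j → j < m → P j → P i) →
                  (∀ {i} → i < count P? m → P i) × (∀ {i} → count P? m ≤ i → i < m → ¬ P i)
count-threshold P? zero h = (λ ()) , λ _ ()
count-threshold P? (suc m) h with P? m
... | yes p = (λ {i} i< → h (≤-pred (≤-trans i< bound)) ≤-refl p) ,
  λ {i} ≤i i<m → contradiction (<-≤-trans i<m (≤-trans (≤-reflexive (sym full)) ≤i)) (<-irrefl refl)
  where
  full : count P? m + 1 ≡ suc m
  full = trans (cong (_+ 1) (count-all P? m (λ i< → h (<⇒≤ i<) ≤-refl p))) (+-comm m 1)
  bound : count P? m + 1 ≤ suc m
  bound = ≤-reflexive full
... | no ¬p rewrite +-identityʳ (count P? m) = let below , above = count-threshold P? m (λ i≤j j<m → h i≤j (m<n⇒m<1+n j<m)) in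
  below , λ {i} ≤i i<1+m → case m≤n⇒m<n∨m≡n (≤-pred i<1+m) of λ where
    (inj₁ i<m) → above ≤i i<m
    (inj₂ refl) → ¬p

-- The default 0 need not be fixed by `f`; a nonzero entry shows that the index is within the list.
at-map : ∀ (f : ℕ → ℕ) xs {i} → at xs i ≢ 0 → at (map f xs) i ≡ f (at xs i)
at-map f []       ≢0         = contradiction refl ≢0
at-map f (x ∷ xs) {zero}  _  = refl
at-map f (x ∷ xs) {suc i} ≢0 = at-map f xs ≢0

length-cartesianProductWith : ∀ {A B C : Set} (f : A → B → C) xs ys → length (cartesianProductWith f xs ys) ≡ length xs * length ys
length-cartesianProductWith f []       ys = refl
length-cartesianProductWith f (x ∷ xs) ys = trans (length-++ (map (f x) ys)) (cong₂ _+_ (length-map (f x) ys) (length-cartesianProductWith f xs ys))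

∈⇒0<length : ∀ {A : Set} {v : A} {l} → v ∈ l → 0 < length l
∈⇒0<length {l = _ ∷ _} _ = s≤s z≤n

-- The node of depth u above x in the binary trie of height L, where the
-- path to a node is written in binary after a leading 1.
node : (L x u : ℕ) → ℕ
node L x u = 2 ^ u + x div2^ (L ∸ u)

path< : ∀ {L x u} → x < 2 ^ L → u ≤ L → x div2^ (L ∸ u) < 2 ^ u
path< {L} {x} {u} x< u≤L = div<2^ u (L ∸ u) (subst (λ v → x < 2 ^ v) (sym (m+[n∸m]≡n u≤L)) x<)

node< : ∀ {w L x u} → L ≤ w → x < 2 ^ L → u < L → node L x u < 2 ^ w
node< {w} {L} {x} {u} L≤w x< u<L = begin-strict
  2 ^ u + x div2^ (L ∸ u) <⟨ +-monoʳ-< (2 ^ u) (path< x< (<⇒≤ u<L)) ⟩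
  2 ^ u + 2 ^ u           ≡⟨ cong (2 ^ u +_) (+-identityʳ _) ⟨
  2 ^ suc u               ≤⟨ ^-monoʳ-≤ 2 (≤-trans u<L L≤w) ⟩
  2 ^ w                   ∎
  where open ≤-Reasoning

depth : ∀ {L x u} → x < 2 ^ L → u ≤ L → ⌊log₂ (node L x u) ⌋ ≡ u
depth {u = u} x< u≤L = ⌊log₂[2^u+v]⌋≡u u (path< x< u≤L)

node≢0 : ∀ L x u → node L x u ≢ 0
node≢0 L x u e = contradiction (<-≤-trans (0<2^ u) (≤-trans (m≤m+n _ _) (≤-reflexive e))) (<-irrefl refl)

module Trie (w L M : ℕ) (y : ℕ → ℕ) (y-mono : ∀ {i j} → i ≤ j → j < M → y i ≤ y j) (y<2^L : ∀ {i} → i < M → y i < 2 ^ L)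
            (0<L : 0 < L) (0<M : 0 < M) (L≤w : L ≤ w) (space : 8 * (M * L) < 2 ^ w) where

  -- Depths stop at L - 1: with its leading 1 a leaf has L + 1 bits, too many if L is the word
  -- length. Common ancestors are merged because `dictionary` wants distinct keys.
  allNodes nodes : List ℕ
  allNodes = cartesianProductWith (λ i u → node L (y i) u) (upTo M) (upTo L)
  nodes = deduplicate _≟_ allNodes

  length-nodes : length nodes ≤ M * L
  length-nodes = begin
    length nodes                     ≤⟨ length-deduplicate _≟_ allNodes ⟩
    length allNodes                  ≡⟨ length-cartesianProductWith _ (upTo M) (upTo L) ⟩
    length (upTo M) * length (upTo L) ≡⟨ cong₂ _*_ (length-upTo M) (length-upTo L) ⟩
    M * L                            ∎
    where open ≤-Reasoning

  node∈ : ∀ {i u} → i < M → u < L → node L (y i) u ∈ nodes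
  node∈ i<M u<L = ∈-deduplicate⁺ _≟_ (∈-cartesianProductWith⁺ (λ i u → node L (y i) u) (∈-upTo⁺ i<M) (∈-upTo⁺ u<L))

  nodes∋ : ∀ {v} → v ∈ nodes → ∃[ i ] ∃[ u ] (i < M × u < L × v ≡ node L (y i) u)
  nodes∋ v∈ with ∈-cartesianProductWith⁻ (λ i u → node L (y i) u) (upTo M) (upTo L) (∈-deduplicate⁻ _≟_ allNodes v∈)
  ... | i , u , i∈ , u∈ , e = i , u , ∈-upTo⁻ i∈ , ∈-upTo⁻ u∈ , e

  opaque
    nodeDictionary : Dictionary w nodes
    nodeDictionary = dictionary w nodes (Uniqueness.deduplicate-! allNodes)
      (All.tabulate λ v∈ → let i , u , i<M , u<L , e = nodes∋ v∈ in subst (_< 2 ^ w) (sym e) (node< L≤w (y<2^L i<M) u<L))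
      (∈⇒0<length (node∈ 0<M 0<L)) (≤-<-trans (*-monoʳ-≤ 8 length-nodes) space)

  open Dictionary nodeDictionary public

  -- The rank among the y i of every x below v whose next bit is b, if v is
  -- the deepest node of the trie above x.
  childRank : ℕ → ℕ → ℕ
  childRank b v = count (λ i → node L (y i) (suc ⌊log₂ v ⌋) ≤? 2 * v + b) M

  lefts rights : List ℕ
  lefts = map (childRank 0) keys
  rights = map (childRank 1) keys

  rankOf : ℕ → ℕ
  rankOf x = count (λ i → y i ≤? x) M

  module _ (x : ℕ) (x<2^L : x < 2 ^ L) where

    InTrie : ℕ → Set
    InTrie u = at keys (slot (node L x u)) ≡ node L x u

    ∈⇒InTrie : ∀ {i u} → i < M → u < L → x div2^ (L ∸ u) ≡ y i div2^ (L ∸ u) → InTrie u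
    ∈⇒InTrie {i} {u} i<M u<L e = found (subst (_∈ nodes) (cong (2 ^ u +_) (sym e)) (node∈ i<M u<L))

    root : InTrie 0
    root = ∈⇒InTrie 0<M 0<L (trans (n<1⇒n≡0 (path< x<2^L z≤n)) (sym (n<1⇒n≡0 (path< (y<2^L 0<M) z≤n))))

    -- At depth L the nodes are the numbers themselves. Otherwise suppose x < y i: then the two
    -- nodes at depth u + 1 are ordered both ways, hence equal, and the node above `x` would be in
    -- the trie after all.
    children-ordered : ∀ {u} → u < L → suc u ≡ L ⊎ ¬ InTrie (suc u) → ∀ {i} → i < M →
                       (node L (y i) (suc u) ≤ node L x (suc u) → y i ≤ x) × (y i ≤ x → node L (y i) (suc u) ≤ node L x (suc u))
    children-ordered {u} u<L last {i} i<M =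
      to (m≤n⇒m<n∨m≡n u<L) last , λ y≤x → +-monoʳ-≤ (2 ^ suc u) (div2^-mono (L ∸ suc u) y≤x)
      where
      shift0 : ∀ {l} → suc u ≡ l → ∀ v → v div2^ (l ∸ suc u) ≡ v
      shift0 refl v = trans (cong (v div2^_) (n∸n≡0 (suc u))) (div2^0 v)
      to : suc u < L ⊎ suc u ≡ L → suc u ≡ L ⊎ ¬ InTrie (suc u) → node L (y i) (suc u) ≤ node L x (suc u) → y i ≤ x
      to (inj₂ su≡L) _ le =
        subst₂ _≤_ (shift0 su≡L (y i)) (shift0 su≡L x) (+-cancelˡ-≤ (2 ^ suc u) _ _ le)
      to (inj₁ su<L) (inj₁ su≡L) le = contradiction su<L (<-irrefl su≡L)
      to (inj₁ su<L) (inj₂ ¬in) le with ≤-<-connex (y i) x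
      ... | inj₁ y≤x = y≤x
      ... | inj₂ x<y = contradiction (∈⇒InTrie i<M su<L
              (≤-antisym (div2^-mono (L ∸ suc u) (<⇒≤ x<y)) (+-cancelˡ-≤ (2 ^ suc u) _ _ le))) ¬in

    child : ∀ {u b} → u < L → x div2^ (L ∸ suc u) div2^ 1 * 2 + b ≡ x div2^ (L ∸ suc u) → 2 * node L x u + b ≡ node L x (suc u)
    child {u} {b} u<L e = begin
      2 * (2 ^ u + x div2^ (L ∸ u)) + b                  ≡⟨ lemma (2 ^ u) (x div2^ (L ∸ u)) b ⟩
      2 * 2 ^ u + (x div2^ (L ∸ u) * 2 + b)              ≡⟨ cong (λ v → 2 ^ suc u + (v * 2 + b)) parent ⟨
      2 * 2 ^ u + (x div2^ (L ∸ suc u) div2^ 1 * 2 + b)  ≡⟨ cong (2 ^ suc u +_) e ⟩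
      node L x (suc u)                                     ∎
      where
      open ≡-Reasoning
      lemma : ∀ a v b → 2 * (a + v) + b ≡ 2 * a + (v * 2 + b)
      lemma = solve-∀
      parent : x div2^ (L ∸ suc u) div2^ 1 ≡ x div2^ (L ∸ u)
      parent = trans (div2^-div2 x (L ∸ suc u)) (cong (x div2^_) (sym (+-∸-assoc 1 u<L)))

    childRank-correct : ∀ {u b} → u < L → InTrie u → suc u ≡ L ⊎ ¬ InTrie (suc u) →
                        x div2^ (L ∸ suc u) div2^ 1 * 2 + b ≡ x div2^ (L ∸ suc u) →
                        at (map (childRank b) keys) (slot (node L x u)) ≡ rankOf x
    childRank-correct {u} {b} u<L in-u last e = begin
      at (map (childRank b) keys) (slot (node L x u)) ≡⟨ at-map (childRank b) keys (subst (_≢ 0) (sym in-u) (node≢0 L x u)) ⟩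
      childRank b (at keys (slot (node L x u)))       ≡⟨ cong (childRank b) in-u ⟩
      childRank b (node L x u)                        ≡⟨ count-cong _ (λ i → y i ≤? x) M (λ {i} i<M →
          subst₂ (λ d c → (node L (y i) (suc d) ≤ c → y i ≤ x) × (y i ≤ x → node L (y i) (suc d) ≤ c))
            (sym (depth x<2^L (<⇒≤ u<L))) (sym (child u<L e)) (children-ordered u<L last i<M)) ⟩
      rankOf x ∎
      where open ≡-Reasoning

    rank-correct : ∀ u → u < L → InTrie u → suc u ≡ L ⊎ ¬ InTrie (suc u) →
      (x div2^ (L ∸ suc u) div2^ 1 * 2 ≡ x div2^ (L ∸ suc u) → at lefts (slot (node L x u)) ≡ rankOf x) ×
      (x div2^ (L ∸ suc u) div2^ 1 * 2 ≢ x div2^ (L ∸ suc u) → at rights (slot (node L x u)) ≡ rankOf x)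
    rank-correct u u<L in-u last =
      (λ even → childRank-correct u<L in-u last (trans (+-identityʳ _) even)) ,
      (λ odd → childRank-correct u<L in-u last (odd-part (x div2^ (L ∸ suc u)) odd))
      where
      odd-part : ∀ z → z div2^ 1 * 2 ≢ z → z div2^ 1 * 2 + 1 ≡ z
      odd-part z ≢z with z mod2^ 1 | mod<2^ z 1 | mod+div z 1
      ... | 0 | _ | e = contradiction (sym e) ≢z
      ... | 1 | _ | e = trans (+-comm _ 1) (sym e)
      ... | suc (suc _) | s≤s (s≤s ()) | _

    rankOf-below : ∀ {i} → i < rankOf x → y i ≤ x
    rankOf-below = proj₁ (count-threshold (λ i → y i ≤? x) M (λ i≤j j<M → ≤-trans (y-mono i≤j j<M)))

    rankOf-above : rankOf x < M → x < y (rankOf x)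
    rankOf-above κ<M = ≰⇒> (proj₂ (count-threshold (λ i → y i ≤? x) M (λ i≤j j<M → ≤-trans (y-mono i≤j j<M))) ≤-refl κ<M)

  lefts≤ : All (_≤ M) lefts
  lefts≤ = All.map⁺ (All.universal (λ v → count≤ _ M) keys)

  rights≤ : All (_≤ M) rights
  rights≤ = All.map⁺ (All.universal (λ v → count≤ _ M) keys)

-- Alignments and pieces

-- At most m insertions and deletions, since done has any m.
data Alignment {σ : ℕ} : ℕ → Str σ → Str σ → Set where
  done : ∀ {m} → Alignment m [] []
  keep : ∀ {m c xs ys} → Alignment m xs ys → Alignment m (c ∷ xs) (c ∷ ys)
  ins  : ∀ {m c xs ys} → Alignment m xs ys → Alignment (suc m) xs (c ∷ ys)
  del  : ∀ {m c xs ys} → Alignment m xs ys → Alignment (suc m) (c ∷ xs) ys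

weaken : ∀ {m} {xs ys : Str σ} → Alignment m xs ys → Alignment (suc m) xs ys
weaken done     = done
weaken (keep d) = keep (weaken d)
weaken (ins d)  = ins (weaken d)
weaken (del d)  = del (weaken d)

aligned : ∀ {m} (xs : Str σ) → Alignment m xs xs
aligned []       = done
aligned (c ∷ xs) = keep (aligned xs)

-- If the removed character was copied, its copy becomes an insertion; if it was deleted, that
-- deletion disappears.
dropFirst : ∀ {m c} {xs ys : Str σ} → Alignment m (c ∷ xs) ys → Alignment (suc m) xs ys
dropFirst (keep d) = ins d
dropFirst (ins d)  = ins (dropFirst d)
dropFirst (del d)  = weaken (weaken d)

-- Alignments have no substitutions: one costs a deletion plus the insertion that `dropFirst` leaves
-- behind, hence the 2 for every edit.
prepend : ∀ {m} {xs ys zs : Str σ} → xs ⇝ ys → Alignment m ys zs → Alignment (2 + m) xs zs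
prepend insert     d        = weaken (dropFirst d)
prepend delete     d        = weaken (del d)
prepend substitute d        = del (dropFirst d)
prepend (later s)  (keep d) = keep (prepend s d)
prepend (later s)  (ins d)  = ins (prepend (later s) d)
prepend (later s)  (del d)  = del (prepend s d)

alignment : ∀ {m} {xs ys : Str σ} → xs ⇝[ m ] ys → Alignment (m * 2) xs ys
alignment done       = aligned _
alignment (step s r) = prepend s (alignment r)

-- With kind = 0, the occurrences numbered rank + 1, rank + 2, … of a
-- character in S₂ are those numbered rank₁ + 1, rank₁ + 2, … in S₁, and a
-- position pos₁ + q in S₁ becomes pos₂ + q in S₂.  With kind = 1, the single
-- occurrence number rank + 1 in S₂ is an inserted character at pos₂.
record Piece : Set where
  constructor piece
  field
    rank kind rank₁ pos₁ pos₂ : ℕ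

open Piece public

data Locates {σ : ℕ} (S : Str σ) (a : Fin σ) : Piece → ℕ → ℕ → Set where
  copied   : ∀ {r r₁ p₁ p₂ y q} → Select S a (suc (y + r₁)) (p₁ + q) →
             Locates S a (piece r 0 r₁ p₁ p₂) (r + y) (q + p₂)
  inserted : ∀ {r r₁ p₁ p₂ x} → Locates S a (piece r 1 r₁ p₁ p₂) x p₂

-- The ranks are increasing, and the pieces apply from their rank on.
find : Piece → List Piece → ℕ → Piece
find cur []       x = cur
find cur (e ∷ es) x = if rank e <ᵇ suc x then find e es x else cur

-- The identity piece. Its fields are what cells beyond the end of an array read as.
origin : Piece
origin = piece 0 0 0 0 0

origin-locates : ∀ {S : Str σ} {a x p} → Select S a (suc x) p → Locates S a origin x p
origin-locates {S = S} {a} {x} {p} s =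
  subst₂ (Locates S a origin) refl (+-identityʳ p)
    (copied {y = x} {q = p} (subst (λ v → Select S a (suc v) p) (sym (+-identityʳ x)) s))

origin-select : ∀ {S : Str σ} {a x p} → Locates S a origin x p → Select S a (suc x) p
origin-select {S = S} {a} (copied {y = y} {q = q} s) =
  subst₂ (Select S a) (cong suc (+-identityʳ y)) (sym (+-identityʳ q)) s

-- The effect of one more character in front: `r` and `r₁` tell whether it is an occurrence in S₂
-- and in S₁, `p₂` and `p₁` whether it is in S₂ and in S₁ at all.
shift : (r r₁ p₁ p₂ : ℕ) → Piece → Piece
shift r r₁ p₁ p₂ e = piece (r + rank e) (kind e) (r₁ + rank₁ e) (p₁ + pos₁ e) (p₂ + pos₂ e)

shift-locates : ∀ {S S′ : Str σ} {a} r r₁ p₁ p₂ → (∀ {j q} → Select S a j q → Select S′ a (r₁ + j) (p₁ + q)) →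
                ∀ {e x p} → Locates S a e x p → Locates S′ a (shift r r₁ p₁ p₂ e) (r + x) (p₂ + p)
shift-locates {S′ = S′} {a} r r₁ p₁ p₂ f (copied {r′} {r₁′} {p₁′} {p₂′} {y} {q} s) =
  subst₂ (Locates S′ a _) (+-assoc r r′ y) (lemma q p₂ p₂′)
    (copied (subst₂ (Select S′ a) (lemma′ r₁ y r₁′) (sym (+-assoc p₁ p₁′ q)) (f s)))
  where
  lemma : ∀ q a b → q + (a + b) ≡ a + (q + b)
  lemma = solve-∀
  lemma′ : ∀ a y b → a + suc (y + b) ≡ suc (y + (a + b))
  lemma′ = solve-∀
shift-locates r r₁ p₁ p₂ f inserted = inserted

+-cancelˡ-<ᵇ : ∀ r m n → (r + m <ᵇ suc (r + n)) ≡ (m <ᵇ suc n)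
+-cancelˡ-<ᵇ zero    m n = refl
+-cancelˡ-<ᵇ (suc r) m n = +-cancelˡ-<ᵇ r m n

find-shift : ∀ r r₁ p₁ p₂ e es x → find (shift r r₁ p₁ p₂ e) (map (shift r r₁ p₁ p₂) es) (r + x) ≡ shift r r₁ p₁ p₂ (find e es x)
find-shift r r₁ p₁ p₂ e []       x = refl
find-shift r r₁ p₁ p₂ e (f ∷ es) x rewrite +-cancelˡ-<ᵇ r (rank f) x with rank f <ᵇ suc x
... | true  = find-shift r r₁ p₁ p₂ f es x
... | false = refl

-- The implicit `origin` does not get shifted. A copied character moves both strings alike, so
-- `origin` stays valid in front and copying creates no piece.
find-shift-origin : ∀ r r₁ p₁ p₂ es x →
  find origin es x ≡ origin × find origin (map (shift r r₁ p₁ p₂) es) (r + x) ≡ origin ⊎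
  find origin (map (shift r r₁ p₁ p₂) es) (r + x) ≡ shift r r₁ p₁ p₂ (find origin es x)
find-shift-origin r r₁ p₁ p₂ []       x = inj₁ (refl , refl)
find-shift-origin r r₁ p₁ p₂ (e ∷ es) x rewrite +-cancelˡ-<ᵇ r (rank e) x with rank e <ᵇ suc x
... | true  = inj₂ (find-shift r r₁ p₁ p₂ e es x)
... | false = inj₁ (refl , refl)

-- The same pieces with the one of rank 0, which may be implicit, in front.
groundHead : List Piece → Piece
groundHead []       = origin
groundHead (e ∷ es) = case rank e of λ { zero → e ; (suc _) → origin }

groundTail : List Piece → List Piece
groundTail []       = []
groundTail (e ∷ es) = case rank e of λ { zero → es ; (suc _) → e ∷ es }

rank-groundHead : ∀ es → rank (groundHead es) ≡ 0
rank-groundHead []                        = refl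
rank-groundHead (piece zero    _ _ _ _ ∷ es) = refl
rank-groundHead (piece (suc _) _ _ _ _ ∷ es) = refl

find-ground : ∀ es x → find origin es x ≡ find (groundHead es) (groundTail es) x
find-ground []                        x = refl
find-ground (piece zero    _ _ _ _ ∷ es) x = refl
find-ground (piece (suc _) _ _ _ _ ∷ es) x = refl

-- An insertion or deletion moves the strings differently, so the implicit identity has to become an
-- explicit piece before the shift.
shiftGround : (r r₁ p₁ p₂ : ℕ) → List Piece → List Piece
shiftGround r r₁ p₁ p₂ es = map (shift r r₁ p₁ p₂) (groundHead es ∷ groundTail es)

find-shiftGround : ∀ r r₁ p₁ p₂ cur es x →
                   find cur (shiftGround r r₁ p₁ p₂ es) (r + x) ≡ shift r r₁ p₁ p₂ (find origin es x)
find-shiftGround r r₁ p₁ p₂ cur es x = begin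
  find cur (shiftGround r r₁ p₁ p₂ es) (r + x)
    ≡⟨ find-taken cur (shift r r₁ p₁ p₂ (groundHead es)) (map (shift r r₁ p₁ p₂) (groundTail es))
         (trans (+-cancelˡ-<ᵇ r _ x) (cong (_<ᵇ suc x) (rank-groundHead es))) ⟩
  find (shift r r₁ p₁ p₂ (groundHead es)) (map (shift r r₁ p₁ p₂) (groundTail es)) (r + x)
    ≡⟨ find-shift r r₁ p₁ p₂ (groundHead es) (groundTail es) x ⟩
  shift r r₁ p₁ p₂ (find (groundHead es) (groundTail es) x)
    ≡⟨ cong (shift r r₁ p₁ p₂) (find-ground es x) ⟨
  shift r r₁ p₁ p₂ (find origin es x) ∎
  where
  open ≡-Reasoning
  find-taken : ∀ cur e es {x} → (rank e <ᵇ suc x) ≡ true → find cur (e ∷ es) x ≡ find e es x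
  find-taken cur e es t rewrite t = refl

¬select-zero : ∀ {S : Str σ} {a p} → ¬ Select S a 0 p
¬select-zero (miss _ s) = ¬select-zero s

module _ (a : Fin σ) where

  -- Below the rank of the first piece, origin applies.
  pieces : ∀ {m xs ys} → Alignment m xs ys → List Piece
  pieces done = []
  pieces (keep {c = c} d) with c Fin.≟ a
  ... | yes _ = map (shift 1 1 1 1) (pieces d)
  ... | no  _ = map (shift 0 0 1 1) (pieces d)
  pieces (ins {c = c} d) with c Fin.≟ a
  ... | yes _ = piece 0 1 0 0 1 ∷ shiftGround 1 0 0 1 (pieces d)
  ... | no  _ = shiftGround 0 0 0 1 (pieces d)
  pieces (del {c = c} d) with c Fin.≟ a
  ... | yes _ = shiftGround 0 1 1 0 (pieces d)
  ... | no  _ = shiftGround 0 0 1 0 (pieces d)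

  private
    kept : ∀ {S S′ : Str σ} r r₁ p₁ p₂ es {x p} →
           (∀ {j q} → Select S a j q → Select S′ a (r₁ + j) (p₁ + q)) →
           (Locates S a origin x p → Locates S′ a origin (r + x) (p₂ + p)) →
           Locates S a (find origin es x) x p →
           Locates S′ a (find origin (map (shift r r₁ p₁ p₂) es) (r + x)) (r + x) (p₂ + p)
    kept {S} {S′} r r₁ p₁ p₂ es {x} {p} f g l with find-shift-origin r r₁ p₁ p₂ es x
    ... | inj₁ (e , e′) = subst (λ v → Locates S′ a v (r + x) (p₂ + p)) (sym e′)
                            (g (subst (λ v → Locates S a v x p) e l))
    ... | inj₂ e′       = subst (λ v → Locates S′ a v (r + x) (p₂ + p)) (sym e′) (shift-locates r r₁ p₁ p₂ f l)

    grounded : ∀ {S S′ : Str σ} r r₁ p₁ p₂ cur es {x p} →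
               (∀ {j q} → Select S a j q → Select S′ a (r₁ + j) (p₁ + q)) →
               Locates S a (find origin es x) x p →
               Locates S′ a (find cur (shiftGround r r₁ p₁ p₂ es) (r + x)) (r + x) (p₂ + p)
    grounded {S} {S′} r r₁ p₁ p₂ cur es {x} {p} f l =
      subst (λ v → Locates S′ a v (r + x) (p₂ + p)) (sym (find-shiftGround r r₁ p₁ p₂ cur es x)) (shift-locates r r₁ p₁ p₂ f l)

    find-before : ∀ {r₁ p₁ p₂} cur es → find cur (map (shift 1 r₁ p₁ p₂) es) 0 ≡ cur
    find-before cur []       = refl
    find-before cur (e ∷ es) = refl

  pieces-locate : ∀ {m xs ys} (d : Alignment m xs ys) {x p} → Select ys a (suc x) p →
                  Locates xs a (find origin (pieces d) x) x p
  pieces-locate {xs = xs} (keep {c = c} d) s with c Fin.≟ a | s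
  -- Rank 0 precedes every piece shifted by 1, so `origin` answers for the copied occurrence itself.
  ... | yes refl | first    = subst (λ v → Locates xs a v 0 1) (sym (find-before origin (pieces d))) (origin-locates first)
  ... | yes refl | hit {j = suc _} s = kept 1 1 1 1 (pieces d) hit (origin-locates ∘ hit ∘ origin-select) (pieces-locate d s)
  ... | yes refl | hit {j = zero} s = ⊥-elim (¬select-zero s)
  ... | yes refl | miss n _ = contradiction refl n
  ... | no  n    | first    = contradiction refl n
  ... | no  n    | hit _    = contradiction refl n
  ... | no  n    | miss _ s = kept 0 0 1 1 (pieces d) (miss n) (origin-locates ∘ miss n ∘ origin-select) (pieces-locate d s)
  pieces-locate {xs = xs} (ins {c = c} d) s with c Fin.≟ a | s
  ... | yes refl | first    =
    subst (λ v → Locates xs a v 0 1)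
      (sym (find-before {0} {0} {1} (piece 0 1 0 0 1) (groundHead (pieces d) ∷ groundTail (pieces d)))) inserted
  ... | yes refl | hit {j = suc _} s = grounded 1 0 0 1 (piece 0 1 0 0 1) (pieces d) (λ t → t) (pieces-locate d s)
  ... | yes refl | hit {j = zero} s = ⊥-elim (¬select-zero s)
  ... | yes refl | miss n _ = contradiction refl n
  ... | no  n    | first    = contradiction refl n
  ... | no  n    | hit _    = contradiction refl n
  ... | no  n    | miss _ s = grounded 0 0 0 1 origin (pieces d) (λ t → t) (pieces-locate d s)
  pieces-locate {xs = xs} (del {c = c} d) s with c Fin.≟ a
  ... | yes refl = grounded 0 1 1 0 origin (pieces d) hit (pieces-locate d s)
  ... | no  n    = grounded 0 0 1 0 origin (pieces d) (miss n) (pieces-locate d s)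

  length-shiftGround : ∀ r r₁ p₁ p₂ es → length (shiftGround r r₁ p₁ p₂ es) ≤ suc (length es)
  length-shiftGround r r₁ p₁ p₂ [] = ≤-refl
  length-shiftGround r r₁ p₁ p₂ (piece zero _ _ _ _ ∷ es) = s≤s (≤-trans (≤-reflexive (length-map _ es)) (n≤1+n _))
  length-shiftGround r r₁ p₁ p₂ (piece (suc _) _ _ _ _ ∷ es) = s≤s (s≤s (≤-reflexive (length-map _ es)))

  -- Inserting `a` adds at most two pieces, one for the inserted occurrence and one for an identity
  -- made explicit behind it. Every other insertion or deletion adds at most one.
  length-pieces : ∀ {m xs ys} (d : Alignment m xs ys) → length (pieces d) ≤ m * 2
  length-pieces done = z≤n
  length-pieces (keep {c = c} d) with c Fin.≟ a
  ... | yes _ = ≤-trans (≤-reflexive (length-map _ (pieces d))) (length-pieces d)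
  ... | no  _ = ≤-trans (≤-reflexive (length-map _ (pieces d))) (length-pieces d)
  length-pieces (ins {c = c} d) with c Fin.≟ a
  ... | yes _ = s≤s (≤-trans (length-shiftGround 1 0 0 1 (pieces d)) (s≤s (length-pieces d)))
  ... | no  _ = ≤-trans (length-shiftGround 0 0 0 1 (pieces d)) (≤-trans (s≤s (length-pieces d)) (n≤1+n _))
  length-pieces (del {c = c} d) with c Fin.≟ a
  ... | yes _ = ≤-trans (length-shiftGround 0 1 1 0 (pieces d)) (≤-trans (s≤s (length-pieces d)) (n≤1+n _))
  ... | no  _ = ≤-trans (length-shiftGround 0 0 1 0 (pieces d)) (≤-trans (s≤s (length-pieces d)) (n≤1+n _))

Ascending : ℕ → List Piece → Set
Ascending b []       = ⊤
Ascending b (e ∷ es) = b ≤ rank e × Ascending (suc (rank e)) es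

shift-ascending : ∀ r r₁ p₁ p₂ {b} es → Ascending b es → Ascending (r + b) (map (shift r r₁ p₁ p₂) es)
shift-ascending r r₁ p₁ p₂ []       _       = tt
shift-ascending r r₁ p₁ p₂ (e ∷ es) (l , s) =
  +-monoʳ-≤ r l , subst (λ v → Ascending v (map (shift r r₁ p₁ p₂) es)) (+-suc r (rank e)) (shift-ascending r r₁ p₁ p₂ es s)

ascending-relax : ∀ {b c} es → b ≤ c → Ascending c es → Ascending b es
ascending-relax []       b≤c _       = tt
ascending-relax (e ∷ es) b≤c (l , s) = ≤-trans b≤c l , s

groundTail-ascending : ∀ es → Ascending 0 es → Ascending 1 (groundTail es)
groundTail-ascending []                           s       = tt
groundTail-ascending (piece zero    _ _ _ _ ∷ es) (_ , s) = s
groundTail-ascending (piece (suc _) _ _ _ _ ∷ es) (_ , s) = s≤s z≤n , s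

shiftGround-ascending : ∀ r r₁ p₁ p₂ es → Ascending 0 es → Ascending r (shiftGround r r₁ p₁ p₂ es)
shiftGround-ascending r r₁ p₁ p₂ es s =
  subst (λ v → Ascending v (shiftGround r r₁ p₁ p₂ es)) (+-identityʳ r)
    (shift-ascending r r₁ p₁ p₂ (groundHead es ∷ groundTail es)
      (z≤n , subst (λ v → Ascending (suc v) (groundTail es)) (sym (rank-groundHead es)) (groundTail-ascending es s)))

pieces-ascending : ∀ (a : Fin σ) {m xs ys} (d : Alignment m xs ys) → Ascending 0 (pieces a d)
pieces-ascending a done = tt
pieces-ascending a (keep {c = c} d) with c Fin.≟ a
... | yes _ = ascending-relax _ z≤n (shift-ascending 1 1 1 1 (pieces a d) (pieces-ascending a d))
... | no  _ = shift-ascending 0 0 1 1 (pieces a d) (pieces-ascending a d)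
pieces-ascending a (ins {c = c} d) with c Fin.≟ a
... | yes _ = z≤n , shiftGround-ascending 1 0 0 1 (pieces a d) (pieces-ascending a d)
... | no  _ = shiftGround-ascending 0 0 0 1 (pieces a d) (pieces-ascending a d)
pieces-ascending a (del {c = c} d) with c Fin.≟ a
... | yes _ = shiftGround-ascending 0 1 1 0 (pieces a d) (pieces-ascending a d)
... | no  _ = shiftGround-ascending 0 0 1 0 (pieces a d) (pieces-ascending a d)

-- Bounds that make each field a word. Kind 1 arises only from a character of S₂, so `n₂` bounds the
-- kind too, even for words of no bits.
record Bounded (n₁ n₂ : ℕ) (e : Piece) : Set where
  constructor bounded
  field
    rank≤  : rank e ≤ n₂
    kind≤  : kind e ≤ n₂
    rank₁≤ : rank₁ e ≤ n₁
    pos₁≤  : pos₁ e ≤ n₁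
    pos₂≤  : pos₂ e ≤ n₂

open Bounded public

origin-bounded : ∀ {n₁ n₂} → Bounded n₁ n₂ origin
origin-bounded = bounded z≤n z≤n z≤n z≤n z≤n

ground-bounded : ∀ {n₁ n₂} es → All (Bounded n₁ n₂) es → All (Bounded n₁ n₂) (groundHead es ∷ groundTail es)
ground-bounded []                           []       = origin-bounded ∷ []
ground-bounded (piece zero    _ _ _ _ ∷ es) bs       = bs
ground-bounded (piece (suc _) _ _ _ _ ∷ es) bs       = origin-bounded ∷ bs

shift-bounded : ∀ r r₁ p₁ p₂ {n₁ n₂ m₁ m₂} es → r + n₂ ≤ m₂ → r₁ + n₁ ≤ m₁ → p₁ + n₁ ≤ m₁ → p₂ + n₂ ≤ m₂ →
                All (Bounded n₁ n₂) es → All (Bounded m₁ m₂) (map (shift r r₁ p₁ p₂) es)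
shift-bounded r r₁ p₁ p₂ es ≤r ≤r₁ ≤p₁ ≤p₂ bs = All.map⁺ (All.map (λ b → bounded
  (≤-trans (+-monoʳ-≤ r (rank≤ b)) ≤r) (≤-trans (kind≤ b) (≤-trans (m≤n+m _ r) ≤r)) (≤-trans (+-monoʳ-≤ r₁ (rank₁≤ b)) ≤r₁)
  (≤-trans (+-monoʳ-≤ p₁ (pos₁≤ b)) ≤p₁) (≤-trans (+-monoʳ-≤ p₂ (pos₂≤ b)) ≤p₂)) bs)

shiftGround-bounded : ∀ r r₁ p₁ p₂ {n₁ n₂ m₁ m₂} es → r + n₂ ≤ m₂ → r₁ + n₁ ≤ m₁ → p₁ + n₁ ≤ m₁ → p₂ + n₂ ≤ m₂ →
                All (Bounded n₁ n₂) es → All (Bounded m₁ m₂) (shiftGround r r₁ p₁ p₂ es)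
shiftGround-bounded r r₁ p₁ p₂ es ≤r ≤r₁ ≤p₁ ≤p₂ bs =
  shift-bounded r r₁ p₁ p₂ (groundHead es ∷ groundTail es) ≤r ≤r₁ ≤p₁ ≤p₂ (ground-bounded es bs)

pieces-bounded : ∀ (a : Fin σ) {m xs ys} (d : Alignment m xs ys) → All (Bounded (length xs) (length ys)) (pieces a d)
pieces-bounded a done = []
pieces-bounded a (keep {c = c} d) with c Fin.≟ a
... | yes _ = shift-bounded 1 1 1 1 (pieces a d) ≤-refl ≤-refl ≤-refl ≤-refl (pieces-bounded a d)
... | no  _ = shift-bounded 0 0 1 1 (pieces a d) (n≤1+n _) (n≤1+n _) ≤-refl ≤-refl (pieces-bounded a d)
pieces-bounded a (ins {c = c} d) with c Fin.≟ a
... | yes _ = bounded z≤n (s≤s z≤n) z≤n z≤n (s≤s z≤n) ∷ shiftGround-bounded 1 0 0 1 (pieces a d) ≤-refl ≤-refl ≤-refl ≤-refl (pieces-bounded a d)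
... | no  _ = shiftGround-bounded 0 0 0 1 (pieces a d) (n≤1+n _) ≤-refl ≤-refl ≤-refl (pieces-bounded a d)
pieces-bounded a (del {c = c} d) with c Fin.≟ a
... | yes _ = shiftGround-bounded 0 1 1 0 (pieces a d) ≤-refl ≤-refl ≤-refl ≤-refl (pieces-bounded a d)
... | no  _ = shiftGround-bounded 0 0 1 0 (pieces a d) ≤-refl (n≤1+n _) ≤-refl ≤-refl (pieces-bounded a d)

-- Strictly increasing ranks bound the number of pieces by the length of S₂, so that the index of
-- the last piece fits into a word.
ascending-length : ∀ {n₁ n₂ b} es → Ascending b es → All (Bounded n₁ n₂) es → b ≤ suc n₂ → b + length es ≤ suc n₂
ascending-length {b = b} []       _       _        b≤ = ≤-trans (≤-reflexive (+-identityʳ b)) b≤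
ascending-length {b = b} (e ∷ es) (l , s) (c ∷ cs) b≤ =
  ≤-trans (≤-reflexive (+-suc b (length es)))
    (≤-trans (+-monoˡ-≤ (length es) (s≤s l)) (ascending-length es s cs (s≤s (rank≤ c))))

length-groundTail : ∀ es → length (groundTail es) ≤ length es
length-groundTail []                           = z≤n
length-groundTail (piece zero    _ _ _ _ ∷ es) = n≤1+n _
length-groundTail (piece (suc _) _ _ _ _ ∷ es) = ≤-refl

-- Reasoning about programs

quotient-/ : ∀ x n .{{_ : NonZero n}} → quotient x n ≡ x / n
quotient-/ x (suc n) = refl

opaque
  unfolding _mod2^_

  value-word : ∀ w n → value (word w n) ≡ n mod2^ w
  value-word w n = toℕ-fromℕ< _

  quotient-div2^ : ∀ x t → quotient x (2 ^ t) ≡ x div2^ t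
  quotient-div2^ x t = quotient-/ x (2 ^ t) {{m^n≢0 2 t}}

State : Set
State = Reg → ℕ

upd : State → Reg → ℕ → State
upd f r v s = if s ≡ᵇ r then v else f s

-- Registers below 9 keep the argument and the constants during the searches; the others are
-- scratch. Preservation is thus decided by computing on register numbers.
Agree : State → State → Set
Agree f g = ∀ r → T (r <ᵇ 9) → g r ≡ f r

≡ᵇ-false : ∀ r s → T (r <ᵇ 9) → T (8 <ᵇ s) → (r ≡ᵇ s) ≡ false
≡ᵇ-false r s p q with r ≡ᵇ s in e
... | false = refl
... | true with ≡ᵇ⇒≡ r s (subst T (sym e) tt)
...   | refl = contradiction (<-≤-trans (<ᵇ⇒< r 9 p) (<ᵇ⇒< 8 r q)) (<-irrefl refl)

agree-upd : ∀ {f g} r v → T (8 <ᵇ r) → Agree f g → Agree f (upd g r v)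
agree-upd r v r> a s s< rewrite ≡ᵇ-false s r s< r> = a s s<

infixr 5 _⨾_

_⨾_ : ∀ {σ k} → Program σ k → Program σ k → Program σ k
_⨾_ = seq

module Execution {σ k w : ℕ} (S : Str σ) (D : Store k w) (mem : Fin k → ℕ → ℕ)
                 (mem≡ : ∀ b i → value (cell (D b) i) ≡ mem b i) where

  _∼_ : Regs w → State → Set
  ρ ∼ f = ∀ r → value (ρ r) ≡ f r

  ∼-upd : ∀ {ρ f r x v} → ρ ∼ f → value x ≡ v → (ρ [ r ≔ x ]) ∼ upd f r v
  ∼-upd {r = r} ρ∼f e s with s ≡ᵇ r
  ... | true  = e
  ... | false = ρ∼f s

  -- A total-correctness triple with budgets for steps and queries. The start is a concrete state of
  -- natural numbers, which the rules below update symbolically.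
  record Exec (P : Program σ k) (f : State) (t q : ℕ) (Q : State → Set) : Set where
    constructor exec
    field
      run : ∀ ρ → ρ ∼ f → ∃[ ρ′ ] ∃[ f′ ] ∃[ t′ ] ∃[ q′ ]
            (Run S D P ρ ρ′ t′ q′ × ρ′ ∼ f′ × Q f′ × t′ ≤ t × q′ ≤ q)

  open Exec public

  private variable
    P P′ : Program σ k
    f : State
    Q R : State → Set
    t t′ q q′ r s s′ v : ℕ

  relax : t ≤ t′ → q ≤ q′ → (∀ {f} → Q f → R f) → Exec P f t q Q → Exec P f t′ q′ R
  relax t≤ q≤ i (exec h) = exec λ ρ ρ∼ → let ρ′ , f′ , a , b , r , ∼′ , Qf , a≤ , b≤ = h ρ ρ∼ in
    ρ′ , f′ , a , b , r , ∼′ , i Qf , ≤-trans a≤ t≤ , ≤-trans b≤ q≤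

  bind : Exec P f t q R → (∀ {f′} → R f′ → Exec P′ f′ t′ q′ Q) → Exec (P ⨾ P′) f (t + t′) (q + q′) Q
  bind (exec h) g = exec λ ρ ρ∼ → let ρ′ , f′ , a , b , r , ∼′ , Rf , a≤ , b≤ = h ρ ρ∼
                                      ρ″ , f″ , a′ , b′ , r′ , ∼″ , Qf , a′≤ , b′≤ = run (g Rf) ρ′ ∼′ in
    ρ″ , f″ , _ , _ , seq r r′ , ∼″ , Qf , +-mono-≤ a≤ a′≤ , +-mono-≤ b≤ b′≤

  end : Q f → Exec skip f 0 0 Q
  end Qf = exec λ ρ ρ∼ → ρ , _ , 0 , 0 , skip , ρ∼ , Qf , z≤n , z≤n

  assign : (∀ ρ → ρ ∼ f → ∃[ x ] (Run S D P ρ (ρ [ r ≔ x ]) t q × value x ≡ v)) →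
           Exec P′ (upd f r v) t′ q′ Q → Exec (P ⨾ P′) f (t + t′) (q + q′) Q
  assign h (exec g) = exec λ ρ ρ∼ →
    let x , i , e = h ρ ρ∼
        ρ″ , f″ , _ , _ , j , ∼″ , Qf , a≤ , b≤ = g _ (∼-upd ρ∼ e) in
    ρ″ , f″ , _ , _ , seq i j , ∼″ , Qf , +-monoʳ-≤ _ a≤ , +-monoʳ-≤ _ b≤

  literal∙ : ∀ n → n < 2 ^ w → Exec P (upd f r n) t q Q → Exec (literal r n ⨾ P) f (1 + t) q Q
  literal∙ n n< = assign λ ρ ρ∼ → word w n , literal , trans (value-word w n) (mod-small w n<)

  binop∙ : ∀ o {x y} → f s ≡ x → f s′ ≡ y → evalℕ w o x y mod2^ w ≡ v →
           Exec P (upd f r v) t q Q → Exec (binop r o s s′ ⨾ P) f (1 + t) q Q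
  binop∙ {s = s} {s′} o refl refl e = assign λ ρ ρ∼ → _ , binop ,
    trans (value-word w _) (trans (cong₂ (λ x y → evalℕ w o x y mod2^ w) (ρ∼ s) (ρ∼ s′)) e)

  load∙ : ∀ b {i} → f s ≡ i → mem b i ≡ v → Exec P (upd f r v) t q Q → Exec (load r b s ⨾ P) f (1 + t) q Q
  load∙ {s = s} b refl e = assign λ ρ ρ∼ → _ , load , trans (cong (λ i → value (cell (D b) i)) (ρ∼ s)) (trans (mem≡ b _) e)

  select∙ : ∀ {a j} → f s ≡ j → Select S a j v → v < 2 ^ w → Exec P (upd f r v) t q Q → Exec (select r a s ⨾ P) f t (1 + q) Q
  select∙ {s = s} {v = v} {a = a} refl h v< = assign λ ρ ρ∼ →
    word w v , select (word w v) (subst₂ (Select S a) (sym (ρ∼ s)) (sym value-v) h) , value-v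
    where
    value-v : value (word w v) ≡ v
    value-v = trans (value-word w v) (mod-small w v<)

  <ᵇ-true : ∀ {m n} → m < n → (m <ᵇ n) ≡ true
  <ᵇ-true {m} {n} m<n with m <ᵇ n | <⇒<ᵇ m<n
  ... | true | _ = refl

  <ᵇ-false : ∀ {m n} → n ≤ m → (m <ᵇ n) ≡ false
  <ᵇ-false {m} {n} n≤m with m <ᵇ n in e
  ... | false = refl
  ... | true  = contradiction (<-≤-trans (<ᵇ⇒< m n (subst T (sym e) tt)) n≤m) (<-irrefl refl)

  ≡ᵇ-true : ∀ {m n} → m ≡ n → (m ≡ᵇ n) ≡ true
  ≡ᵇ-true {m} {n} m≡n with m ≡ᵇ n | ≡⇒≡ᵇ m n m≡n
  ... | true | _ = refl

  ≢⇒≡ᵇ-false : ∀ {m n} → m ≢ n → (m ≡ᵇ n) ≡ false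
  ≢⇒≡ᵇ-false {m} {n} m≢n with m ≡ᵇ n in e
  ... | false = refl
  ... | true  = contradiction (≡ᵇ⇒≡ m n (subst T (sym e) tt)) m≢n

  private
    test≺ : ∀ {ρ} → ρ ∼ f → test (r ≺ s) ρ ≡ (f r <ᵇ f s)
    test≺ {r = r} {s} ρ∼ = cong₂ _<ᵇ_ (ρ∼ r) (ρ∼ s)

    test≈ : ∀ {ρ} → ρ ∼ f → test (r ≈ s) ρ ≡ (f r ≡ᵇ f s)
    test≈ {r = r} {s} ρ∼ = cong₂ _≡ᵇ_ (ρ∼ r) (ρ∼ s)

    thenRun : ∀ {c} → (∀ {ρ} → ρ ∼ f → test c ρ ≡ true) → Exec P f t q Q → Exec (branch c P P′) f (1 + t) q Q
    thenRun h (exec g) = exec λ ρ ρ∼ → let ρ′ , f′ , a , b , r , ∼′ , Qf , a≤ , b≤ = g ρ ρ∼ in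
      ρ′ , f′ , _ , b , then- (h ρ∼) r , ∼′ , Qf , s≤s a≤ , b≤

    elseRun : ∀ {c} → (∀ {ρ} → ρ ∼ f → test c ρ ≡ false) → Exec P′ f t q Q → Exec (branch c P P′) f (1 + t) q Q
    elseRun h (exec g) = exec λ ρ ρ∼ → let ρ′ , f′ , a , b , r , ∼′ , Qf , a≤ , b≤ = g ρ ρ∼ in
      ρ′ , f′ , _ , b , else- (h ρ∼) r , ∼′ , Qf , s≤s a≤ , b≤

  branch≺ : ∀ {x y} → f r ≡ x → f s ≡ y → (x < y → Exec P f t q Q) → (y ≤ x → Exec P′ f t q Q) →
            Exec (branch (r ≺ s) P P′) f (1 + t) q Q
  branch≺ {x = x} {y} refl refl h g with <-≤-connex x y
  ... | inj₁ lt = thenRun (λ ρ∼ → trans (test≺ ρ∼) (<ᵇ-true lt)) (h lt)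
  ... | inj₂ ge = elseRun (λ ρ∼ → trans (test≺ ρ∼) (<ᵇ-false ge)) (g ge)

  branch≈ : ∀ {x y} → f r ≡ x → f s ≡ y → (x ≡ y → Exec P f t q Q) → (x ≢ y → Exec P′ f t q Q) →
            Exec (branch (r ≈ s) P P′) f (1 + t) q Q
  branch≈ {x = x} {y} refl refl h g with x ≟ y
  ... | yes e = thenRun (λ ρ∼ → trans (test≈ ρ∼) (≡ᵇ-true e)) (h e)
  ... | no ¬e = elseRun (λ ρ∼ → trans (test≈ ρ∼) (≢⇒≡ᵇ-false ¬e)) (g ¬e)

  while-exit : f s ≤ f r → Q f → Exec (while (r ≺ s) P) f 1 0 Q
  while-exit ge Qf = exec λ ρ ρ∼ → ρ , _ , 1 , 0 , exit (trans (test≺ ρ∼) (<ᵇ-false ge)) , ρ∼ , Qf , ≤-refl , ≤-refl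

  while-loop : f r < f s → Exec P f t q R → (∀ {f′} → R f′ → Exec (while (r ≺ s) P) f′ t′ q′ Q) →
               Exec (while (r ≺ s) P) f (1 + (t + t′)) (q + q′) Q
  while-loop lt (exec h) g = exec λ ρ ρ∼ →
    let ρ′ , f′ , a , b , r , ∼′ , Rf , a≤ , b≤ = h ρ ρ∼
        ρ″ , f″ , a′ , b′ , r′ , ∼″ , Qf , a′≤ , b′≤ = run (g Rf) ρ′ ∼′ in
    ρ″ , f″ , _ , _ , loop (trans (test≺ ρ∼) (<ᵇ-true lt)) r r′ , ∼″ , Qf , s≤s (+-mono-≤ a≤ a′≤) , +-mono-≤ b≤ b′≤

-- Word arithmetic without overflow

opaque
  unfolding _div2^_

  div2^-≤ : ∀ x t → x div2^ t ≤ x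
  div2^-≤ x t = m/n≤m x (2 ^ t) {{m^n≢0 2 t}}

  div2-< : ∀ x → suc x div2^ 1 < suc x
  div2-< x = m/n<m (suc x) 2 (s≤s (s≤s z≤n))

add-exact : ∀ {w} x y {v} → x + y ≡ v → v < 2 ^ w → evalℕ w add x y mod2^ w ≡ v
add-exact {w} x y refl v< = mod-small w v<

sub-exact : ∀ {w x y} v → v + y ≡ x → x < 2 ^ w → evalℕ w sub x y mod2^ w ≡ v
sub-exact {w} {x} {y} v refl x< = begin
  (v + y + (2 ^ w ∸ y)) mod2^ w   ≡⟨ cong (_mod2^ w) (+-assoc v y (2 ^ w ∸ y)) ⟩
  (v + (y + (2 ^ w ∸ y))) mod2^ w ≡⟨ cong (λ u → (v + u) mod2^ w) (m+[n∸m]≡n (≤-trans (m≤n+m y v) (<⇒≤ x<))) ⟩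
  (v + 2 ^ w) mod2^ w             ≡⟨ cong (λ u → (v + u) mod2^ w) (*-identityˡ (2 ^ w)) ⟨
  (v + 1 * 2 ^ w) mod2^ w         ≡⟨ mod-+* v 1 w ⟩
  v mod2^ w                       ≡⟨ mod-small w (≤-<-trans (m≤m+n v y) x<) ⟩
  v                               ∎
  where open ≡-Reasoning

shr-exact : ∀ {w x y} → x < 2 ^ w → evalℕ w shr x y mod2^ w ≡ x div2^ y
shr-exact {w} {x} {y} x< =
  trans (cong (_mod2^ w) (quotient-div2^ x y)) (mod-small w (≤-<-trans (div2^-≤ x y) x<))

-- Registers and binary search

rX rOne rZero rE rM rB rL rA rT rLo rRem rH rMid rFlag rKey rSlot rU rV rW rK : Reg
rX = 0
rOne = 1
rZero = 2
rE = 3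
rM = 4
rB = 5
rL = 6
rA = 7
rT = 8
rLo = 9
rRem = 10
rH = 11
rMid = 12
rFlag = 13
rKey = 14
rSlot = 15
rU = 16
rV = 17
rW = 18
rK = 19

-- Looks for an m in [lo, lo + len] satisfying the probed predicate whose
-- successor does not satisfy it or exceeds lo + len.
searchStep : ∀ {σ k} → Program σ k → Program σ k
searchStep probe =
  binop rH shr rRem rOne ⨾ binop rH add rH rOne ⨾ binop rMid add rLo rH ⨾ (probe ⨾
  branch (rZero ≺ rFlag)
    (binop rLo add rMid rZero ⨾ binop rRem sub rRem rH ⨾ skip)
    (binop rRem sub rH rOne ⨾ skip))

search : ∀ {σ k} → Program σ k → Program σ k
search probe = while (rZero ≺ rRem) (searchStep probe)

Probed : State → (ℕ → Set) → State → ℕ → State → Set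
Probed f₀ P f m f′ =
  Agree f₀ f′ × f′ rLo ≡ f rLo × f′ rRem ≡ f rRem × f′ rH ≡ f rH × f′ rMid ≡ f rMid ×
  (0 < f′ rFlag × P m ⊎ f′ rFlag ≡ 0 × ¬ P m)

-- Only a boundary is tracked: `P` holds at the left end and fails just past the right end, unless
-- that is the top.
Window : State → (ℕ → Set) → (start top : ℕ) → State → (lo len : ℕ) → Set
Window f₀ P start top f lo len =
  Agree f₀ f × f rLo ≡ lo × f rRem ≡ len × start ≤ lo × P lo × lo + len ≤ top ×
  (lo + len ≡ top ⊎ ¬ P (suc (lo + len)))

Found : State → (ℕ → Set) → (start top : ℕ) → State → Set
Found f₀ P start top f =
  Agree f₀ f × ∃[ m ] (f rLo ≡ m × start ≤ m × m ≤ top × P m × (m ≡ top ⊎ ¬ P (suc m)))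

module _ {σ k w : ℕ} (S : Str σ) (D : Store k w) (mem : Fin k → ℕ → ℕ)
         (mem≡ : ∀ b i → value (cell (D b) i) ≡ mem b i) where

  open Execution S D mem mem≡

  module _ (f₀ : State) (one : f₀ rOne ≡ 1) (zero≡ : f₀ rZero ≡ 0) (P : ℕ → Set) (start top : ℕ) (top< : top < 2 ^ w)
           (probe : Program σ k) (tₚ : ℕ) where

    module _ (probe-exec : ∀ f m → Agree f₀ f → f rMid ≡ m → start < m → m ≤ top → Exec probe f tₚ 0 (Probed f₀ P f m)) where

      -- Probing at distance `half + 1` leaves a remainder of at most `half` on either side, so each
      -- round takes one bit off its length.
      searchStep-exec : ∀ i {f lo len} → Window f₀ P start top f lo (suc len) → suc len < 2 ^ suc i →
                        Exec (searchStep probe) f (6 + tₚ) 0 (λ f′ → ∃[ lo′ ] ∃[ rem′ ] (Window f₀ P start top f′ lo′ rem′ × rem′ < 2 ^ i))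
      searchStep-exec i {f} {lo} {len} (agr , lo≡ , rem≡ , start≤ , Plo , ≤top , last) rem< =
        relax (≤-reflexive (lemma tₚ)) ≤-refl (λ x → x)
          (binop∙ shr rem≡ (trans (agr rOne tt) one) (shr-exact rem<W)
          (binop∙ add refl (trans (agr rOne tt) one) (add-exact half 1 (+-comm half 1) (≤-<-trans h≤rem rem<W))
          (binop∙ add lo≡ refl (add-exact lo h refl (≤-<-trans mid≤top top<))
          (bind (probe-exec f₁ mid (agree-upd rMid _ tt (agree-upd rH _ tt (agree-upd rH _ tt agr))) refl start<mid mid≤top)
            λ {f′} (agr′ , lo′ , rem′ , h′ , mid′ , outcome) →
          branch≺ (trans (agr′ rZero tt) zero≡) refl
            (λ 0<flag →
              binop∙ add mid′ (trans (agr′ rZero tt) zero≡) (add-exact mid 0 (+-identityʳ mid) (≤-<-trans mid≤top top<))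
              (binop∙ sub (trans rem′ rem≡) h′ (sub-exact (suc len ∸ h) (m∸n+n≡m h≤rem) rem<W)
              (end (mid , suc len ∸ h ,
                (agree-upd rRem _ tt (agree-upd rLo _ tt agr′) , refl , refl ,
                 <⇒≤ start<mid , P-mid outcome 0<flag ,
                 ≤-trans (≤-reflexive window-right) ≤top ,
                 subst (λ v → v ≡ top ⊎ ¬ P (suc v)) (sym window-right) last) ,
                right<))))
            (λ flag≤0 →
              relax (n≤1+n 1) ≤-refl (λ x → x)
              (binop∙ sub h′ (trans (agr′ rOne tt) one) (sub-exact half (+-comm half 1) (≤-<-trans h≤rem rem<W))
              (end (lo , half ,
                (agree-upd rRem _ tt agr′ , trans lo′ lo≡ , refl , start≤ , Plo ,
                 ≤-trans (+-monoʳ-≤ lo (<⇒≤ (div2-< len))) ≤top ,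
                 inj₂ (subst (¬_ ∘ P) (+-suc lo half) (¬P-mid outcome flag≤0))) ,
                half<)))))))) 
        where
        lemma : ∀ t → 3 + (t + 3) ≡ 6 + t
        lemma = solve-∀
        half h mid : ℕ
        half = suc len div2^ 1
        h = suc half
        mid = lo + h
        f₁ : State
        f₁ = upd (upd (upd f rH half) rH h) rMid mid
        rem<W : suc len < 2 ^ w
        rem<W = ≤-<-trans (≤-trans (m≤n+m (suc len) lo) ≤top) top<
        h≤rem : h ≤ suc len
        h≤rem = div2-< len
        mid≤top : mid ≤ top
        mid≤top = ≤-trans (+-monoʳ-≤ lo h≤rem) ≤top
        start<mid : start < mid
        start<mid = ≤-<-trans start≤ (m<m+n lo (s≤s z≤n))
        P-mid : ∀ {c} → (0 < c × P mid ⊎ c ≡ 0 × ¬ P mid) → 0 < c → P mid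
        P-mid (inj₁ (_ , p)) _ = p
        P-mid (inj₂ (z , _)) l = contradiction l (<⇒≱ (s≤s (≤-reflexive z)))
        ¬P-mid : ∀ {c} → (0 < c × P mid ⊎ c ≡ 0 × ¬ P mid) → c ≤ 0 → ¬ P mid
        ¬P-mid (inj₁ (l , _)) z = contradiction l (<⇒≱ (s≤s z))
        ¬P-mid (inj₂ (_ , n)) _ = n
        window-right : mid + (suc len ∸ h) ≡ lo + suc len
        window-right = trans (+-assoc lo h _) (cong (lo +_) (m+[n∸m]≡n h≤rem))
        half< : half < 2 ^ i
        half< = div<2^ i 1 (subst (suc len <_) (cong (2 ^_) (+-comm 1 i)) rem<)
        right< : suc len ∸ h < 2 ^ i
        right< = ≤-<-trans (m≤n+o⇒m∸n≤o (suc len) h (begin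
          suc len                       ≡⟨ mod+div (suc len) 1 ⟩
          suc len mod2^ 1 + half * 2    ≤⟨ +-monoˡ-≤ (half * 2) (≤-pred (mod<2^ (suc len) 1)) ⟩
          1 + half * 2                  ≡⟨ double half ⟩
          h + half                      ∎)) half<
          where
          open ≤-Reasoning
          double : ∀ x → 1 + x * 2 ≡ suc x + x
          double = solve-∀

      search-exec : ∀ i {f lo len} → Window f₀ P start top f lo len → len < 2 ^ i → Exec (search probe) f (1 + i * (7 + tₚ)) 0 (Found f₀ P start top)
      search-exec i {f} {lo} {zero} (agr , lo≡ , rem≡ , start≤ , Plo , ≤top , last) _ =
        relax (s≤s z≤n) ≤-refl (λ x → x) (while-exit (≤-trans (≤-reflexive rem≡) z≤n)
          (agr , lo , lo≡ , start≤ , subst (_≤ top) (+-identityʳ lo) ≤top , Plo ,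
           subst (λ v → v ≡ top ⊎ ¬ P (suc v)) (+-identityʳ lo) last))
      search-exec zero {len = suc len} _ (s≤s ())
      search-exec (suc i) {len = suc len} W@(agr , _ , rem≡ , _) rem< =
        relax (≤-reflexive (lemma tₚ (i * (7 + tₚ)))) ≤-refl (λ x → x)
          (while-loop (subst₂ _<_ (sym (trans (agr rZero tt) zero≡)) (sym rem≡) (s≤s z≤n))
            (searchStep-exec i W rem<)
            λ (lo′ , rem′ , W′ , rem′<) → search-exec i W′ rem′<)
        where
        lemma : ∀ t u → 1 + (6 + t + (1 + u)) ≡ 1 + (7 + t + u)
        lemma = solve-∀

-- The query program

select-pos≤ : ∀ {σ} {S : Str σ} {a j p} → Select S a j p → p ≤ length S
select-pos≤ first      = s≤s z≤n
select-pos≤ (hit s)    = s≤s (select-pos≤ s)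
select-pos≤ (miss _ s) = s≤s (select-pos≤ s)

select-rank≤ : ∀ {σ} {S : Str σ} {a j p} → Select S a j p → j ≤ p
select-rank≤ first      = s≤s z≤n
select-rank≤ (hit s)    = s≤s (select-rank≤ s)
select-rank≤ (miss _ s) = ≤-trans (select-rank≤ s) (n≤1+n _)

n∸1<n : ∀ {n} → 0 < n → n ∸ 1 < n
n∸1<n (s≤s _) = ≤-refl

-- Up to topShift these have a single cell: were they fields of one array,
-- the literals addressing them could exceed the word size.
data Array : Set where
  lastIndex reps spacing height topMultiplier topShift : Array
  ranks kinds ranks₁ poss₁ poss₂ : Array
  multipliers shifts offsets keys lefts rights : Array

-- The contract between the tables and the program, in terms of the numbers read, so that the query
-- is verified apart from the construction.
module Layout (w : ℕ) (tab : Array → ℕ → ℕ) where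

  e : ℕ
  e = tab lastIndex 0

  m : ℕ
  m = tab reps 0

  B : ℕ
  B = tab spacing 0

  L : ℕ
  L = tab height 0

  slot : ℕ → ℕ
  slot = twoLevel w (tab topMultiplier 0) (tab topShift 0) (tab multipliers) (tab shifts) (tab offsets)

  InTrie : ℕ → ℕ → Set
  InTrie x u = tab keys (slot (node L x u)) ≡ node L x u

  PieceAt : ℕ → Piece → Set
  PieceAt i p = tab ranks i ≡ rank p × tab kinds i ≡ kind p × tab ranks₁ i ≡ rank₁ p ×
                tab poss₁ i ≡ pos₁ p × tab poss₂ i ≡ pos₂ p

  PiecesLocate : ∀ {σ} (S : Str σ) (a : Fin σ) (x p : ℕ) → Set
  PiecesLocate S a x p = ∀ i → i ≤ e → tab ranks i ≤ x → i ≡ e ⊎ x < tab ranks (suc i) →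
                         ∃[ e′ ] (PieceAt i e′ × Locates S a e′ x p)

  -- At the deepest node of the trie above x, the rank of x depends only on
  -- the next bit of x.
  RankStored : (x κ : ℕ) → Set
  RankStored x κ = ∀ u → u < L → InTrie x u → suc u ≡ L ⊎ ¬ InTrie x (suc u) →
    (x div2^ (L ∸ suc u) div2^ 1 * 2 ≡ x div2^ (L ∸ suc u) → tab lefts (slot (node L x u)) ≡ κ) ×
    (x div2^ (L ∸ suc u) div2^ 1 * 2 ≢ x div2^ (L ∸ suc u) → tab rights (slot (node L x u)) ≡ κ)

  record TrieFor (β x κ : ℕ) : Set where
    constructor trieFor
    field
      L≤w     : L ≤ w
      x<2^L   : x < 2 ^ L
      L≤2^β   : L ≤ 2 ^ β
      0<L     : 0 < L
      root    : InTrie x 0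
      correct : RankStored x κ

  -- The representatives are the pieces B, 2B, up to mB; piece 0, of rank 0, is below every query.
  -- With κ of them at most `x`, the predecessor lies among the pieces from κB on.
  record RankFor (β x κ : ℕ) : Set where
    field
      κ≤m     : κ ≤ m
      κ-lower : tab ranks (κ * B) ≤ x
      κ-upper : κ < m → x < tab ranks (suc κ * B)
      trie    : 0 < m → TrieFor β x κ

  record Spacing (β : ℕ) : Set where
    field
      mB≤e   : m * B ≤ e
      e<     : e < m * B + 2 ^ β
      B≤2^β  : B ≤ 2 ^ β
      0<B    : 0 < m → 0 < B

module Query {σ k : ℕ} (arr : Array → Fin k) (a : Fin σ) where

  trieLookup : Program σ k
  trieLookup =
    binop rU sub rL rMid ⨾ binop rU shr rX rU ⨾ binop rV shl rOne rMid ⨾ binop rKey add rV rU ⨾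
    binop rU mul rA rKey ⨾ binop rU shr rU rT ⨾
    load rV (arr multipliers) rU ⨾ binop rV mul rV rKey ⨾ load rW (arr shifts) rU ⨾ binop rV shr rV rW ⨾
    load rW (arr offsets) rU ⨾ binop rSlot add rW rV ⨾ skip

  trieProbe : Program σ k
  trieProbe =
    trieLookup ⨾ load rV (arr keys) rSlot ⨾
    branch (rV ≈ rKey) (binop rFlag add rOne rZero ⨾ skip) (binop rFlag add rZero rZero ⨾ skip)

  trieRank : Program σ k
  trieRank =
    -- The root is above every number, so it is never probed. The final lookup is repeated because
    -- the last probe may have been at another depth.
    binop rLo add rZero rZero ⨾ binop rRem sub rL rOne ⨾ search trieProbe ⨾ binop rMid add rLo rZero ⨾ trieLookup ⨾
    -- The next bit is the last one of `x` shifted right by L - u - 1; it is 0 exactly if shifting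
    -- out that bit and back changes nothing.
    binop rU sub rL rMid ⨾ binop rU sub rU rOne ⨾ binop rU shr rX rU ⨾ binop rV shr rU rOne ⨾ binop rV shl rV rOne ⨾
    branch (rV ≈ rU) (load rK (arr lefts) rSlot ⨾ skip) (load rK (arr rights) rSlot ⨾ skip)

  rankProbe : Program σ k
  rankProbe =
    load rU (arr ranks) rMid ⨾
    branch (rX ≺ rU) (binop rFlag add rZero rZero ⨾ skip) (binop rFlag add rOne rZero ⨾ skip)

  answer : Program σ k
  answer =
    load rU (arr ranks) rLo ⨾ load rV (arr kinds) rLo ⨾ load rW (arr poss₂) rLo ⨾
    branch (rZero ≺ rV)
      (binop rX add rW rZero ⨾ skip)
      (binop rX sub rX rU ⨾ load rU (arr ranks₁) rLo ⨾ binop rX add rX rU ⨾ binop rX add rX rOne ⨾ select rX a rX ⨾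
       load rU (arr poss₁) rLo ⨾ binop rX sub rX rU ⨾ binop rX add rX rW ⨾ skip)

  query : Program σ k
  query =
    -- Ranks count preceding occurrences, so `j` is decremented. The literal 1 fits into a word
    -- because a valid `j` is at least 1.
    literal rOne 1 ⨾ binop rX sub rX rOne ⨾ load rE (arr lastIndex) rZero ⨾ load rM (arr reps) rZero ⨾
    load rB (arr spacing) rZero ⨾ load rL (arr height) rZero ⨾ load rA (arr topMultiplier) rZero ⨾ load rT (arr topShift) rZero ⨾
    branch (rZero ≺ rM) trieRank (binop rK add rZero rZero ⨾ skip) ⨾
    binop rLo mul rK rB ⨾
    -- Blocks in front of the last representative have exactly B pieces; the last block runs to
    -- piece `e`.
    branch (rK ≺ rM) (binop rRem sub rB rOne ⨾ skip) (binop rRem sub rE rLo ⨾ skip) ⨾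
    search rankProbe ⨾ answer

  module Correct {w : ℕ} (S : Str σ) (D : Store k w) (tab : Array → ℕ → ℕ)
                 (tab≡ : ∀ b i → value (cell (D (arr b)) i) ≡ tab b i) where

    open Execution S D (λ b i → value (cell (D b) i)) (λ _ _ → refl)

    open Layout w tab

    tab< : ∀ b i → tab b i < 2 ^ w
    tab< b i = subst (_< 2 ^ w) (tab≡ b i) (toℕ<n _)

    module _ (x : ℕ) (x<W : suc x < 2 ^ w) where

      1<W : 1 < 2 ^ w
      1<W = ≤-<-trans (s≤s z≤n) x<W

      0<W : 0 < 2 ^ w
      0<W = 0<2^ w

      record Constants (f : State) : Set where
        constructor constants
        field
          isX    : f rX ≡ x
          isOne  : f rOne ≡ 1
          isZero : f rZero ≡ 0
          isE    : f rE ≡ e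
          isM    : f rM ≡ m
          isB    : f rB ≡ B
          isL    : f rL ≡ L
          isA    : f rA ≡ tab topMultiplier 0
          isT    : f rT ≡ tab topShift 0

      open Constants

      constants-agree : ∀ {f g} → Constants f → Agree f g → Constants g
      constants-agree c agr = constants
        (trans (agr rX tt) (isX c)) (trans (agr rOne tt) (isOne c)) (trans (agr rZero tt) (isZero c))
        (trans (agr rE tt) (isE c)) (trans (agr rM tt) (isM c)) (trans (agr rB tt) (isB c))
        (trans (agr rL tt) (isL c)) (trans (agr rA tt) (isA c)) (trans (agr rT tt) (isT c))

      Ranked : State → State → ℕ → Set
      Ranked f f′ κ = Agree f f′ × f′ rK ≡ κ

      module _ (L≤w : L ≤ w) (x<2^L : x < 2 ^ L) where

        2^u<W : ∀ {u} → u < L → 2 ^ u < 2 ^ w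
        2^u<W u<L = ^-monoʳ-< 2 (s≤s (s≤s z≤n)) (<-≤-trans u<L L≤w)

        LookedUp : State → ℕ → State → Set
        LookedUp f u f′ = Agree f f′ × f′ rLo ≡ f rLo × f′ rRem ≡ f rRem × f′ rH ≡ f rH × f′ rMid ≡ f rMid ×
                          f′ rKey ≡ node L x u × f′ rSlot ≡ slot (node L x u)

        trieLookup-exec : ∀ {f u} → Constants f → f rMid ≡ u → u < L → Exec trieLookup f 12 0 (LookedUp f u)
        trieLookup-exec {f} {u} c mid u<L =
          binop∙ sub (isL c) mid (sub-exact (L ∸ u) (m∸n+n≡m (<⇒≤ u<L)) (tab< height 0)) $
          binop∙ shr (isX c) refl (shr-exact (<-trans (n<1+n x) x<W)) $
          binop∙ shl (isOne c) mid (trans (cong (_mod2^ w) (*-identityˡ (2 ^ u))) (mod-small w (2^u<W u<L))) $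
          binop∙ add refl refl (add-exact (2 ^ u) (x div2^ (L ∸ u)) refl (node< L≤w x<2^L u<L)) $
          binop∙ mul (isA c) refl refl $
          binop∙ shr refl (isT c) (shr-exact (mod<2^ _ w)) $
          load∙ (arr multipliers) refl (tab≡ multipliers _) $
          binop∙ mul refl refl refl $
          load∙ (arr shifts) refl (tab≡ shifts _) $
          binop∙ shr refl refl (shr-exact (mod<2^ _ w)) $
          load∙ (arr offsets) refl (tab≡ offsets _) $
          binop∙ add refl refl refl $
          end (agree-upd rSlot _ tt
               (agree-upd rW _ tt (agree-upd rV _ tt (agree-upd rW _ tt (agree-upd rV _ tt
               (agree-upd rV _ tt (agree-upd rU _ tt (agree-upd rU _ tt (agree-upd rKey _ tt
               (agree-upd rV _ tt (agree-upd rU _ tt (agree-upd rU _ tt λ _ _ → refl))))))))))) ,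
                refl , refl , refl , refl , refl , refl)

        trieProbe-exec : ∀ {f₀} → Constants f₀ → ∀ f u → Agree f₀ f → f rMid ≡ u → 0 < u → u ≤ L ∸ 1 →
                         Exec trieProbe f 15 0 (Probed f₀ (InTrie x) f u)
        trieProbe-exec {f₀} c f u agr mid 0<u u≤ =
          bind (trieLookup-exec (constants-agree c agr) mid (m≤n∸1⇒m<n 0<u u≤)) λ {f′} (agr′ , lo , len , h , mid , key , slot≡) →
          let c′ = constants-agree c (λ r r< → trans (agr′ r r<) (agr r r<)) in
          load∙ (arr keys) slot≡ (tab≡ keys _) $
          branch≈ refl key
            (λ p → binop∙ add (isOne c′) (isZero c′) (add-exact 1 0 refl 1<W) $
              end (agree-upd rFlag _ tt (agree-upd rV _ tt λ r r< → trans (agr′ r r<) (agr r r<)) , lo , len , h , mid , inj₁ (s≤s z≤n , p)))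
            (λ ¬p → binop∙ add (isZero c′) (isZero c′) (add-exact 0 0 refl 0<W) $
              end (agree-upd rFlag _ tt (agree-upd rV _ tt λ r r< → trans (agr′ r r<) (agr r r<)) , lo , len , h , mid , inj₂ (refl , ¬p)))
          where
          m≤n∸1⇒m<n : ∀ {m n} → 0 < m → m ≤ n ∸ 1 → m < n
          m≤n∸1⇒m<n {n = zero} (s≤s _) ()
          m≤n∸1⇒m<n {n = suc n} _ p = s≤s p

        trieRank-exec : ∀ β κ → L ≤ 2 ^ β → 0 < L → InTrie x 0 →
          RankStored x κ →
          ∀ {f} → Constants f → Exec trieRank f (2 + (1 + β * 22 + (1 + (12 + 7)))) 0 (λ f′ → Ranked f f′ κ)
        trieRank-exec β κ L≤ 0<L root rank-correct {f} c =
          binop∙ add (isZero c) (isZero c) (add-exact 0 0 refl 0<W) $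
          binop∙ sub (isL c) (isOne c) (sub-exact (L ∸ 1) (m∸n+n≡m 0<L) (tab< height 0)) $
          bind (search-exec S D _ (λ _ _ → refl) f (isOne c) (isZero c) (InTrie x) 0 (L ∸ 1) (≤-<-trans (m∸n≤m L 1) (tab< height 0))
                  trieProbe 15 (trieProbe-exec c) β
                  (agree-upd rRem _ tt (agree-upd rLo _ tt λ _ _ → refl) , refl , refl , z≤n , root , ≤-refl , inj₁ refl)
                  (<-≤-trans (n∸1<n 0<L) L≤))
            λ {f′} (agr , u , lo , _ , u≤ , in-u , above) →
          let u<L = ≤-<-trans u≤ (n∸1<n 0<L)
              c′ = constants-agree c agr in
          binop∙ add lo (isZero c′) (add-exact u 0 (+-identityʳ u) (<-trans u<L (tab< height 0))) $
          bind (trieLookup-exec (constants-agree c (agree-upd rMid u tt agr)) refl u<L) λ {f″} (agr′ , _ , _ , _ , mid , _ , slot≡) →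
          let agr″ = λ r r< → trans (agr′ r r<) (agree-upd rMid u tt agr r r<)
              c″ = constants-agree c agr″
              z = x div2^ (L ∸ suc u)
              z≤x = div2^-≤ x (L ∸ suc u)
              correct = rank-correct u u<L in-u (top-or u above) in
          binop∙ sub (isL c″) mid (sub-exact (L ∸ u) (m∸n+n≡m (<⇒≤ u<L)) (tab< height 0)) $
          binop∙ sub refl (isOne c″) (sub-exact (L ∸ suc u) (one-less u<L) (≤-<-trans (m∸n≤m L u) (tab< height 0))) $
          binop∙ shr (isX c″) refl (shr-exact (<-trans (n<1+n x) x<W)) $
          binop∙ shr refl (isOne c″) (shr-exact (≤-<-trans z≤x (<-trans (n<1+n x) x<W))) $
          binop∙ shl refl (isOne c″) (mod-small w (≤-<-trans (≤-trans (half*2≤ z) z≤x) (<-trans (n<1+n x) x<W))) $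
          branch≈ refl refl
            (λ even → load∙ (arr lefts) slot≡ (trans (tab≡ lefts _) (proj₁ correct even)) (end (ranked agr″ , refl)))
            (λ odd → load∙ (arr rights) slot≡ (trans (tab≡ rights _) (proj₂ correct odd)) (end (ranked agr″ , refl)))
          where
          top-or : ∀ u → u ≡ L ∸ 1 ⊎ ¬ InTrie x (suc u) → suc u ≡ L ⊎ ¬ InTrie x (suc u)
          top-or u (inj₁ refl) = inj₁ (m+[n∸m]≡n 0<L)
          top-or u (inj₂ n) = inj₂ n
          one-less : ∀ {u} → u < L → L ∸ suc u + 1 ≡ L ∸ u
          one-less {u} u<L = trans (+-comm _ 1) (sym (+-∸-assoc 1 u<L))
          half*2≤ : ∀ z → z div2^ 1 * 2 ≤ z
          half*2≤ z = ≤-trans (m≤n+m _ (z mod2^ 1)) (≤-reflexive (sym (mod+div z 1)))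
          ranked : ∀ {f″ v₁ v₂ v₃ v₄ v₅ v₆} → Agree f f″ → Agree f (upd (upd (upd (upd (upd (upd f″ rU v₁) rU v₂) rU v₃) rV v₄) rV v₅) rK v₆)
          ranked agr = agree-upd rK _ tt (agree-upd rV _ tt (agree-upd rV _ tt (agree-upd rU _ tt (agree-upd rU _ tt (agree-upd rU _ tt agr)))))

      rankProbe-exec : ∀ {f₀} → Constants f₀ → ∀ f i → Agree f₀ f → f rMid ≡ i →
                       Exec rankProbe f 3 0 (Probed f₀ (λ i → tab ranks i ≤ x) f i)
      rankProbe-exec c f i agr mid =
        load∙ (arr ranks) mid (tab≡ ranks i) $
        branch≺ (isX c′) refl
          (λ x< → binop∙ add (isZero c′) (isZero c′) (add-exact 0 0 refl 0<W) $
            end (agree-upd rFlag _ tt (agree-upd rU _ tt agr) , refl , refl , refl , refl , inj₂ (refl , <⇒≱ x<)))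
          (λ ≤x → binop∙ add (isOne c′) (isZero c′) (add-exact 1 0 refl 1<W) $
            end (agree-upd rFlag _ tt (agree-upd rU _ tt agr) , refl , refl , refl , refl , inj₁ (s≤s z≤n , ≤x)))
        where c′ = constants-agree c agr

      -- The rank is generalised to `x′`, so that matching on `Locates` can refine it.
      answer-exec : length S < 2 ^ w → ∀ {i e x′ p f} → PieceAt i e → Locates S a e x′ p → x′ ≡ x → p < 2 ^ w →
                    Constants f → f rLo ≡ i → Exec answer f 11 1 (λ f′ → f′ rX ≡ p)
      answer-exec S< {i} (at-rank , at-kind , at-rank₁ , at-pos₁ , at-pos₂) inserted _ p< c lo =
        load∙ (arr ranks) lo (trans (tab≡ ranks i) at-rank) $
        load∙ (arr kinds) lo (trans (tab≡ kinds i) at-kind) $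
        load∙ (arr poss₂) lo (trans (tab≡ poss₂ i) at-pos₂) $
        branch≺ (isZero c) refl
          (λ _ → relax {t = 1} {q = 0} (s≤s z≤n) z≤n (λ e → e) $
            binop∙ add refl (isZero c) (add-exact _ 0 (+-identityʳ _) p<) $
            end refl)
          (λ ())
      answer-exec S< {i} (at-rank , at-kind , at-rank₁ , at-pos₁ , at-pos₂)
                  (copied {r} {r₁} {p₁} {p₂} {y} {q} s) x′≡ p< c lo =
        load∙ (arr ranks) lo (trans (tab≡ ranks i) at-rank) $
        load∙ (arr kinds) lo (trans (tab≡ kinds i) at-kind) $
        load∙ (arr poss₂) lo (trans (tab≡ poss₂ i) at-pos₂) $
        branch≺ (isZero c) refl
          (λ ())
          (λ _ →
            binop∙ sub (isX c) refl (sub-exact y (trans (+-comm y r) x′≡) (<-trans (n<1+n x) x<W)) $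
            load∙ (arr ranks₁) lo (trans (tab≡ ranks₁ i) at-rank₁) $
            binop∙ add refl refl (add-exact y r₁ refl (<-trans (n<1+n _) rank<)) $
            binop∙ add refl (isOne c) (add-exact (y + r₁) 1 (+-comm (y + r₁) 1) rank<) $
            select∙ refl s (≤-<-trans (select-pos≤ s) S<) $
            load∙ (arr poss₁) lo (trans (tab≡ poss₁ i) at-pos₁) $
            binop∙ sub refl refl (sub-exact q (+-comm q p₁) (≤-<-trans (select-pos≤ s) S<)) $
            binop∙ add refl refl (add-exact q p₂ refl p<) $
            end refl)
        where
        rank< : suc (y + r₁) < 2 ^ w
        rank< = ≤-<-trans (≤-trans (select-rank≤ s) (select-pos≤ s)) S<

      module _ (β κ p : ℕ)
        (S< : length S < 2 ^ w) (p< : p < 2 ^ w)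
        (spacing-ok : Spacing β) (rank-ok : RankFor β x κ)
        (locate : PiecesLocate S a x p)
        where

        open Spacing spacing-ok
        open RankFor rank-ok

        -- A search round costs 7 steps besides its probe: 22 is 7 + 15 in the trie, 10 is 7 + 3
        -- among the ranks.
        queryTime : ℕ
        queryTime = 8 + (24 + β * 22 + (1 + (2 + (1 + β * 10 + 11))))

        κB≤e : κ * B ≤ e
        κB≤e = ≤-trans (*-monoˡ-≤ B κ≤m) mB≤e

        Bucketed : State → State → Set
        Bucketed f₀ f = ∃[ len ] (Agree f₀ f × f rLo ≡ κ * B × f rRem ≡ len × κ * B + len ≤ e ×
                                  (κ * B + len ≡ e ⊎ x < tab ranks (suc (κ * B + len))) × len < 2 ^ β)

        bucket-exec : ∀ {f₀ f} → Constants f₀ → Agree f₀ f → f rLo ≡ κ * B → f rK ≡ κ →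
                      Exec (branch (rK ≺ rM) (binop rRem sub rB rOne ⨾ skip) (binop rRem sub rE rLo ⨾ skip)) f 2 0 (Bucketed f₀)
        bucket-exec c agr lo k≡ =
          branch≺ k≡ (isM c′)
            (λ κ<m → let 0<B′ = 0<B (≤-<-trans z≤n κ<m)
                         next = trans (cong suc (sym (+-∸-assoc (κ * B) 0<B′)))
                                  (trans (m+[n∸m]≡n (≤-trans 0<B′ (m≤n+m B (κ * B)))) (+-comm (κ * B) B)) in
              binop∙ sub (isB c′) (isOne c′) (sub-exact (B ∸ 1) (m∸n+n≡m 0<B′) (tab< spacing 0)) $
              end (B ∸ 1 , agree-upd rRem _ tt agr , lo , refl ,
                   ≤-trans (n≤1+n _) (≤-trans (≤-reflexive next) (≤-trans (*-monoˡ-≤ B κ<m) mB≤e)) ,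
                   inj₂ (subst (λ v → x < tab ranks v) (sym next) (κ-upper κ<m)) ,
                   <-≤-trans (n∸1<n 0<B′) B≤2^β))
            (λ m≤κ →
              binop∙ sub (isE c′) lo (sub-exact (e ∸ κ * B) (m∸n+n≡m κB≤e) (tab< lastIndex 0)) $
              end (e ∸ κ * B , agree-upd rRem _ tt agr , lo , refl ,
                   ≤-reflexive (m+[n∸m]≡n κB≤e) , inj₁ (m+[n∸m]≡n κB≤e) ,
                   +-cancelˡ-< (κ * B) _ _ (subst₂ _<_ (sym (m+[n∸m]≡n κB≤e)) (cong (λ v → v * B + 2 ^ β) (≤-antisym m≤κ κ≤m)) e<)))
          where c′ = constants-agree c agr

        query-exec : Exec query (upd (λ _ → 0) rX (suc x)) queryTime 1 (λ f → f rX ≡ p)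
        query-exec =
          literal∙ 1 1<W $
          binop∙ sub refl refl (sub-exact x (+-comm x 1) x<W) $
          load∙ (arr lastIndex) refl (tab≡ lastIndex 0) $
          load∙ (arr reps) refl (tab≡ reps 0) $
          load∙ (arr spacing) refl (tab≡ spacing 0) $
          load∙ (arr height) refl (tab≡ height 0) $
          load∙ (arr topMultiplier) refl (tab≡ topMultiplier 0) $
          load∙ (arr topShift) refl (tab≡ topShift 0) $
          bind {q = 0} {R = λ f′ → Ranked f₀ f′ κ}
            (branch≺ {t = 23 + β * 22} {y = m} refl refl
              (λ 0<m → relax (≤-reflexive (lemma (β * 22))) ≤-refl (λ e → e) (rank-exec (trie 0<m)))
              (λ m≤0 → relax {t = 1} (s≤s z≤n) ≤-refl (λ e → e) $
                binop∙ add refl refl (add-exact 0 0 refl 0<W) $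
                end (agree-upd rK _ tt (λ _ _ → refl) , sym (n≤0⇒n≡0 (≤-trans κ≤m m≤0))))) λ {f₁} (agr₁ , k≡) →
          binop∙ mul k≡ (isB (constants-agree c₀ agr₁)) (mod-small w (≤-<-trans κB≤e (tab< lastIndex 0))) $
          bind {q = 0} (bucket-exec c₀ (agree-upd rLo _ tt agr₁) refl k≡) λ {f₂} (len , agr₂ , lo , len≡ , ≤e , last , len<) →
          bind {q = 0} (search-exec S D _ (λ _ _ → refl) f₀ refl refl (λ i → tab ranks i ≤ x) (κ * B) (κ * B + len) (≤-<-trans ≤e (tab< lastIndex 0))
                         rankProbe 3 (λ f i agr mid _ _ → rankProbe-exec c₀ f i agr mid) β
                         (agr₂ , lo , len≡ , ≤-refl , κ-lower , ≤-refl , inj₁ refl) len<)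
            λ {f₃} (agr₃ , i , lo≡ , _ , i≤ , below , above) →
          let e′ , at-i , located = locate i (≤-trans i≤ ≤e) below (right last above) in
          answer-exec S< at-i located refl p< (constants-agree c₀ agr₃) lo≡
          where
          f₀ : State
          f₀ = upd (upd (upd (upd (upd (upd (upd (upd (upd (λ _ → 0) rX (suc x)) rOne 1) rX x) rE e) rM m) rB B) rL L)
                 rA (tab topMultiplier 0)) rT (tab topShift 0)
          c₀ : Constants f₀
          c₀ = constants refl refl refl refl refl refl refl refl refl
          rank-exec : TrieFor β x κ → Exec trieRank f₀ (2 + (1 + β * 22 + (1 + (12 + 7)))) 0 (λ f′ → Ranked f₀ f′ κ)
          rank-exec (trieFor L≤w x<2^L L≤2^β 0<L root correct) = trieRank-exec L≤w x<2^L β κ L≤2^β 0<L root correct c₀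
          lemma : ∀ b → 2 + (1 + b + (1 + (12 + 7))) ≡ 23 + b
          lemma = solve-∀
          right : ∀ {len i} → κ * B + len ≡ e ⊎ x < tab ranks (suc (κ * B + len)) →
                  i ≡ κ * B + len ⊎ ¬ tab ranks (suc i) ≤ x → i ≡ e ⊎ x < tab ranks (suc i)
          right last       (inj₂ ≰x)  = inj₂ (≰⇒> ≰x)
          right last       (inj₁ refl) = last

-- The stored arrays

nth : List Piece → ℕ → Piece
nth []       i       = origin
nth (e ∷ es) zero    = e
nth (e ∷ es) (suc i) = nth es i

at-map-nth : ∀ (f : Piece → ℕ) → f origin ≡ 0 → ∀ es i → at (map f es) i ≡ f (nth es i)
at-map-nth f f0 []       i       = sym f0
at-map-nth f f0 (e ∷ es) zero    = refl
at-map-nth f f0 (e ∷ es) (suc i) = at-map-nth f f0 es i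

ascending-nth : ∀ {b} es → Ascending b es → ∀ {i} → i < length es → b ≤ rank (nth es i)
ascending-nth (e ∷ es) (l , s) {zero}  _       = l
ascending-nth (e ∷ es) (l , s) {suc i} (s≤s p) = ≤-trans l (≤-trans (n≤1+n _) (ascending-nth es s p))

nth-mono : ∀ {b} es → Ascending b es → ∀ {i j} → i ≤ j → j < length es → rank (nth es i) ≤ rank (nth es j)
nth-mono (e ∷ es) (l , s) {zero}  {zero}  _         _       = ≤-refl
nth-mono (e ∷ es) (l , s) {zero}  {suc j} _         (s≤s p) = ≤-trans (n≤1+n _) (ascending-nth es s p)
nth-mono (e ∷ es) (l , s) {suc i} {suc j} (s≤s i≤j) (s≤s p) = nth-mono es s i≤j p

-- Connects the linear scan that specifies the pieces with the boundary that binary search returns.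
find-nth : ∀ cur es {b x i} → Ascending b es → i ≤ length es → rank (nth (cur ∷ es) i) ≤ x →
           i ≡ length es ⊎ x < rank (nth (cur ∷ es) (suc i)) → find cur es x ≡ nth (cur ∷ es) i
find-nth cur [] {i = zero} s _ _ _ = refl
find-nth cur (e ∷ es) {x = x} {zero} s _ _ (inj₂ x<) with rank e <ᵇ suc x in eq
... | false = refl
... | true  = contradiction (≤-pred (<ᵇ⇒< (rank e) (suc x) (subst T (sym eq) _))) (<⇒≱ x<)
find-nth cur (e ∷ es) {x = x} {suc i} (l , s) (s≤s i≤) ≤x last with rank e <ᵇ suc x in eq
... | false = contradiction
  (<⇒<ᵇ (s≤s (≤-trans (nth-mono {0} (e ∷ es) (z≤n , s) {0} {i} z≤n (s≤s i≤)) ≤x)))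
  (subst (¬_ ∘ T) (sym eq) (λ ()))
... | true  = find-nth e es s i≤ ≤x (case last of λ { (inj₁ refl) → inj₁ refl ; (inj₂ x<) → inj₂ x< })

-- An upper bound for the logarithm of the spacing: 3 for its factor 8 and 1 for rounding up the
-- iterated logarithm.
exponent : ℕ → ℕ
exponent n = 4 + ⌊log₂ ⌊log₂ n ⌋ ⌋

record Tables (w n e : ℕ) (rs ks rs₁ ps₁ ps₂ : List ℕ) : Set where
  field
    table        : Array → List ℕ
    table<       : ∀ b → All (_< 2 ^ w) (table b)
    length-table : ∀ b → length (table b) ≤ suc e
    is-lastIndex : table lastIndex ≡ e ∷ []
    is-ranks     : table ranks ≡ rs
    is-kinds     : table kinds ≡ ks
    is-ranks₁    : table ranks₁ ≡ rs₁
    is-poss₁     : table poss₁ ≡ ps₁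
    is-poss₂     : table poss₂ ≡ ps₂

  tab : Array → ℕ → ℕ
  tab b = at (table b)

  open Layout w tab using (Spacing; RankFor)

  field
    spaced : Spacing (exponent n)
    ranked : ∀ {x} → x ≤ n → ∃[ κ ] RankFor (exponent n) x κ

module _ (w n e : ℕ) (n< : n < 2 ^ w) (e≤n : e ≤ n) (rs ks rs₁ ps₁ ps₂ : List ℕ)
         (small : All (λ l → All (_< 2 ^ w) l × length l ≤ suc e) (rs ∷ ks ∷ rs₁ ∷ ps₁ ∷ ps₂ ∷ []))
         (first≡0 : at rs 0 ≡ 0) (ranks≤n : ∀ i → at rs i ≤ n) (ranks-mono : ∀ {i j} → i ≤ j → j ≤ e → at rs i ≤ at rs j) where

  private
    ℓ B : ℕ
    ℓ = suc ⌊log₂ n ⌋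
    -- M representatives have at most M ℓ nodes, and a dictionary array takes at most 8 cells per
    -- node. This makes M B in all, at most `e`: no trie array is longer than the arrays of the
    -- pieces.
    B = 8 * ℓ

    B≤2^ : B ≤ 2 ^ exponent n
    B≤2^ = ≤-trans (*-monoʳ-≤ 8 (<2^suc⌊log⌋ ⌊log₂ n ⌋)) (≤-reflexive (lemma (2 ^ suc ⌊log₂ ⌊log₂ n ⌋ ⌋)))
      where
      lemma : ∀ y → 8 * y ≡ 2 * (2 * (2 * y))
      lemma = solve-∀

    ℓ≤B : ℓ ≤ B
    ℓ≤B = m≤m+n ℓ _

    e<W : e < 2 ^ w
    e<W = ≤-<-trans e≤n n<

    withTrie : (Array → List ℕ) → Array → List ℕ
    withTrie t lastIndex = e ∷ []
    withTrie t ranks     = rs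
    withTrie t kinds     = ks
    withTrie t ranks₁    = rs₁
    withTrie t poss₁     = ps₁
    withTrie t poss₂     = ps₂
    withTrie t b         = t b

    withTrie-All : ∀ {P : List ℕ → Set} {t} → P (e ∷ []) → All P (rs ∷ ks ∷ rs₁ ∷ ps₁ ∷ ps₂ ∷ []) → (∀ b → P (t b)) → ∀ b → P (withTrie t b)
    withTrie-All pe (p ∷ _)                 pt ranks         = p
    withTrie-All pe (_ ∷ p ∷ _)             pt kinds         = p
    withTrie-All pe (_ ∷ _ ∷ p ∷ _)         pt ranks₁        = p
    withTrie-All pe (_ ∷ _ ∷ _ ∷ p ∷ _)     pt poss₁         = p
    withTrie-All pe (_ ∷ _ ∷ _ ∷ _ ∷ p ∷ _) pt poss₂         = p
    withTrie-All pe ps                      pt lastIndex     = pe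
    withTrie-All pe ps                      pt reps          = pt reps
    withTrie-All pe ps                      pt spacing       = pt spacing
    withTrie-All pe ps                      pt height        = pt height
    withTrie-All pe ps                      pt topMultiplier = pt topMultiplier
    withTrie-All pe ps                      pt topShift      = pt topShift
    withTrie-All pe ps                      pt multipliers   = pt multipliers
    withTrie-All pe ps                      pt shifts        = pt shifts
    withTrie-All pe ps                      pt offsets       = pt offsets
    withTrie-All pe ps                      pt keys          = pt keys
    withTrie-All pe ps                      pt lefts         = pt lefts
    withTrie-All pe ps                      pt rights        = pt rights

    fromTrie : (t : Array → List ℕ) → (∀ b → All (_< 2 ^ w) (t b) × length (t b) ≤ suc e) →
               Layout.Spacing w (λ b → at (withTrie t b)) (exponent n) →
               (∀ {x} → x ≤ n → ∃[ κ ] Layout.RankFor w (λ b → at (withTrie t b)) (exponent n) x κ) →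
               Tables w n e rs ks rs₁ ps₁ ps₂
    fromTrie t small′ spaced ranked = record
      { table = withTrie t
      ; table< = λ b → proj₁ (all b) ; length-table = λ b → proj₂ (all b)
      ; is-lastIndex = refl ; is-ranks = refl ; is-kinds = refl ; is-ranks₁ = refl ; is-poss₁ = refl ; is-poss₂ = refl
      ; spaced = spaced ; ranked = ranked
      }
      where
      all : ∀ b → All (_< 2 ^ w) (withTrie t b) × length (withTrie t b) ≤ suc e
      all = withTrie-All (e<W ∷ [] , s≤s z≤n) small small′

  -- All pieces form a single block, and the number of representatives is read as 0 from an empty
  -- array.
  noTrie : e / B ≡ 0 → Tables w n e rs ks rs₁ ps₁ ps₂
  noTrie e/B≡0 = fromTrie (λ _ → []) (λ _ → [] , z≤n)
    (record { mB≤e = z≤n ; e< = <-≤-trans (m/n≡0⇒m<n e/B≡0) B≤2^ ; B≤2^β = z≤n ; 0<B = λ () })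
    (λ _ → 0 , record { κ≤m = z≤n ; κ-lower = ≤-trans (≤-reflexive first≡0) z≤n ; κ-upper = λ () ; trie = λ () })

  someTrie : 0 < e / B → Tables w n e rs ks rs₁ ps₁ ps₂
  someTrie 0<M = fromTrie table′ table′-small
    (record
      { mB≤e = MB≤e
      ; e< = subst₂ _<_ (sym (m≡m%n+[m/n]*n e B)) (+-comm (2 ^ exponent n) (M * B)) (+-monoˡ-< (M * B) (<-≤-trans (m%n<n e B) B≤2^))
      ; B≤2^β = B≤2^
      ; 0<B = λ _ → s≤s z≤n })
    (λ {x} x≤n → let x< = ≤-<-trans x≤n (<2^suc⌊log⌋ n) in rankOf x , record
      { κ≤m = count≤ _ M ; κ-lower = lower x x< ; κ-upper = rankOf-above x x<
      ; trie = λ _ → Layout.trieFor ℓ≤w x< (≤-trans ℓ≤B B≤2^) (s≤s z≤n) (root x x<) (rank-correct x x<) })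
    where
    open ≤-Reasoning
    M : ℕ
    M = e / B
    MB≤e : M * B ≤ e
    MB≤e = m/n*n≤m e B
    0<n : 0 < n
    0<n = ≤-trans 0<M (≤-trans (m/n≤m e B) e≤n)
    ℓ≤w : ℓ ≤ w
    ℓ≤w = 2^-cancel-< (≤-<-trans (2^⌊log⌋≤ n 0<n) n<)
    index≤ : ∀ {i} → i < M → suc i * B ≤ e
    index≤ i<M = ≤-trans (*-monoˡ-≤ B i<M) MB≤e
    lemma : ∀ a b → 8 * (a * b) ≡ a * (8 * b)
    lemma = solve-∀
    open Trie w ℓ M (λ i → at rs (suc i * B)) (λ i≤j j<M → ranks-mono (*-monoˡ-≤ B (s≤s i≤j)) (index≤ j<M))
           (λ i<M → ≤-<-trans (ranks≤n _) (<2^suc⌊log⌋ n)) (s≤s z≤n) 0<M ℓ≤w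
           (≤-<-trans (≤-trans (≤-reflexive (lemma M ℓ)) MB≤e) e<W)
           renaming (shift to topShiftValue; multipliers to multiplierList; shifts to shiftList; offsets to offsetList;
                     keys to keyList; lefts to leftList; rights to rightList)
    lower : ∀ x x< → at rs (rankOf x * B) ≤ x
    lower x x< with rankOf x | rankOf-below x x<
    ... | zero  | _ = ≤-trans (≤-reflexive first≡0) z≤n
    ... | suc i | below = below ≤-refl
    table′ : Array → List ℕ
    table′ reps          = M ∷ []
    table′ spacing       = B ∷ []
    table′ height        = ℓ ∷ []
    table′ topMultiplier = multiplier ∷ []
    table′ topShift      = topShiftValue ∷ []
    table′ multipliers   = multiplierList
    table′ shifts        = shiftList
    table′ offsets       = offsetList
    table′ keys          = keyList
    table′ lefts         = leftList
    table′ rights        = rightList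
    table′ _             = []
    B≤e : B ≤ e
    B≤e = ≤-trans (m≤n*m B M {{>-nonZero 0<M}}) MB≤e
    M<W : ∀ {v} → v ≤ M → v < 2 ^ w
    M<W v≤M = ≤-<-trans (≤-trans v≤M (m/n≤m e B)) e<W
    fits : ∀ {v} → v ≤ 8 * length nodes → v ≤ suc e
    fits v≤ = ≤-trans v≤ (≤-trans (*-monoʳ-≤ 8 length-nodes) (≤-trans (≤-reflexive (lemma M ℓ)) (≤-trans MB≤e (n≤1+n e))))
    table′-small : ∀ b → All (_< 2 ^ w) (table′ b) × length (table′ b) ≤ suc e
    table′-small reps          = M<W ≤-refl ∷ [] , s≤s z≤n
    table′-small spacing       = ≤-<-trans B≤e e<W ∷ [] , s≤s z≤n
    table′-small height        = ≤-<-trans (≤-trans ℓ≤B B≤e) e<W ∷ [] , s≤s z≤n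
    table′-small topMultiplier = multiplier< ∷ [] , s≤s z≤n
    table′-small topShift      = shift< ∷ [] , s≤s z≤n
    table′-small multipliers   = multipliers< , fits length-multipliers
    table′-small shifts        = shifts< , fits length-shifts
    table′-small offsets       = offsets< , fits length-offsets
    table′-small keys          = keys< , fits length-keys
    table′-small lefts         = All.map M<W lefts≤ , fits (≤-trans (≤-reflexive (length-map _ keyList)) length-keys)
    table′-small rights        = All.map M<W rights≤ , fits (≤-trans (≤-reflexive (length-map _ keyList)) length-keys)
    table′-small lastIndex     = [] , z≤n
    table′-small ranks         = [] , z≤n
    table′-small kinds         = [] , z≤n
    table′-small ranks₁        = [] , z≤n
    table′-small poss₁         = [] , z≤n
    table′-small poss₂         = [] , z≤n

  tables : Tables w n e rs ks rs₁ ps₁ ps₂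
  tables = byCases (e / B) refl
    where
    byCases : ∀ m → e / B ≡ m → Tables w n e rs ks rs₁ ps₁ ps₂
    byCases zero    eq = noTrie eq
    byCases (suc _) eq = someTrie (subst (0 <_) (sym eq) (s≤s z≤n))

cell-map : ∀ w {l} → All (_< 2 ^ w) l → ∀ i → value (cell (map (word w) l) i) ≡ at l i
cell-map w []       i       = trans (value-word w 0) (mod-small w (0<2^ w))
cell-map w (p ∷ ps) zero    = trans (value-word w _) (mod-small w p)
cell-map w (p ∷ ps) (suc i) = cell-map w ps i

record CharTables {σ : ℕ} (w n m : ℕ) (S₁ S₂ : Str σ) (a : Fin σ) : Set where
  field
    table        : Array → List ℕ
    table<       : ∀ b → All (_< 2 ^ w) (table b)
    length-table : ∀ b → length (table b) ≤ m * 2 + m * 2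

  tab : Array → ℕ → ℕ
  tab b = at (table b)

  open Layout w tab

  field
    spaced : Spacing (exponent n)
    ranked : ∀ {x} → x ≤ n → ∃[ κ ] RankFor (exponent n) x κ
    locate : ∀ {x p} → Select S₂ a (suc x) p → PiecesLocate S₁ a x p

module _ {σ w m : ℕ} (S₁ S₂ : Str σ) (a : Fin σ) (n< : length S₁ + length S₂ < 2 ^ w) where

  private
    n₁ n₂ n : ℕ
    n₁ = length S₁
    n₂ = length S₂
    n = n₁ + n₂

  piecesTables : ∀ E → Ascending 0 E → All (Bounded n₁ n₂) E → length E ≤ m * 2 →
                 (∀ {x p} → Select S₂ a (suc x) p → Locates S₁ a (find origin E x) x p) →
                 CharTables w n m S₁ S₂ a
  -- Nothing may be stored in this case; every read yields 0 and so describes `origin`.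
  piecesTables [] _ _ _ locates = record
    { table = λ _ → [] ; table< = λ _ → [] ; length-table = λ _ → z≤n
    ; spaced = record { mB≤e = z≤n ; e< = 0<2^ (exponent n) ; B≤2^β = z≤n ; 0<B = λ () }
    ; ranked = λ _ → 0 , record { κ≤m = z≤n ; κ-lower = z≤n ; κ-upper = λ () ; trie = λ () }
    ; locate = λ s i _ _ _ → origin , (refl , refl , refl , refl , refl) , locates s }
  piecesTables E@(_ ∷ _) ascending bounds few locates = record
    { table = T.table ; table< = T.table<
    -- The extra cell for the piece of rank 0 is paid for by `E` being nonempty.
    ; length-table = λ b → ≤-trans (T.length-table b) (+-mono-≤ (≤-trans (s≤s z≤n) few) (≤-trans (length-groundTail E) few))
    ; spaced = T.spaced ; ranked = T.ranked ; locate = locate }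
    where
    g : List Piece
    g = groundHead E ∷ groundTail E
    e : ℕ
    e = length (groundTail E)
    g-bounds : All (Bounded n₁ n₂) g
    g-bounds = ground-bounded E bounds
    g-ascending : Ascending 0 g
    g-ascending = z≤n , subst (λ r → Ascending (suc r) (groundTail E)) (sym (rank-groundHead E)) (groundTail-ascending E ascending)
    e≤n : e ≤ n
    e≤n = ≤-trans (≤-pred (ascending-length (groundTail E) (groundTail-ascending E ascending) (All.tail g-bounds) (s≤s z≤n))) (m≤n+m n₂ n₁)
    ≤n₁ : ∀ {v} → v ≤ n₁ → v < 2 ^ w
    ≤n₁ v≤ = ≤-<-trans (≤-trans v≤ (m≤m+n n₁ n₂)) n<
    ≤n₂ : ∀ {v} → v ≤ n₂ → v < 2 ^ w
    ≤n₂ v≤ = ≤-<-trans (≤-trans v≤ (m≤n+m n₂ n₁)) n<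
    small : ∀ (f : Piece → ℕ) → (∀ {p} → Bounded n₁ n₂ p → f p < 2 ^ w) → All (_< 2 ^ w) (map f g) × length (map f g) ≤ suc e
    small f f< = All.map⁺ (All.map f< g-bounds) , ≤-reflexive (length-map f g)
    module T = Tables (tables w n e n< e≤n (map rank g) (map kind g) (map rank₁ g) (map pos₁ g) (map pos₂ g)
      (small rank (≤n₂ ∘ rank≤) ∷ small kind (≤n₂ ∘ kind≤) ∷ small rank₁ (≤n₁ ∘ rank₁≤) ∷ small pos₁ (≤n₁ ∘ pos₁≤) ∷ small pos₂ (≤n₂ ∘ pos₂≤) ∷ [])
      (rank-groundHead E)
      (at-All {P = _≤ n} (All.map⁺ {f = rank} (All.map (λ b → ≤-trans (rank≤ b) (m≤n+m n₂ n₁)) g-bounds)) z≤n)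
      (λ {i} {j} i≤j j≤e → subst₂ _≤_ (sym (at-map-nth rank refl g i)) (sym (at-map-nth rank refl g j)) (nth-mono g g-ascending i≤j (s≤s j≤e))))
    at-nth : ∀ {b} (f : Piece → ℕ) → f origin ≡ 0 → T.table b ≡ map f g → ∀ i → T.tab b i ≡ f (nth g i)
    at-nth f f0 eq i = trans (cong (λ l → at l i) eq) (at-map-nth f f0 g i)
    last≡ : T.tab lastIndex 0 ≡ e
    last≡ = cong (λ l → at l 0) T.is-lastIndex
    locate : ∀ {x p} → Select S₂ a (suc x) p → Layout.PiecesLocate w T.tab S₁ a x p
    locate {x} {p} s i i≤ ≤x last =
      nth g i , (at-nth rank refl T.is-ranks i , at-nth kind refl T.is-kinds i , at-nth rank₁ refl T.is-ranks₁ i ,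
                 at-nth pos₁ refl T.is-poss₁ i , at-nth pos₂ refl T.is-poss₂ i) ,
      subst (λ q → Locates S₁ a q x p) (trans (find-ground E x) (find-nth (groundHead E) (groundTail E) (proj₂ g-ascending)
        (subst (i ≤_) last≡ i≤) (subst (_≤ x) (at-nth rank refl T.is-ranks i) ≤x) (position last))) (locates s)
      where
      position : i ≡ T.tab lastIndex 0 ⊎ x < T.tab ranks (suc i) → i ≡ e ⊎ x < rank (nth g (suc i))
      position (inj₁ i≡) = inj₁ (trans i≡ last≡)
      position (inj₂ x<) = inj₂ (subst (x <_) (at-nth rank refl T.is-ranks (suc i)) x<)

  charTables : Alignment m S₁ S₂ → CharTables w n m S₁ S₂ a
  charTables al = piecesTables (pieces a al) (pieces-ascending a al) (pieces-bounded a al) (length-pieces a al) (pieces-locate a al)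

-- Assembly for the whole alphabet

index : Array → Fin 17
index lastIndex     = # 0
index reps          = # 1
index spacing       = # 2
index height        = # 3
index topMultiplier = # 4
index topShift      = # 5
index ranks         = # 6
index kinds         = # 7
index ranks₁        = # 8
index poss₁         = # 9
index poss₂         = # 10
index multipliers   = # 11
index shifts        = # 12
index offsets       = # 13
index keys          = # 14
index lefts         = # 15
index rights        = # 16

arrays : Vec Array 17
arrays = lastIndex ∷ reps ∷ spacing ∷ height ∷ topMultiplier ∷ topShift ∷ ranks ∷ kinds ∷ ranks₁ ∷ poss₁ ∷ poss₂ ∷
         multipliers ∷ shifts ∷ offsets ∷ keys ∷ lefts ∷ rights ∷ []

arrays-index : ∀ b → Vec.lookup arrays (index b) ≡ b
arrays-index lastIndex     = refl
arrays-index reps          = refl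
arrays-index spacing       = refl
arrays-index height        = refl
arrays-index topMultiplier = refl
arrays-index topShift      = refl
arrays-index ranks         = refl
arrays-index kinds         = refl
arrays-index ranks₁        = refl
arrays-index poss₁         = refl
arrays-index poss₂         = refl
arrays-index multipliers   = refl
arrays-index shifts        = refl
arrays-index offsets       = refl
arrays-index keys          = refl
arrays-index lefts         = refl
arrays-index rights        = refl

sum-map≤ : ∀ {A : Set} (xs : List A) {f : A → ℕ} {c} → (∀ x → f x ≤ c) → sum (map f xs) ≤ length xs * c
sum-map≤ []       h = z≤n
sum-map≤ (x ∷ xs) h = +-mono-≤ (h x) (sum-map≤ xs h)

words≤ : ∀ {k w c} (D : Store k w) → (∀ b → length (D b) ≤ c) → words D ≤ k * c
words≤ {k} {c = c} D h = ≤-trans (sum-map≤ (allFin k) h) (≤-reflexive (cong (_* c) (length-tabulate {n = k} (λ i → i))))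

module Solution (σ : ℕ) where

  arr : Fin σ → Array → Fin (σ * 17)
  arr a b = combine a (index b)

  program : Fin σ → Program σ (σ * 17)
  program a = Query.query (arr a) a

  -- Shared by space and time: each character has 17 arrays of at most 8d cells, and 175 is the time
  -- of a query when the iterated logarithm is 0.
  constant : ℕ
  constant = σ * 17 * 8 + 175

  module _ (w : ℕ) (S₁ S₂ : Str σ) (d : ℕ) (n< : length S₁ + length S₂ < 2 ^ w) (edits : S₁ ⇝[ d ] S₂) where

    n : ℕ
    n = length S₁ + length S₂

    char : ∀ a → CharTables w n (d * 2) S₁ S₂ a
    char a = charTables S₁ S₂ a n< (alignment edits)

    store : Store (σ * 17) w
    store q = map (word w) (CharTables.table (char (proj₁ (remQuot 17 q))) (Vec.lookup arrays (proj₂ (remQuot {σ} 17 q))))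

    store-size : words store ≤ constant * d
    store-size = begin
      words store                   ≤⟨ words≤ store (λ q → ≤-trans (≤-reflexive (length-map (word w) (CharTables.table (char (proj₁ (remQuot 17 q))) _)))
                                         (CharTables.length-table (char (proj₁ (remQuot 17 q))) _)) ⟩
      σ * 17 * (d * 2 * 2 + d * 2 * 2) ≡⟨ lemma (σ * 17) d ⟩
      σ * 17 * 8 * d                ≤⟨ *-monoˡ-≤ d (m≤m+n (σ * 17 * 8) 175) ⟩
      constant * d                  ∎
      where
      open ≤-Reasoning
      lemma : ∀ s d → s * (d * 2 * 2 + d * 2 * 2) ≡ s * 8 * d
      lemma = solve-∀

    store-arr : ∀ a b → store (arr a b) ≡ map (word w) (CharTables.table (char a) b)
    store-arr a b = trans
      (cong (λ (q : Fin σ × Fin 17) → map (word w) (CharTables.table (char (proj₁ q)) (Vec.lookup arrays (proj₂ q)))) (remQuot-combine a (index b)))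
      (cong (λ b → map (word w) (CharTables.table (char a) b)) (arrays-index b))

    answers : ∀ a → AnswersSelect S₁ S₂ store (program a) a (constant * (1 + ⌊log₂ ⌊log₂ n ⌋ ⌋)) 1
    answers a j p s = byValue (value j) refl
      where
      open CharTables (char a)
      suc<2^w : ∀ x → value j ≡ suc x → suc x < 2 ^ w
      suc<2^w x e = subst (_< 2 ^ w) e (toℕ<n _)
      open ≤-Reasoning
      time≤ : 8 + (24 + exponent n * 22 + (1 + (2 + (1 + exponent n * 10 + 11)))) ≤ constant * (1 + ⌊log₂ ⌊log₂ n ⌋ ⌋)
      time≤ = begin
        8 + (24 + exponent n * 22 + (1 + (2 + (1 + exponent n * 10 + 11)))) ≡⟨ lemma ⌊log₂ ⌊log₂ n ⌋ ⌋ ⟩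
        175 + 32 * c                                  ≤⟨ +-monoʳ-≤ 175 (*-monoˡ-≤ c {32} {175} (≤ᵇ⇒≤ 32 175 _)) ⟩
        175 + 175 * c                                 ≡⟨ *-suc 175 c ⟨
        175 * (1 + c)                                 ≤⟨ *-monoˡ-≤ (1 + c) (m≤n+m 175 (σ * 17 * 8)) ⟩
        constant * (1 + c)                            ∎
        where
        c = ⌊log₂ ⌊log₂ n ⌋ ⌋
        lemma : ∀ c → 8 + (24 + (4 + c) * 22 + (1 + (2 + (1 + (4 + c) * 10 + 11)))) ≡ 175 + 32 * c
        lemma = solve-∀
      byValue : ∀ v → value j ≡ v → ∃[ ρ ] ∃[ t ] ∃[ q ] (Run S₁ store (program a) (input j) ρ t q × value (ρ 0) ≡ p ×
                  t ≤ constant * (1 + ⌊log₂ ⌊log₂ n ⌋ ⌋) × q ≤ 1)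
      byValue zero    e = ⊥-elim (¬select-zero (subst (λ v → Select S₂ a v p) e s))
      byValue (suc x) e =
        let s′ = subst (λ v → Select S₂ a v p) e s
            p≤ = ≤-trans (select-pos≤ s′) (m≤n+m _ (length S₁))
            x≤ = ≤-trans (n≤1+n x) (≤-trans (select-rank≤ s′) p≤)
            κ , rank-ok = ranked x≤
            ρ , f , t , q , r , ρ∼ , f≡ , t≤ , q≤ = Execution.Exec.run (Query.Correct.query-exec (arr a) a S₁ store tab
              (λ b i → trans (cong (λ l → value (cell l i)) (store-arr a b)) (cell-map w (table< b) i))
              x (suc<2^w x e) (exponent n) κ p (≤-<-trans (m≤m+n _ _) n<) (≤-<-trans p≤ n<) spaced rank-ok (locate s′)) (input j) initially
        in ρ , t , q , r , trans (ρ∼ 0) f≡ , ≤-trans t≤ time≤ , q≤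
        where
        initially : ∀ r → value (input j r) ≡ upd (λ _ → 0) 0 (suc x) r
        initially zero    = e
        initially (suc r) = trans (value-word w 0) (mod-small w (0<2^ w))

theorem1 : (σ : ℕ) →
    ∃[ k ] Σ[ query ∈ (Fin σ → Program σ k) ] ∃[ C ]
    (∀ (w : ℕ) (S₁ S₂ : Str σ) (d : ℕ) →
    let n = length S₁ + length S₂ in
    n < 2 ^ w →
    IsEditDistance S₁ S₂ d →
    Σ[ D ∈ Store k w ]
    (words D ≤ C * d ×
    (∀ (a : Fin σ) →
    AnswersSelect S₁ S₂ D (query a) a (C * (1 + ⌊log₂ ⌊log₂ n ⌋ ⌋)) 1)))
theorem1 σ = σ * 17 , program , constant , λ w S₁ S₂ d n< (edits , _) →
  store w S₁ S₂ d n< edits , store-size w S₁ S₂ d n< edits , answers w S₁ S₂ d n< edits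
  where open Solution σ
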